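{- Let $K$ be a field and $\tau$ a field topology on $K$ that is bronze t-henselian (bt-henselian). Then $K$ is large.
   Context: A field topology on $K$ is a Hausdorff, non-discrete topology on $K$ in which addition, negation, multiplication and inversion (on $K^\times$) are continuous. Let $K[X]^d_1$ be the set of monic polynomials of degree $d$ over $K$, topologized by identification with $K^d$ via coefficients. $\tau$ is bronze t-henselian if: whenever $Q\in K[X]^d_1$ is separable and has a root in $K$, there is a neighborhood $V$ of $Q$ in $K[X]^d_1$ such that every $P\in V$ has a root in $K$. $K$ is large if for every polynomial $P(x,y)\in K[x,y]$ and $(a,b)\in K^2$ with $P(a,b)=0\neq\frac{\partial P}{\partial y}(a,b)$, the set $\{(x,y)\in K^2:P(x,y)=0\}$ is infinite. -}

module Defs where

open import Level using (Level; _⊔_; Lift) renaming (suc to lsuc)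
open import Algebra.Bundles using (CommutativeRing)
open import Data.Nat using (ℕ; zero; suc)
open import Data.Fin using (Fin)
open import Data.Vec using (Vec; lookup; toList)
open import Data.List using (List; []; _∷_; map; _++_)
open import Data.List.Relation.Unary.All using (All)
open import Data.List.Relation.Unary.Any using (Any)
open import Data.Product using (Σ; ∃; _×_; _,_)
open import Data.Unit using (⊤)
open import Data.Empty using (⊥)
open import Relation.Nullary using (¬_)
open import Relation.Unary using (Pred)

record Field (c ℓ : Level) : Set (lsuc (c ⊔ ℓ)) where
  field
    commutativeRing : CommutativeRing c ℓ
  open CommutativeRing commutativeRing public
  field
    0≉1     : ¬ (0# ≈ 1#)
    inverse : ∀ x → ¬ (x ≈ 0#) → ∃ λ y → x * y ≈ 1#

-- Polynomial arithmetic over a field.  A polynomial in one variable is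
-- its coefficient list  a₀ ∷ a₁ ∷ … (so  a₀ + a₁ X + …).

module Poly {c ℓ} (K : Field c ℓ) where
  open Field K

  Pol : Set c
  Pol = List Carrier

  natMul : ℕ → Carrier → Carrier
  natMul zero    a = 0#
  natMul (suc n) a = a + natMul n a

  addP : Pol → Pol → Pol
  addP []       q        = q
  addP (a ∷ p)  []       = a ∷ p
  addP (a ∷ p)  (b ∷ q)  = (a + b) ∷ addP p q

  negP : Pol → Pol
  negP = map (-_)

  scaleP : Carrier → Pol → Pol
  scaleP a = map (a *_)

  mulP : Pol → Pol → Pol
  mulP []      q = []
  mulP (a ∷ p) q = addP (scaleP a q) (0# ∷ mulP p q)

  evalP : Pol → Carrier → Carrier
  evalP []      x = 0#
  evalP (a ∷ p) x = a + x * evalP p x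

  derivAux : ℕ → Pol → Pol
  derivAux n []      = []
  derivAux n (a ∷ p) = natMul n a ∷ derivAux (suc n) p

  derivP : Pol → Pol
  derivP []      = []
  derivP (a ∷ p) = derivAux 1 p

  IsZeroP : Pol → Set (c ⊔ ℓ)
  IsZeroP p = All (_≈ 0#) p

  _≈ᴾ_ : Pol → Pol → Set (c ⊔ ℓ)
  p ≈ᴾ q = IsZeroP (addP p (negP q))

  Separable : Pol → Set (c ⊔ ℓ)
  Separable p = ∃ λ A → ∃ λ B → addP (mulP A p) (mulP B (derivP p)) ≈ᴾ (1# ∷ [])

  HasRoot : Pol → Set (c ⊔ ℓ)
  HasRoot p = ∃ λ x → evalP p x ≈ 0#

  -- the monic polynomial of degree d with lower coefficients c₀ … c_{d-1}
  -- (identification of K[X]^d_1 with K^d)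
  monic : ∀ {d} → Vec Carrier d → Pol
  monic cs = toList cs ++ (1# ∷ [])

  -- polynomials in two variables x, y:  P = Σ_j P_j(x) y^j
  Pol2 : Set c
  Pol2 = List Pol

  eval2 : Pol2 → Carrier → Carrier → Carrier
  eval2 P a b = evalP (map (λ p → evalP p a) P) b

  dyAux : ℕ → Pol2 → Pol2
  dyAux n []      = []
  dyAux n (p ∷ P) = map (natMul n) p ∷ dyAux (suc n) P

  ∂y : Pol2 → Pol2
  ∂y []      = []
  ∂y (p ∷ P) = dyAux 1 P

record FieldTopology {c ℓ} (K : Field c ℓ) (t : Level) : Set (c ⊔ ℓ ⊔ lsuc t) where
  open Field K
  field
    IsOpen    : Pred Carrier t → Set t
    -- opens are subsets of the setoid, i.e. closed under ≈
    open-resp : ∀ {U} → IsOpen U → ∀ {x y} → x ≈ y → U x → U y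
    univ-open : IsOpen (λ _ → Lift t ⊤)
    ∩-open    : ∀ {U V} → IsOpen U → IsOpen V → IsOpen (λ x → U x × V x)
    ⋃-open    : ∀ {I : Set t} (U : I → Pred Carrier t) →
                (∀ i → IsOpen (U i)) → IsOpen (λ x → ∃ λ i → U i x)
    hausdorff : ∀ x y → ¬ (x ≈ y) →
                ∃ λ U → ∃ λ V → IsOpen U × IsOpen V × U x × V y ×
                  (∀ z → U z → V z → ⊥)
    nonDiscrete : ¬ (∀ x → ∃ λ U → IsOpen U × U x × (∀ y → U y → y ≈ x))
    +-cont : ∀ x y U → IsOpen U → U (x + y) →
             ∃ λ V → ∃ λ W → IsOpen V × IsOpen W × V x × W y ×
               (∀ x' y' → V x' → W y' → U (x' + y'))
    *-cont : ∀ x y U → IsOpen U → U (x * y) →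
             ∃ λ V → ∃ λ W → IsOpen V × IsOpen W × V x × W y ×
               (∀ x' y' → V x' → W y' → U (x' * y'))
    neg-cont : ∀ x U → IsOpen U → U (- x) →
               ∃ λ V → IsOpen V × V x × (∀ x' → V x' → U (- x'))
    inv-cont : ∀ x z U → ¬ (x ≈ 0#) → x * z ≈ 1# → IsOpen U → U z →
               ∃ λ V → IsOpen V × V x ×
                 (∀ x' → V x' → ¬ (x' ≈ 0#) × (∀ z' → x' * z' ≈ 1# → U z'))

BtHenselian : ∀ {c ℓ t} (K : Field c ℓ) → FieldTopology K t → Set (c ⊔ ℓ ⊔ lsuc t)
BtHenselian {t = t} K τ =
  ∀ (d : ℕ) (q : Vec Carrier d) → Separable (monic q) → HasRoot (monic q) →
  -- a neighbourhood of q in K^d (product topology): contains a basic box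
  ∃ λ (U : Fin d → Pred Carrier t) → (∀ i → IsOpen (U i)) × (∀ i → U i (lookup q i)) ×
    (∀ (p : Vec Carrier d) → (∀ i → U i (lookup p i)) → HasRoot (monic p))
  where
    open Field K
    open Poly K
    open FieldTopology τ

FiniteSubset : ∀ {c ℓ p} (K : Field c ℓ) → (Field.Carrier K → Field.Carrier K → Set p) → Set (c ⊔ ℓ ⊔ p)
FiniteSubset K S = ∃ λ (L : List (Carrier × Carrier)) →
  ∀ x y → S x y → Any (λ { (u , v) → (x ≈ u) × (y ≈ v) }) L
  where open Field K

Large : ∀ {c ℓ} (K : Field c ℓ) → Set (c ⊔ ℓ)
Large K = ∀ (P : Pol2) (a b : Carrier) → eval2 P a b ≈ 0# → ¬ (eval2 (∂y P) a b ≈ 0#) →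
  ¬ FiniteSubset K (λ x y → eval2 P x y ≈ 0#)
  where
    open Field K
    open Poly K

{-# OPTIONS --safe #-}
-- Move the smooth point to the origin and shear, so that the curve is P(x, y) = 0 with P monic in x
-- and ∂P/∂y ≠ 0 at the origin.  Bt-henselianity would apply to F(y) = P(w(y), y), w(0) = 0, if F were
-- separable: perturbing w to w + s keeps a root y for all small s, and the point (w(y) + s, y) of the
-- curve determines s, so a neighbourhood of 0 would be finite if the curve had finitely many points.
--
-- To make F separable take w = α yᵏ / t with t′ = 0, so that y F′ is, up to a power of t, the value at
-- x = w of D P, where D = y ∂/∂y + k x ∂/∂x.  By Gauss's lemma P may be replaced by a factor through the
-- origin that is coprime to D P over K(y), which gives S(y) ≠ 0 in the ideal (P, D P).  A common root of
-- F and F′ is then a root of S; it is not 0, since F′(0) ≠ 0.  The other roots of S are avoided in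
-- characteristic p by putting them among the poles of w (t a p-th power, p ∣ k; at a pole the leading
-- term of P dominates), and in characteristic 0 by a generic constant α (t = 1, k ≥ 2).
--
-- The equality of K is neither decidable nor stable, so K need not be infinite even up to double
-- negation; hence polynomials are compared by coefficients, never by values, and the reasoning takes
-- place under ¬¬.

module Submission where

open import Defs
open import Level using (Level; _⊔_; Lift; lift) renaming (suc to lsuc)
open import Algebra.Bundles using (CommutativeRing; RawRing)
open import Algebra.Solver.Ring.AlmostCommutativeRing using (_-Raw-AlmostCommutative⟶_; fromCommutativeRing)
import Algebra.Solver.Ring
import Algebra.Properties.Semiring.Mult.TCOptimised as NaturalMultiples
import Algebra.Properties.Ring as RingProperties
open import Data.Nat.Base as ℕ using (ℕ; zero; suc; _≤_; _<_; z≤n; s≤s)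
import Data.Nat.Properties as ℕₚ
open import Data.Fin.Base as Fin using (Fin; toℕ)
open import Data.Vec.Base as Vec using (Vec)
import Data.Vec.Properties as Vecₚ
open import Data.Product using (Σ; ∃; _×_; _,_; proj₁; proj₂)
open import Data.Sum as Sum using (_⊎_; inj₁; inj₂)
open import Data.Empty using (⊥; ⊥-elim)
open import Data.Unit using (⊤; tt)
open import Data.List.Base as List using (List; []; _∷_; length; _++_)
open import Data.List.Relation.Unary.All as All using (All; []; _∷_)
open import Data.List.Relation.Unary.Any as Any using (Any; here; there)
import Data.List.Relation.Unary.Any.Properties as Anyₚ
open import Data.List.Relation.Binary.Pointwise as Pointwise using (Pointwise; Pointwise-length)
open import Data.Maybe.Base using (Maybe; just; nothing)
open import Relation.Nullary using (¬_; yes; no)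
open import Relation.Unary using (Pred)
open import Relation.Binary.Definitions using (tri<; tri≈; tri>)
open import Relation.Binary.PropositionalEquality as ≡ using (_≡_)
import Relation.Binary.Reflection as Reflection
import Relation.Binary.Reasoning.Setoid as SetoidReasoning

-- The order of the choices is what makes them possible. Since `x = α y ^ k` satisfies `θ x = k x`
-- for `θ = y d/dy`, and `θ t = 0`, the derivation `D`, and with it the eliminant `S`, depends on
-- `w` only through the image of `k` in `K`. In characteristic p this image is 0, so `t` and the
-- size of `k` may be chosen after `S`. In characteristic 0 the exponent has to be fixed before `S`
-- is known, and only `α` is free afterwards. The exponent is at least 2 so that `w` does not
-- contribute to `F′(0)`. It is also large compared with the degrees of `t` and of the coefficients
-- of `P`, so that `t ^ n P (w + s, y)` keeps its degree and its leading coefficient for all `s`;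
-- bt-henselianity concerns monic polynomials of one fixed degree. `P` may be inseparable in `x`, so
-- `∂P/∂x` alone would not do: that `P` does not divide `D P` comes from `∂P/∂y ≠ 0` at the origin.
-- Common roots are handled without an algebraic closure, in the quotient `K[y] / (F, F′)`.

infixl 1 _>>=_
_>>=_ : ∀ {a b} {A : Set a} {B : Set b} → ¬ ¬ A → (A → ¬ ¬ B) → ¬ ¬ B
(m >>= f) k = m (λ a → f a k)

return : ∀ {a} {A : Set a} → A → ¬ ¬ A
return a k = k a

lem : ∀ {a} (A : Set a) → ¬ ¬ (A ⊎ ¬ A)
lem A k = k (inj₂ (λ a → k (inj₁ a)))

least : ∀ {p} (P : ℕ → Set p) n → P n → ¬ ¬ (∃ λ m → P m × ∀ i → i < m → ¬ P i)
least P n = go n n ℕₚ.≤-refl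
  where
  go : ∀ b n → n ≤ b → P n → ¬ ¬ (∃ λ m → P m × ∀ i → i < m → ¬ P i)
  go b n n≤b pn = lem (∃ λ i → i < n × P i) >>= Sum.[ smaller b n≤b , minimal ]
    where
    smaller : ∀ b → n ≤ b → (∃ λ i → i < n × P i) → ¬ ¬ (∃ λ m → P m × ∀ i → i < m → ¬ P i)
    smaller zero    z≤n (i , () , pi)
    smaller (suc b) n≤b (i , i<n , pi) = go b i (ℕₚ.≤-pred (ℕₚ.≤-trans i<n n≤b)) pi
    minimal : ¬ (∃ λ i → i < n × P i) → ¬ ¬ (∃ λ m → P m × ∀ i → i < m → ¬ P i)
    minimal none = return (n , pn , λ i i<n pi → none (i , i<n , pi))

-- Powers and ring identities.

power : ∀ {c} {C : Set c} → (C → C → C) → C → C → ℕ → C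
power _*_ 1# x zero    = 1#
power _*_ 1# x (suc n) = x * power _*_ 1# x n

-- The library's powers depend on the equality of the ring as well, so they are not
-- definitionally the same in a ring and in its quotients.
module Powers {c ℓ} (R : CommutativeRing c ℓ) where
  infixr 8 _^_
  _^_ : CommutativeRing.Carrier R → ℕ → CommutativeRing.Carrier R
  _^_ = power (CommutativeRing._*_ R) (CommutativeRing.1# R)

-- The normal form of the integer `a − b`, with at least one component zero; it keeps the
-- coefficients inside the solver small, and 0 and 1 in the form that denotes without a subtraction.
reduce : ℕ → ℕ → ℕ × ℕ
reduce zero    b       = 0 , b
reduce (suc a) zero    = suc a , 0
reduce (suc a) (suc b) = reduce a b

reduce-≡ : ∀ a b → a ℕ.+ proj₂ (reduce a b) ≡ proj₁ (reduce a b) ℕ.+ b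
reduce-≡ zero    b       = ≡.refl
reduce-≡ (suc a) zero    = ≡.refl
reduce-≡ (suc a) (suc b) = ≡.trans (≡.cong suc (reduce-≡ a b)) (≡.sym (ℕₚ.+-suc _ b))

infixl 6 _:+_
infixl 7 _:*_
infix 8 :-_
infix 4 _:=_

-- A syntax independent of the ring, so that the same constructors serve all the rings that occur;
-- the polynomials of a solver instance belong to one ring each.
data Expr (n : ℕ) : Set where
  var       : Fin n → Expr n
  :0 :1     : Expr n
  _:+_ _:*_ : Expr n → Expr n → Expr n
  :-_       : Expr n → Expr n

_:=_ : ∀ {n} → Expr n → Expr n → Expr n × Expr n
_:=_ = _,_

-- A ring solver with coefficients in ℤ: the pair (m , n) stands for m − n.  The split on n
-- makes the coefficients 0 and 1 denote 0# and 1# definitionally.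
module RingSolver {c ℓ} (R : CommutativeRing c ℓ) where
  open CommutativeRing R
  open NaturalMultiples semiring using (×-homo-+; ×1-homo-*; ×-cong) renaming (_×_ to _×′_)
  open RingProperties ring using (-0#≈0#; -‿distribˡ-*; -‿distribʳ-*; -‿+-comm; -‿involutive)
  open import Relation.Binary.Reasoning.Setoid setoid
  private
    Coeff : RawRing _ _
    Coeff = record
      { Carrier = ℕ × ℕ
      ; _≈_ = _≡_
      ; _+_ = λ (a , b) (c , d) → reduce (a ℕ.+ c) (b ℕ.+ d)
      ; _*_ = λ (a , b) (c , d) → reduce (a ℕ.* c ℕ.+ b ℕ.* d) (a ℕ.* d ℕ.+ b ℕ.* c)
      ; -_ = λ (a , b) → b , a
      ; 0# = 0 , 0
      ; 1# = 1 , 0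
      }

    ⟦_⟧ : ℕ × ℕ → Carrier
    ⟦ a , zero ⟧  = a ×′ 1#
    ⟦ a , suc b ⟧ = a ×′ 1# + - (suc b ×′ 1#)

    val : ∀ a b → ⟦ a , b ⟧ ≈ a ×′ 1# + - (b ×′ 1#)
    val a zero    = sym (trans (+-congˡ -0#≈0#) (+-identityʳ _))
    val a (suc b) = refl

    interchange : ∀ a b c d → (a + b) + (c + d) ≈ (a + c) + (b + d)
    interchange a b c d = begin
      (a + b) + (c + d) ≈⟨ +-assoc a b _ ⟩
      a + (b + (c + d)) ≈⟨ +-congˡ (sym (+-assoc b c d)) ⟩
      a + ((b + c) + d) ≈⟨ +-congˡ (+-congʳ (+-comm b c)) ⟩
      a + ((c + b) + d) ≈⟨ +-congˡ (+-assoc c b d) ⟩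
      a + (c + (b + d)) ≈⟨ sym (+-assoc a c _) ⟩
      (a + c) + (b + d) ∎

    cancel : ∀ a b → a + - b + b ≈ a
    cancel a b = trans (+-assoc a _ b) (trans (+-congˡ (-‿inverseˡ b)) (+-identityʳ a))

    equal : ∀ a b c d → a ℕ.+ d ≡ c ℕ.+ b → ⟦ a , b ⟧ ≈ ⟦ c , d ⟧
    equal a b c d eq = begin
      ⟦ a , b ⟧                     ≈⟨ val a b ⟩
      A + - B                       ≈⟨ sym (cancel _ D) ⟩
      A + - B + - D + D             ≈⟨ +-comm _ D ⟩
      D + (A + - B + - D)           ≈⟨ +-congˡ (+-assoc A _ _) ⟩
      D + (A + (- B + - D))         ≈⟨ sym (+-assoc D A _) ⟩
      D + A + (- B + - D)           ≈⟨ +-congʳ (+-comm D A) ⟩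
      A + D + (- B + - D)           ≈⟨ +-congʳ (sym (×-homo-+ 1# a d)) ⟩
      (a ℕ.+ d) ×′ 1# + (- B + - D) ≈⟨ +-congʳ (×-cong eq refl) ⟩
      (c ℕ.+ b) ×′ 1# + (- B + - D) ≈⟨ +-congʳ (×-homo-+ 1# c b) ⟩
      C + B + (- B + - D)           ≈⟨ +-assoc C B _ ⟩
      C + (B + (- B + - D))         ≈⟨ +-congˡ (sym (+-assoc B _ _)) ⟩
      C + (B + - B + - D)           ≈⟨ +-congˡ (+-congʳ (-‿inverseʳ B)) ⟩
      C + (0# + - D)                ≈⟨ +-congˡ (+-identityˡ _) ⟩
      C + - D                       ≈⟨ sym (val c d) ⟩
      ⟦ c , d ⟧                     ∎
      where
      A = a ×′ 1#
      B = b ×′ 1#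
      C = c ×′ 1#
      D = d ×′ 1#

    reduced : ∀ a b → ⟦ reduce a b ⟧ ≈ ⟦ a , b ⟧
    reduced a b = sym (equal a b _ _ (reduce-≡ a b))

    +-homo′ : ∀ p q → ⟦ proj₁ p ℕ.+ proj₁ q , proj₂ p ℕ.+ proj₂ q ⟧ ≈ ⟦ p ⟧ + ⟦ q ⟧
    +-homo′ (a , b) (c , d) = begin
      ⟦ a ℕ.+ c , b ℕ.+ d ⟧                                ≈⟨ val (a ℕ.+ c) (b ℕ.+ d) ⟩
      (a ℕ.+ c) ×′ 1# + - ((b ℕ.+ d) ×′ 1#)
          ≈⟨ +-cong (×-homo-+ 1# a c) (-‿cong (×-homo-+ 1# b d)) ⟩
      (a ×′ 1# + c ×′ 1#) + - (b ×′ 1# + d ×′ 1#)          ≈⟨ +-congˡ (sym (-‿+-comm _ _)) ⟩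
      (a ×′ 1# + c ×′ 1#) + (- (b ×′ 1#) + - (d ×′ 1#))    ≈⟨ interchange _ _ _ _ ⟩
      (a ×′ 1# + - (b ×′ 1#)) + (c ×′ 1# + - (d ×′ 1#))    ≈⟨ +-cong (sym (val a b)) (sym (val c d)) ⟩
      ⟦ a , b ⟧ + ⟦ c , d ⟧                                ∎

    *-homo′ : ∀ p q → ⟦ proj₁ p ℕ.* proj₁ q ℕ.+ proj₂ p ℕ.* proj₂ q , proj₁ p ℕ.* proj₂ q ℕ.+ proj₂ p ℕ.* proj₁
        q ⟧ ≈ ⟦ p ⟧ * ⟦ q ⟧
    *-homo′ (a , b) (c , d) = begin
      ⟦ a ℕ.* c ℕ.+ b ℕ.* d , a ℕ.* d ℕ.+ b ℕ.* c ⟧         ≈⟨ val _ (a ℕ.* d ℕ.+ b ℕ.* c) ⟩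
      (a ℕ.* c ℕ.+ b ℕ.* d) ×′ 1# + - ((a ℕ.* d ℕ.+ b ℕ.* c) ×′ 1#)
        ≈⟨ +-cong (hom a c b d) (-‿cong (hom a d b c)) ⟩
      (A * C + B * D) + - (A * D + B * C)                   ≈⟨ +-congˡ (sym (-‿+-comm _ _)) ⟩
      (A * C + B * D) + (- (A * D) + - (B * C))             ≈⟨ interchange _ _ _ _ ⟩
      (A * C + - (A * D)) + (B * D + - (B * C))             ≈⟨ +-congˡ (+-comm _ _) ⟩
      (A * C + - (A * D)) + (- (B * C) + B * D)
        ≈⟨ +-cong (+-congˡ (-‿distribʳ-* A D)) (+-cong (-‿distribˡ-* B C) bd) ⟩
      (A * C + A * - D) + (- B * C + - B * - D)
          ≈⟨ +-cong (sym (distribˡ A C _)) (sym (distribˡ _ C _)) ⟩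
      A * (C + - D) + - B * (C + - D)                       ≈⟨ sym (distribʳ _ A _) ⟩
      (A + - B) * (C + - D)                                 ≈⟨ *-cong (sym (val a b)) (sym (val c d)) ⟩
      ⟦ a , b ⟧ * ⟦ c , d ⟧                                 ∎
      where
      A = a ×′ 1#
      B = b ×′ 1#
      C = c ×′ 1#
      D = d ×′ 1#
      hom : ∀ a c b d → (a ℕ.* c ℕ.+ b ℕ.* d) ×′ 1# ≈ (a ×′ 1#) * (c ×′ 1#) + (b ×′ 1#) * (d ×′ 1#)
      hom a c b d = trans (×-homo-+ 1# (a ℕ.* c) (b ℕ.* d)) (+-cong (×1-homo-* a c) (×1-homo-* b d))
      bd : B * D ≈ - B * - D
      bd = begin
        B * D         ≈⟨ sym (-‿involutive _) ⟩
        - - (B * D)   ≈⟨ -‿cong (-‿distribʳ-* B D) ⟩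
        - (B * - D)   ≈⟨ -‿distribˡ-* B _ ⟩
        - B * - D     ∎

    -‿homo′ : ∀ p → ⟦ proj₂ p , proj₁ p ⟧ ≈ - ⟦ p ⟧
    -‿homo′ (a , b) = begin
      ⟦ b , a ⟧                   ≈⟨ val b a ⟩
      b ×′ 1# + - (a ×′ 1#)       ≈⟨ +-congʳ (sym (-‿involutive _)) ⟩
      - - (b ×′ 1#) + - (a ×′ 1#) ≈⟨ -‿+-comm _ _ ⟩
      - (- (b ×′ 1#) + a ×′ 1#)   ≈⟨ -‿cong (+-comm _ _) ⟩
      - (a ×′ 1# + - (b ×′ 1#))   ≈⟨ -‿cong (sym (val a b)) ⟩
      - ⟦ a , b ⟧                 ∎

    morphism : Coeff -Raw-AlmostCommutative⟶ fromCommutativeRing R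
    morphism = record
      { ⟦_⟧ = ⟦_⟧ ; +-homo = λ p@(a , b) q@(c , d) → trans (reduced (a ℕ.+ c) (b ℕ.+ d)) (+-homo′ p q)
      ; *-homo = λ p@(a , b) q@(c , d) → trans (reduced (a ℕ.* c ℕ.+ b ℕ.* d) (a ℕ.* d ℕ.+ b ℕ.* c))
          (*-homo′ p q)
      ; -‿homo = -‿homo′
      ; 0-homo = refl ; 1-homo = refl }

    equal? : ∀ p q → Maybe (⟦ p ⟧ ≈ ⟦ q ⟧)
    equal? (a , b) (c , d) with a ℕ.+ d ℕₚ.≟ c ℕ.+ b
    ... | no _   = nothing
    ... | yes eq = just (equal a b c d eq)

    module Solver = Algebra.Solver.Ring Coeff (fromCommutativeRing R) morphism equal?

    ⟦_⟧ᴱ : ∀ {n} → Expr n → Vec Carrier n → Carrier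
    ⟦ var i ⟧ᴱ  ρ = Vec.lookup ρ i
    ⟦ :0 ⟧ᴱ     ρ = 0#
    ⟦ :1 ⟧ᴱ     ρ = 1#
    ⟦ e :+ f ⟧ᴱ ρ = ⟦ e ⟧ᴱ ρ + ⟦ f ⟧ᴱ ρ
    ⟦ e :* f ⟧ᴱ ρ = ⟦ e ⟧ᴱ ρ * ⟦ f ⟧ᴱ ρ
    ⟦ :- e ⟧ᴱ   ρ = - ⟦ e ⟧ᴱ ρ

    translate : ∀ {n} → Expr n → Solver.Polynomial n
    translate (var i)  = Solver.var i
    translate :0       = Solver.con (0 , 0)
    translate :1       = Solver.con (1 , 0)
    translate (e :+ f) = translate e Solver.:+ translate f
    translate (e :* f) = translate e Solver.:* translate f
    translate (:- e)   = Solver.:- translate e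

    translate-correct : ∀ {n} (e : Expr n) ρ → Solver.⟦ translate e ⟧ ρ ≈ ⟦ e ⟧ᴱ ρ
    translate-correct (var i)  ρ = refl
    translate-correct :0       ρ = refl
    translate-correct :1       ρ = refl
    translate-correct (e :+ f) ρ = +-cong (translate-correct e ρ) (translate-correct f ρ)
    translate-correct (e :* f) ρ = *-cong (translate-correct e ρ) (translate-correct f ρ)
    translate-correct (:- e)   ρ = -‿cong (translate-correct e ρ)

  open Reflection setoid var ⟦_⟧ᴱ (λ e → Solver.⟦ translate e ⟧↓)
    (λ e ρ → trans (Solver.correct (translate e) ρ) (translate-correct e ρ)) public
    using (solve)

-- The operations are parametrised by the bare ring operations, so that the polynomials over a
-- ring and over one of its quotients have definitionally equal operations.
module PolynomialOperations {c} {C : Set c} (_+_ _*_ : C → C → C) (-_ : C → C) (0# : C) where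

  coeff : List C → ℕ → C
  coeff []      n       = 0#
  coeff (a ∷ p) zero    = a
  coeff (a ∷ p) (suc n) = coeff p n

  add : List C → List C → List C
  add []      q       = q
  add (a ∷ p) []      = a ∷ p
  add (a ∷ p) (b ∷ q) = (a + b) ∷ add p q

  neg : List C → List C
  neg []      = []
  neg (a ∷ p) = (- a) ∷ neg p

  scale : C → List C → List C
  scale a []      = []
  scale a (b ∷ q) = (a * b) ∷ scale a q

  mul : List C → List C → List C
  mul []      q = []
  mul (a ∷ p) q = add (scale a q) (0# ∷ mul p q)

  derivative : List C → List C
  derivative []      = []
  derivative (a ∷ p) = add p (0# ∷ derivative p)

-- Homomorphisms, ideals, quotients and domains.

∣_∣ : ∀ {c ℓ} → CommutativeRing c ℓ → Set c
∣ R ∣ = CommutativeRing.Carrier R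

Equal : ∀ {c ℓ} (R : CommutativeRing c ℓ) → ∣ R ∣ → ∣ R ∣ → Set ℓ
Equal R = CommutativeRing._≈_ R

plus times : ∀ {c ℓ} (R : CommutativeRing c ℓ) → ∣ R ∣ → ∣ R ∣ → ∣ R ∣
plus R  = CommutativeRing._+_ R
times R = CommutativeRing._*_ R

0[_] 1[_] : ∀ {c ℓ} (R : CommutativeRing c ℓ) → ∣ R ∣
0[ R ] = CommutativeRing.0# R
1[ R ] = CommutativeRing.1# R

infix 4 Equal
infixl 6 plus
infixl 7 times
syntax Equal R x y = x ≈[ R ] y
syntax plus R x y = x +[ R ] y
syntax times R x y = x *[ R ] y

record RingHom {c ℓ c′ ℓ′} (R : CommutativeRing c ℓ) (S : CommutativeRing c′ ℓ′) : Set (c ⊔ ℓ ⊔ c′ ⊔ ℓ′) where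
  field
    ⟦_⟧    : ∣ R ∣ → ∣ S ∣
    cong   : ∀ {x y} → x ≈[ R ] y → ⟦ x ⟧ ≈[ S ] ⟦ y ⟧
    0-homo : ⟦ 0[ R ] ⟧ ≈[ S ] 0[ S ]
    1-homo : ⟦ 1[ R ] ⟧ ≈[ S ] 1[ S ]
    +-homo : ∀ x y → ⟦ x +[ R ] y ⟧ ≈[ S ] (⟦ x ⟧ +[ S ] ⟦ y ⟧)
    *-homo : ∀ x y → ⟦ x *[ R ] y ⟧ ≈[ S ] (⟦ x ⟧ *[ S ] ⟦ y ⟧)

  ^-homo : ∀ x n → ⟦ Powers._^_ R x n ⟧ ≈[ S ] Powers._^_ S ⟦ x ⟧ n
  ^-homo x zero    = 1-homo
  ^-homo x (suc n) = CommutativeRing.trans S (*-homo x _) (CommutativeRing.*-congˡ S (^-homo x n))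

identity : ∀ {c ℓ} (R : CommutativeRing c ℓ) → RingHom R R
identity R = record
  { ⟦_⟧ = λ x → x ; cong = λ e → e ; 0-homo = refl ; 1-homo = refl
  ; +-homo = λ _ _ → refl ; *-homo = λ _ _ → refl }
  where open CommutativeRing R

compose : ∀ {c ℓ c′ ℓ′ c″ ℓ″} {R : CommutativeRing c ℓ} {S : CommutativeRing c′ ℓ′} {T : CommutativeRing c″ ℓ″} →
          RingHom S T → RingHom R S → RingHom R T
compose {T = T} g f = record
  { ⟦_⟧ = λ x → g.⟦ f.⟦ x ⟧ ⟧
  ; cong = λ e → g.cong (f.cong e)
  ; 0-homo = trans (g.cong f.0-homo) g.0-homo
  ; 1-homo = trans (g.cong f.1-homo) g.1-homo
  ; +-homo = λ x y → trans (g.cong (f.+-homo x y)) (g.+-homo _ _)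
  ; *-homo = λ x y → trans (g.cong (f.*-homo x y)) (g.*-homo _ _) }
  where
  open CommutativeRing T
  module f = RingHom f
  module g = RingHom g

record IsIdeal {c ℓ z} (R : CommutativeRing c ℓ) (Z : ∣ R ∣ → Set z) : Set (c ⊔ ℓ ⊔ z) where
  field
    resp     : ∀ {x y} → x ≈[ R ] y → Z x → Z y
    0-closed : Z 0[ R ]
    +-closed : ∀ {x y} → Z x → Z y → Z (x +[ R ] y)
    *-closed : ∀ r {x} → Z x → Z (r *[ R ] x)

Multiples : ∀ {c ℓ} (R : CommutativeRing c ℓ) → CommutativeRing.Carrier R → CommutativeRing.Carrier R →
    Set (c ⊔ ℓ)
Multiples R f x = ∃ λ u → x ≈ u * f
  where open CommutativeRing R

multiples : ∀ {c ℓ} (R : CommutativeRing c ℓ) f → IsIdeal R (Multiples R f)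
multiples R f = record
  { resp = λ e (u , eq) → u , trans (sym e) eq
  ; 0-closed = 0# , sym (zeroˡ f)
  ; +-closed = λ (u , eq) (v , eq′) → u + v , trans (+-cong eq eq′) (sym (distribʳ f u v))
  ; *-closed = λ r (u , eq) → r * u , trans (*-congˡ eq) (sym (*-assoc r u f)) }
  where open CommutativeRing R

Combinations : ∀ {c ℓ} (R : CommutativeRing c ℓ) (f g x : CommutativeRing.Carrier R) → Set (c ⊔ ℓ)
Combinations R f g x = ∃ λ u → ∃ λ v → x ≈ u * f + v * g
  where open CommutativeRing R

combinations : ∀ {c ℓ} (R : CommutativeRing c ℓ) f g → IsIdeal R (Combinations R f g)
combinations R f g = record
  { resp = λ e (u , v , eq) → u , v , trans (sym e) eq
  ; 0-closed = 0# , 0# , solve 2 (λ f g → :0 := :0 :* f :+ :0 :* g) refl f g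
  ; +-closed = λ (u , v , eq) (u′ , v′ , eq′) → u + u′ , v + v′ , trans (+-cong eq eq′)
      (solve 6 (λ f g u v u′ v′ → (u :* f :+ v :* g) :+ (u′ :* f :+ v′ :* g) :=
          (u :+ u′) :* f :+ (v :+ v′) :* g) refl f g u v u′ v′)
  ; *-closed = λ r (u , v , eq) → r * u , r * v , trans (*-congˡ eq)
      (solve 5 (λ f g u v r → r :* (u :* f :+ v :* g) := r :* u :* f :+ r :* v :* g) refl f g u v r) }
  where
  open CommutativeRing R
  solve = RingSolver.solve R

module Quotient {c ℓ z} (R : CommutativeRing c ℓ) {Z : CommutativeRing.Carrier R → Set z}
    (isIdeal : IsIdeal R Z) where
  open CommutativeRing R
  open IsIdeal isIdeal
  private
    solve = RingSolver.solve R

  infix 4 _∼_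
  -- A record, because `x` and `y` could not be inferred from `Z (x + - y)`. The quotient keeps the
  -- carrier and the operations and changes only the equality.
  record _∼_ (x y : Carrier) : Set z where
    constructor mod
    field difference : Z (x + - y)
  open _∼_ public

  ≈⇒∼ : ∀ {x y} → x ≈ y → x ∼ y
  ≈⇒∼ {x} {y} e = mod (resp (trans (sym (-‿inverseʳ y)) (+-congʳ (sym e))) 0-closed)

  ∼-sym : ∀ {x y} → x ∼ y → y ∼ x
  ∼-sym {x} {y} (mod d) = mod (resp (solve 2 (λ x y → :- :1 :* (x :+ :- y) := y :+ :- x) refl x y)
      (*-closed (- 1#) d))

  ∼-trans : ∀ {x y z} → x ∼ y → y ∼ z → x ∼ z
  ∼-trans {x} {y} {z} (mod d) (mod e) =
    mod (resp (solve 3 (λ x y z → (x :+ :- y) :+ (y :+ :- z) := x :+ :- z) refl x y z) (+-closed d e))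

  quotient : CommutativeRing c z
  quotient = record
    { Carrier = Carrier ; _≈_ = _∼_ ; _+_ = _+_ ; _*_ = _*_ ; -_ = -_ ; 0# = 0# ; 1# = 1#
    ; isCommutativeRing = record
      { isRing = record
        { +-isAbelianGroup = record
          { isGroup = record
            { isMonoid = record
              { isSemigroup = record
                { isMagma = record
                  { isEquivalence = record { refl = ≈⇒∼ refl ; sym = ∼-sym ; trans = ∼-trans }
                  ; ∙-cong = λ {x} {y} {u} {v} (mod d) (mod e) → mod (resp
                      (solve 4 (λ x y u v → (x :+ :- y) :+ (u :+ :- v) := (x :+ u) :+ :- (y :+ v)) refl x y u v)
                      (+-closed d e)) }
                ; assoc = λ x y z → ≈⇒∼ (+-assoc x y z) }
              ; identity = (λ x → ≈⇒∼ (+-identityˡ x)) , λ x → ≈⇒∼ (+-identityʳ x) }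
            ; inverse = (λ x → ≈⇒∼ (-‿inverseˡ x)) , λ x → ≈⇒∼ (-‿inverseʳ x)
            ; ⁻¹-cong = λ {x} {y} (mod d) → mod (resp
                (solve 2 (λ x y → :- :1 :* (x :+ :- y) := :- x :+ :- (:- y)) refl x y) (*-closed (- 1#) d)) }
          ; comm = λ x y → ≈⇒∼ (+-comm x y) }
        ; *-cong = λ {x} {y} {u} {v} (mod d) (mod e) → mod (resp
            (solve 4 (λ x y u v → u :* (x :+ :- y) :+ y :* (u :+ :- v) := x :* u :+ :- (y :* v)) refl x y u v)
            (+-closed (*-closed u d) (*-closed y e)))
        ; *-assoc = λ x y z → ≈⇒∼ (*-assoc x y z)
        ; *-identity = (λ x → ≈⇒∼ (*-identityˡ x)) , λ x → ≈⇒∼ (*-identityʳ x)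
        ; distrib = (λ x y z → ≈⇒∼ (distribˡ x y z)) , λ x y z → ≈⇒∼ (distribʳ x y z) }
      ; *-comm = λ x y → ≈⇒∼ (*-comm x y) }
    }

  projection : RingHom R quotient
  projection = record
    { ⟦_⟧ = λ x → x ; cong = ≈⇒∼ ; 0-homo = ≈⇒∼ refl ; 1-homo = ≈⇒∼ refl
    ; +-homo = λ _ _ → ≈⇒∼ refl ; *-homo = λ _ _ → ≈⇒∼ refl }

  member⇒zero : ∀ {x} → Z x → x ∼ 0#
  member⇒zero {x} zx = mod (resp (solve 1 (λ x → x := x :+ :- :0) refl x) zx)

  zero⇒member : ∀ {x} → x ∼ 0# → Z x
  zero⇒member {x} (mod d) = resp (solve 1 (λ x → x :+ :- :0 := x) refl x) d

-- The negative form: without decidable equality, a vanishing product does not tell which factor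
-- vanishes.
record IsDomain {c ℓ} (R : CommutativeRing c ℓ) : Set (c ⊔ ℓ) where
  field
    1≉0              : ¬ (1[ R ] ≈[ R ] 0[ R ])
    no-zero-divisors : ∀ x y → ¬ (x ≈[ R ] 0[ R ]) → ¬ (y ≈[ R ] 0[ R ]) → ¬ ((x *[ R ] y) ≈[ R ] 0[ R ])

  ^-nonzero : ∀ x n → ¬ (x ≈[ R ] 0[ R ]) → ¬ (Powers._^_ R x n ≈[ R ] 0[ R ])
  ^-nonzero x zero    x≉0 = 1≉0
  ^-nonzero x (suc n) x≉0 = no-zero-divisors x (Powers._^_ R x n) x≉0 (^-nonzero x n x≉0)

-- Polynomial rings in one variable.

module PolynomialRing {c ℓ} (R : CommutativeRing c ℓ) where
  open CommutativeRing R
  open SetoidReasoning setoid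
  open PolynomialOperations _+_ _*_ -_ 0# public
  private
    solve = RingSolver.solve R

  infix 4 _≋_
  -- Lists that differ by trailing zeros are equal polynomials. A normal form would require deciding
  -- whether a coefficient is zero.
  record _≋_ (p q : List Carrier) : Set ℓ where
    constructor pointwise
    field at : ∀ n → coeff p n ≈ coeff q n
  open _≋_ public

  ≋-refl : ∀ {p} → p ≋ p
  ≋-refl .at n = refl

  ≋-sym : ∀ {p q} → p ≋ q → q ≋ p
  ≋-sym e .at n = sym (e .at n)

  ≋-trans : ∀ {p q r} → p ≋ q → q ≋ r → p ≋ r
  ≋-trans e f .at n = trans (e .at n) (f .at n)

  ∷-cong : ∀ {a b p q} → a ≈ b → p ≋ q → (a ∷ p) ≋ (b ∷ q)
  ∷-cong e f .at zero    = e
  ∷-cong e f .at (suc n) = f .at n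

  ∷-tail : ∀ {a b p q} → (a ∷ p) ≋ (b ∷ q) → p ≋ q
  ∷-tail e .at n = e .at (suc n)

  0∷[] : (0# ∷ []) ≋ []
  0∷[] .at zero    = refl
  0∷[] .at (suc n) = refl

  coeff-add : ∀ p q n → coeff (add p q) n ≈ coeff p n + coeff q n
  coeff-add []      q       n       = sym (+-identityˡ _)
  coeff-add (a ∷ p) []      n       = sym (+-identityʳ _)
  coeff-add (a ∷ p) (b ∷ q) zero    = refl
  coeff-add (a ∷ p) (b ∷ q) (suc n) = coeff-add p q n

  coeff-neg : ∀ p n → coeff (neg p) n ≈ - coeff p n
  coeff-neg []      n       = solve 0 (:0 := :- :0) refl
  coeff-neg (a ∷ p) zero    = refl
  coeff-neg (a ∷ p) (suc n) = coeff-neg p n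

  coeff-scale : ∀ a p n → coeff (scale a p) n ≈ a * coeff p n
  coeff-scale a []      n       = sym (zeroʳ a)
  coeff-scale a (b ∷ p) zero    = refl
  coeff-scale a (b ∷ p) (suc n) = coeff-scale a p n

  add-cong : ∀ {p p′ q q′} → p ≋ p′ → q ≋ q′ → add p q ≋ add p′ q′
  add-cong {p} {p′} {q} {q′} e f .at n = begin
    coeff (add p q) n       ≈⟨ coeff-add p q n ⟩
    coeff p n + coeff q n   ≈⟨ +-cong (e .at n) (f .at n) ⟩
    coeff p′ n + coeff q′ n ≈⟨ coeff-add p′ q′ n ⟨
    coeff (add p′ q′) n     ∎

  add-congʳ : ∀ p {q q′} → q ≋ q′ → add p q ≋ add p q′
  add-congʳ p e = add-cong {p} ≋-refl e

  add-congˡ : ∀ {p p′} q → p ≋ p′ → add p q ≋ add p′ q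
  add-congˡ q e = add-cong {q = q} e ≋-refl

  neg-cong : ∀ {p q} → p ≋ q → neg p ≋ neg q
  neg-cong {p} {q} e .at n = trans (coeff-neg p n) (trans (-‿cong (e .at n)) (sym (coeff-neg q n)))

  scale-cong : ∀ {a b p q} → a ≈ b → p ≋ q → scale a p ≋ scale b q
  scale-cong {a} {b} {p} {q} e f .at n =
    trans (coeff-scale a p n) (trans (*-cong e (f .at n)) (sym (coeff-scale b q n)))

  add-assoc : ∀ p q r → add (add p q) r ≋ add p (add q r)
  add-assoc p q r .at n = begin
    coeff (add (add p q) r) n             ≈⟨ coeff-add (add p q) r n ⟩
    coeff (add p q) n + coeff r n         ≈⟨ +-congʳ (coeff-add p q n) ⟩
    coeff p n + coeff q n + coeff r n     ≈⟨ +-assoc _ _ _ ⟩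
    coeff p n + (coeff q n + coeff r n)   ≈⟨ +-congˡ (coeff-add q r n) ⟨
    coeff p n + coeff (add q r) n         ≈⟨ coeff-add p (add q r) n ⟨
    coeff (add p (add q r)) n             ∎

  add-comm : ∀ p q → add p q ≋ add q p
  add-comm p q .at n = trans (coeff-add p q n) (trans (+-comm _ _) (sym (coeff-add q p n)))

  add-identityʳ : ∀ p → add p [] ≋ p
  add-identityʳ p .at n = trans (coeff-add p [] n) (+-identityʳ _)

  add-inverseˡ : ∀ p → add (neg p) p ≋ []
  add-inverseˡ p .at n = trans (coeff-add (neg p) p n) (trans (+-congʳ (coeff-neg p n)) (-‿inverseˡ _))

  add-interchange : ∀ p q r s → add (add p q) (add r s) ≋ add (add p r) (add q s)
  add-interchange p q r s .at n = begin
    coeff (add (add p q) (add r s)) n                     ≈⟨ expand p q r s ⟩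
    (coeff p n + coeff q n) + (coeff r n + coeff s n)
        ≈⟨ solve 4 (λ p q r s → (p :+ q) :+ (r :+ s) := (p :+ r) :+ (q :+ s)) refl _ _ _ _ ⟩
    (coeff p n + coeff r n) + (coeff q n + coeff s n)     ≈⟨ expand p r q s ⟨
    coeff (add (add p r) (add q s)) n                     ∎
    where
    expand : ∀ p q r s → coeff (add (add p q) (add r s)) n ≈ (coeff p n + coeff q n) + (coeff r n + coeff s n)
    expand p q r s = trans (coeff-add (add p q) (add r s) n) (+-cong (coeff-add p q n) (coeff-add r s n))

  scale-add : ∀ a p q → scale a (add p q) ≋ add (scale a p) (scale a q)
  scale-add a p q .at n = begin
    coeff (scale a (add p q)) n                 ≈⟨ coeff-scale a (add p q) n ⟩
    a * coeff (add p q) n                       ≈⟨ *-congˡ (coeff-add p q n) ⟩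
    a * (coeff p n + coeff q n)                 ≈⟨ distribˡ _ _ _ ⟩
    a * coeff p n + a * coeff q n               ≈⟨ +-cong (coeff-scale a p n) (coeff-scale a q n) ⟨
    coeff (scale a p) n + coeff (scale a q) n   ≈⟨ coeff-add (scale a p) (scale a q) n ⟨
    coeff (add (scale a p) (scale a q)) n       ∎

  scale-+ : ∀ a b p → scale (a + b) p ≋ add (scale a p) (scale b p)
  scale-+ a b p .at n = begin
    coeff (scale (a + b) p) n                   ≈⟨ coeff-scale (a + b) p n ⟩
    (a + b) * coeff p n                         ≈⟨ distribʳ _ _ _ ⟩
    a * coeff p n + b * coeff p n               ≈⟨ +-cong (coeff-scale a p n) (coeff-scale b p n) ⟨
    coeff (scale a p) n + coeff (scale b p) n   ≈⟨ coeff-add (scale a p) (scale b p) n ⟨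
    coeff (add (scale a p) (scale b p)) n       ∎

  scale-scale : ∀ a b p → scale a (scale b p) ≋ scale (a * b) p
  scale-scale a b p .at n = begin
    coeff (scale a (scale b p)) n ≈⟨ coeff-scale a (scale b p) n ⟩
    a * coeff (scale b p) n       ≈⟨ *-congˡ (coeff-scale b p n) ⟩
    a * (b * coeff p n)           ≈⟨ *-assoc a b _ ⟨
    a * b * coeff p n             ≈⟨ coeff-scale (a * b) p n ⟨
    coeff (scale (a * b) p) n     ∎

  scale-0 : ∀ p → scale 0# p ≋ []
  scale-0 p .at n = trans (coeff-scale 0# p n) (zeroˡ _)

  scale-1 : ∀ p → scale 1# p ≋ p
  scale-1 p .at n = trans (coeff-scale 1# p n) (*-identityˡ _)

  shift-add : ∀ p q → (0# ∷ add p q) ≋ add (0# ∷ p) (0# ∷ q)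
  shift-add p q = ∷-cong (sym (+-identityˡ _)) ≋-refl

  scale-shift : ∀ a p → scale a (0# ∷ p) ≋ (0# ∷ scale a p)
  scale-shift a p = ∷-cong (zeroʳ a) ≋-refl

  mul-zeroʳ : ∀ p → mul p [] ≋ []
  mul-zeroʳ []      = ≋-refl
  mul-zeroʳ (a ∷ p) = ≋-trans (∷-cong refl (mul-zeroʳ p)) 0∷[]

  mul-congʳ : ∀ p {q q′} → q ≋ q′ → mul p q ≋ mul p q′
  mul-congʳ []      e = ≋-refl
  mul-congʳ (a ∷ p) e = add-cong (scale-cong refl e) (∷-cong refl (mul-congʳ p e))

  mul-null : ∀ p q → p ≋ [] → mul p q ≋ []
  mul-null []      q e = ≋-refl
  mul-null (a ∷ p) q e = ≋-trans
    (add-cong (≋-trans (scale-cong (e .at 0) ≋-refl) (scale-0 q))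
              (∷-cong refl (mul-null p q (pointwise λ n → e .at (suc n)))))
    0∷[]

  mul-congˡ : ∀ {p p′} q → p ≋ p′ → mul p q ≋ mul p′ q
  mul-congˡ {[]}    {p′}     q e = ≋-sym (mul-null p′ q (≋-sym e))
  mul-congˡ {a ∷ p} {[]}     q e = mul-null (a ∷ p) q e
  mul-congˡ {a ∷ p} {b ∷ p′} q e = add-cong (scale-cong (e .at 0) ≋-refl) (∷-cong refl (mul-congˡ q (∷-tail e)))

  mul-cong₂ : ∀ {p p′ q q′} → p ≋ p′ → q ≋ q′ → mul p q ≋ mul p′ q′
  mul-cong₂ {p} {p′} {q} {q′} e f = ≋-trans (mul-congˡ q e) (mul-congʳ p′ f)

  mul-distribʳ : ∀ r p q → mul (add p q) r ≋ add (mul p r) (mul q r)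
  mul-distribʳ r []      q       = ≋-refl
  mul-distribʳ r (a ∷ p) []      = ≋-sym (add-identityʳ _)
  mul-distribʳ r (a ∷ p) (b ∷ q) = ≋-trans
    (add-cong (scale-+ a b r) (≋-trans (∷-cong refl (mul-distribʳ r p q)) (shift-add (mul p r) (mul q r))))
    (add-interchange (scale a r) (scale b r) (0# ∷ mul p r) (0# ∷ mul q r))

  mul-scale : ∀ a p q → mul (scale a p) q ≋ scale a (mul p q)
  mul-scale a []      q = ≋-refl
  mul-scale a (b ∷ p) q = ≋-trans
    (add-cong (≋-sym (scale-scale a b q))
        (≋-trans (∷-cong refl (mul-scale a p q)) (≋-sym (scale-shift a (mul p q)))))
    (≋-sym (scale-add a (scale b q) (0# ∷ mul p q)))

  mul-shift : ∀ p q → mul (0# ∷ p) q ≋ (0# ∷ mul p q)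
  mul-shift p q = add-cong {p′ = []} (scale-0 q) ≋-refl

  mul-∷ : ∀ p b q → mul p (b ∷ q) ≋ add (scale b p) (0# ∷ mul p q)
  mul-∷ []      b q = ≋-sym 0∷[]
  mul-∷ (a ∷ p) b q = ∷-cong (+-congʳ (*-comm a b)) (≋-trans
    (add-cong ≋-refl (mul-∷ p b q))
    (≋-trans (≋-sym (add-assoc (scale a q) (scale b p) (0# ∷ mul p q)))
    (≋-trans (add-cong (add-comm (scale a q) (scale b p)) ≋-refl)
             (add-assoc (scale b p) (scale a q) (0# ∷ mul p q)))))

  mul-comm : ∀ p q → mul p q ≋ mul q p
  mul-comm []      q = ≋-sym (mul-zeroʳ q)
  mul-comm (a ∷ p) q = ≋-trans (add-cong ≋-refl (∷-cong refl (mul-comm p q))) (≋-sym (mul-∷ q a p))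

  mul-assoc : ∀ p q r → mul (mul p q) r ≋ mul p (mul q r)
  mul-assoc []      q r = ≋-refl
  mul-assoc (a ∷ p) q r = ≋-trans (mul-distribʳ r (scale a q) (0# ∷ mul p q))
    (add-cong (mul-scale a q r) (≋-trans (mul-shift (mul p q) r) (∷-cong refl (mul-assoc p q r))))

  mul-identityˡ : ∀ p → mul (1# ∷ []) p ≋ p
  mul-identityˡ p = ≋-trans (add-cong (scale-1 p) 0∷[]) (add-identityʳ p)

  polynomialRing : CommutativeRing c ℓ
  polynomialRing = record
    { Carrier = List Carrier
    ; _≈_ = _≋_
    ; _+_ = add
    ; _*_ = mul
    ; -_ = neg
    ; 0# = []
    ; 1# = 1# ∷ []
    ; isCommutativeRing = record
      { isRing = record
        { +-isAbelianGroup = record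
          { isGroup = record
            { isMonoid = record
              { isSemigroup = record
                { isMagma = record
                  { isEquivalence = record { refl = ≋-refl ; sym = ≋-sym ; trans = ≋-trans }
                  ; ∙-cong = add-cong }
                ; assoc = add-assoc }
              ; identity = (λ p → ≋-refl) , add-identityʳ }
            ; inverse = add-inverseˡ , λ p → ≋-trans (add-comm p (neg p)) (add-inverseˡ p)
            ; ⁻¹-cong = neg-cong }
          ; comm = add-comm }
        ; *-cong = mul-cong₂
        ; *-assoc = mul-assoc
        ; *-identity = mul-identityˡ , λ p → ≋-trans (mul-comm p (1# ∷ [])) (mul-identityˡ p)
        ; distrib = (λ p q r → ≋-trans (mul-comm p (add q r)) (≋-trans (mul-distribʳ p q r)
                                 (add-cong (mul-comm q p) (mul-comm r p))))
                  , mul-distribʳ }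
      ; *-comm = mul-comm }
    }

module Polynomials {c ℓ} (R : CommutativeRing c ℓ) where
  open CommutativeRing R
  open PolynomialRing R public
  private
    solve = RingSolver.solve R

  open CommutativeRing polynomialRing public using ()
    renaming (_+_ to _⊕_; _*_ to _⊗_; -_ to ⊖_; 1# to 𝟙; +-cong to ⊕-cong; *-cong to ⊗-cong)
  private
    module Pol = CommutativeRing polynomialRing
    solveᴾ = RingSolver.solve polynomialRing
  open Powers R using (_^_)
  open Powers polynomialRing using () renaming (_^_ to _^ᴾ_) public

  const : Carrier → List Carrier
  const a = a ∷ []

  X : List Carrier
  X = 0# ∷ 1# ∷ []

  const-cong : ∀ {a b} → a ≈ b → const a ≋ const b
  const-cong e = ∷-cong e ≋-refl

  const-⊗ : ∀ a p → const a ⊗ p ≋ scale a p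
  const-⊗ a p = ≋-trans (add-cong ≋-refl 0∷[]) (add-identityʳ _)

  coeff-const-⊗ : ∀ a p n → coeff (const a ⊗ p) n ≈ a * coeff p n
  coeff-const-⊗ a p n = trans (const-⊗ a p .at n) (coeff-scale a p n)

  X-⊗ : ∀ p → X ⊗ p ≋ (0# ∷ p)
  X-⊗ p = ≋-trans (mul-shift (1# ∷ []) p) (∷-cong refl (mul-identityˡ p))

  ∷-as-sum : ∀ a p → (a ∷ p) ≋ const a ⊕ X ⊗ p
  ∷-as-sum a p = ≋-trans (∷-cong (sym (+-identityʳ a)) ≋-refl) (add-cong {const a} ≋-refl (≋-sym (X-⊗ p)))

  constHom : RingHom R polynomialRing
  constHom = record
    { ⟦_⟧ = const ; cong = const-cong ; 0-homo = 0∷[] ; 1-homo = ≋-refl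
    ; +-homo = λ x y → ≋-refl
    ; *-homo = λ x y → ≋-sym (const-⊗ x (const y)) }

  coeff-⊗-0 : ∀ p q → coeff (p ⊗ q) 0 ≈ coeff p 0 * coeff q 0
  coeff-⊗-0 []      q = sym (zeroˡ _)
  coeff-⊗-0 (a ∷ p) q = trans (coeff-add (scale a q) (0# ∷ mul p q) 0)
    (trans (+-identityʳ _) (coeff-scale a q 0))

  coeff-∷-⊗ : ∀ a p q n → coeff ((a ∷ p) ⊗ q) (suc n) ≈ a * coeff q (suc n) + coeff (p ⊗ q) n
  coeff-∷-⊗ a p q n = trans (coeff-add (scale a q) (0# ∷ mul p q) (suc n)) (+-congʳ (coeff-scale a q (suc n)))

  coeff-⊗-1 : ∀ p q → coeff (p ⊗ q) 1 ≈ coeff p 0 * coeff q 1 + coeff p 1 * coeff q 0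
  coeff-⊗-1 []      q = solve 2 (λ x y → :0 := :0 :* x :+ :0 :* y) refl _ _
  coeff-⊗-1 (a ∷ p) q = trans (coeff-∷-⊗ a p q 0) (+-congˡ (coeff-⊗-0 p q))

  -- Derivatives.

  derivative-null : ∀ p → p ≋ [] → derivative p ≋ []
  derivative-null []      e = ≋-refl
  derivative-null (a ∷ p) e = ≋-trans (add-cong p≋[] (∷-cong refl (derivative-null p p≋[]))) 0∷[]
    where
    p≋[] : p ≋ []
    p≋[] .at n = e .at (suc n)

  derivative-cong : ∀ {p q} → p ≋ q → derivative p ≋ derivative q
  derivative-cong {[]}    {q}     e = ≋-sym (derivative-null q (≋-sym e))
  derivative-cong {a ∷ p} {[]}    e = derivative-null (a ∷ p) e
  derivative-cong {a ∷ p} {b ∷ q} e = add-cong (∷-tail e) (∷-cong refl (derivative-cong (∷-tail e)))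

  derivative-⊕ : ∀ p q → derivative (p ⊕ q) ≋ derivative p ⊕ derivative q
  derivative-⊕ []      q       = ≋-refl
  derivative-⊕ (a ∷ p) []      = ≋-sym (add-identityʳ _)
  derivative-⊕ (a ∷ p) (b ∷ q) = ≋-trans
    (add-cong ≋-refl (≋-trans (∷-cong refl (derivative-⊕ p q)) (shift-add (derivative p) (derivative q))))
    (add-interchange p q (0# ∷ derivative p) (0# ∷ derivative q))

  derivative-scale : ∀ a p → derivative (scale a p) ≋ scale a (derivative p)
  derivative-scale a []      = ≋-refl
  derivative-scale a (b ∷ p) = ≋-trans
    (add-cong ≋-refl (≋-trans (∷-cong refl (derivative-scale a p)) (≋-sym (scale-shift a (derivative p)))))
    (≋-sym (scale-add a p (0# ∷ derivative p)))

  derivative-⊗ : ∀ p q → derivative (p ⊗ q) ≋ derivative p ⊗ q ⊕ p ⊗ derivative q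
  derivative-⊗ []      q = ≋-refl
  derivative-⊗ (a ∷ p) q = begin
    derivative (scale a q ⊕ (0# ∷ p ⊗ q))
      ≈⟨ derivative-⊕ (scale a q) (0# ∷ p ⊗ q) ⟩
    derivative (scale a q) ⊕ (p ⊗ q ⊕ (0# ∷ derivative (p ⊗ q)))
      ≈⟨ add-cong (derivative-scale a q)
          (add-cong ≋-refl (≋-trans (∷-cong refl (derivative-⊗ p q))
          (shift-add (derivative p ⊗ q) (p ⊗ derivative q)))) ⟩
    scale a (derivative q) ⊕ (p ⊗ q ⊕ ((0# ∷ derivative p ⊗ q) ⊕ (0# ∷ p ⊗ derivative q)))
      ≈⟨ solveᴾ 4 (λ s u v w → s :+ (u :+ (v :+ w)) := (u :+ v) :+ (s :+ w)) ≋-refl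
           (scale a (derivative q)) (p ⊗ q) (0# ∷ derivative p ⊗ q) (0# ∷ p ⊗ derivative q) ⟩
    (p ⊗ q ⊕ (0# ∷ derivative p ⊗ q)) ⊕ (scale a (derivative q) ⊕ (0# ∷ p ⊗ derivative q))
      ≈⟨ add-congˡ (scale a (derivative q) ⊕ (0# ∷ p ⊗ derivative q))
          (add-congʳ (p ⊗ q) (mul-shift (derivative p) q)) ⟨
    (p ⊗ q ⊕ (0# ∷ derivative p) ⊗ q) ⊕ (scale a (derivative q) ⊕ (0# ∷ p ⊗ derivative q))
      ≈⟨ add-congˡ (scale a (derivative q) ⊕ (0# ∷ p ⊗ derivative q)) (mul-distribʳ q p (0# ∷ derivative p)) ⟨
    derivative (a ∷ p) ⊗ q ⊕ (a ∷ p) ⊗ derivative q ∎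
    where open SetoidReasoning Pol.setoid

  coeff-derivative-0 : ∀ p → coeff (derivative p) 0 ≈ coeff p 1
  coeff-derivative-0 []      = refl
  coeff-derivative-0 (a ∷ p) = trans (coeff-add p (0# ∷ derivative p) 0) (+-identityʳ _)

  -- Degrees and leading coefficients.

  -- The coefficient `a` may be zero: `Lead n 0# p` says that `p` has degree less than `n`, so
  -- degree bounds and leading coefficients obey the same rules.
  record Lead (n : ℕ) (a : Carrier) (p : List Carrier) : Set ℓ where
    constructor leads
    field
      above : ∀ j → n < j → coeff p j ≈ 0#
      lead  : coeff p n ≈ a
  open Lead public

  Lead-resp : ∀ {n a b p q} → a ≈ b → p ≋ q → Lead n a p → Lead n b q
  Lead-resp e f (leads ab le) = leads (λ j n<j → trans (sym (f .at j)) (ab j n<j))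
      (trans (sym (f .at _)) (trans le e))

  Lead-weaken : ∀ {m n a p} → m < n → Lead m a p → Lead n 0# p
  Lead-weaken m<n l = leads (λ j n<j → above l j (ℕₚ.<-trans m<n n<j)) (above l _ m<n)

  Lead-0-weaken : ∀ {m n p} → m ≤ n → Lead m 0# p → Lead n 0# p
  Lead-0-weaken m≤n l with ℕₚ.m≤n⇒m<n∨m≡n m≤n
  ... | inj₁ m<n    = Lead-weaken m<n l
  ... | inj₂ ≡.refl = l

  Lead-length : ∀ p → Lead (length p) 0# p
  Lead-length p = leads (λ j n<j → beyond p j (ℕₚ.<⇒≤ n<j)) (beyond p _ ℕₚ.≤-refl)
    where
    beyond : ∀ p j → length p ≤ j → coeff p j ≈ 0#
    beyond []      j       _         = refl
    beyond (a ∷ p) (suc j) (s≤s len≤) = beyond p j len≤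

  Lead-⊕ : ∀ {n a b p q} → Lead n a p → Lead n b q → Lead n (a + b) (p ⊕ q)
  Lead-⊕ {p = p} {q} k l = leads
    (λ j n<j → trans (coeff-add p q j) (trans (+-cong (above k j n<j) (above l j n<j)) (+-identityʳ _)))
    (trans (coeff-add p q _) (+-cong (lead k) (lead l)))

  Lead-const : ∀ a → Lead 0 a (const a)
  Lead-const a = leads (λ { (suc j) _ → refl }) refl

  Lead-⊗ : ∀ {m n a b} p q → Lead m a p → Lead n b q → Lead (m ℕ.+ n) (a * b) (p ⊗ q)
  Lead-⊗ [] q k l = leads (λ _ _ → refl) (trans (sym (zeroˡ _)) (*-congʳ (lead k)))
  Lead-⊗ {zero} {n} (a₀ ∷ p) q k l = leads (λ j n<j → trans (e j) (trans (*-congˡ (above l j n<j)) (zeroʳ _)))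
                                       (trans (e n) (*-cong (lead k) (lead l)))
    where
    p≋[] : p ≋ []
    p≋[] .at j = above k (suc j) (s≤s z≤n)
    e : ∀ j → coeff ((a₀ ∷ p) ⊗ q) j ≈ a₀ * coeff q j
    e j = trans (mul-congˡ q (∷-cong refl p≋[]) .at j) (coeff-const-⊗ a₀ q j)
  Lead-⊗ {suc m} {n} (a₀ ∷ p) q k l = leads
    (λ { (suc j) (s≤s m+n<j) → trans (e j (ℕₚ.<⇒≤ m+n<j)) (above ih j m+n<j) })
    (trans (e (m ℕ.+ n) ℕₚ.≤-refl) (lead ih))
    where
    ih = Lead-⊗ {m} {n} p q (leads (λ j m<j → above k (suc j) (s≤s m<j)) (lead k)) l
    e : ∀ j → m ℕ.+ n ≤ j → coeff ((a₀ ∷ p) ⊗ q) (suc j) ≈ coeff (p ⊗ q) j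
    e j m+n≤j = trans (coeff-∷-⊗ a₀ p q j)
      (trans (+-congʳ (trans (*-congˡ (above l (suc j) (s≤s (ℕₚ.≤-trans (ℕₚ.m≤n+m n m) m+n≤j)))) (zeroʳ _)))
          (+-identityˡ _))

  Lead-X : Lead 1 1# X
  Lead-X = leads (λ { (suc (suc j)) _ → refl ; (suc zero) (s≤s ()) }) refl

  Lead-^ : ∀ {n a} p m → Lead n a p → Lead (m ℕ.* n) (a ^ m) (p ^ᴾ m)
  Lead-^ p zero    l = Lead-const 1#
  Lead-^ p (suc m) l = Lead-⊗ p _ l (Lead-^ p m l)

  record HasDegree (n : ℕ) (p : List Carrier) : Set ℓ where
    constructor degree
    field
      leading : Lead n (coeff p n) p
      nonzero : ¬ (coeff p n ≈ 0#)
  open HasDegree public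

  HasDegree-lead : ∀ {n a p} → Lead n a p → ¬ (a ≈ 0#) → HasDegree n p
  HasDegree-lead l a≉0 = degree (leads (above l) refl) (λ e → a≉0 (trans (sym (lead l)) e))

  HasDegree-resp : ∀ {n p q} → p ≋ q → HasDegree n p → HasDegree n q
  HasDegree-resp e d = HasDegree-lead (Lead-resp refl e (leading d)) (nonzero d)

  HasDegree-unique : ∀ {m n p} → HasDegree m p → HasDegree n p → m ≡ n
  HasDegree-unique {m} {n} d e with ℕₚ.<-cmp m n
  ... | tri< m<n _ _ = ⊥-elim (nonzero e (above (leading d) n m<n))
  ... | tri≈ _ m≡n _ = m≡n
  ... | tri> _ _ n<m = ⊥-elim (nonzero d (above (leading e) m n<m))

  degree-or-zero : ∀ p → ¬ ¬ (p ≋ [] ⊎ ∃ λ n → HasDegree n p)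
  degree-or-zero []      = return (inj₁ ≋-refl)
  degree-or-zero (a ∷ p) = degree-or-zero p >>= λ where
    (inj₂ (n , d)) → return (inj₂ (suc n , degree
        (leads (λ { (suc j) (s≤s n<j) → above (leading d) j n<j }) refl) (nonzero d)))
    (inj₁ p≋[]) → lem (a ≈ 0#) >>= λ where
      (inj₁ a≈0) → return (inj₁ (≋-trans (∷-cong a≈0 p≋[]) 0∷[]))
      (inj₂ a≉0) → return (inj₂ (0 , HasDegree-resp (≋-sym (∷-cong refl p≋[]))
          (HasDegree-lead (Lead-const a) a≉0)))

  has-degree : ∀ p → ¬ (p ≋ []) → ¬ ¬ (∃ λ n → HasDegree n p)
  has-degree p p≉0 = degree-or-zero p >>= λ where
    (inj₁ p≋0) → ⊥-elim (p≉0 p≋0)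
    (inj₂ d)   → return d

  HasDegree⇒≉ : ∀ {n p} → HasDegree n p → ¬ (p ≋ [])
  HasDegree⇒≉ d e = nonzero d (e .at _)

  Lead-0 : ∀ {a p} → Lead 0 a p → p ≋ const a
  Lead-0 l .at zero    = lead l
  Lead-0 l .at (suc j) = above l (suc j) (s≤s z≤n)

  -- Pseudo-division.

  shift : ℕ → List Carrier → List Carrier
  shift zero    p = p
  shift (suc m) p = 0# ∷ shift m p

  coeff-shift : ∀ m p i → coeff (shift m p) (m ℕ.+ i) ≡ coeff p i
  coeff-shift zero    p i = ≡.refl
  coeff-shift (suc m) p i = coeff-shift m p i

  shift-⊗ : ∀ m p → shift m 𝟙 ⊗ p ≋ shift m p
  shift-⊗ zero    p = mul-identityˡ p
  shift-⊗ (suc m) p = ≋-trans (mul-shift (shift m 𝟙) p) (∷-cong refl (shift-⊗ m p))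

  Below : ℕ → List Carrier → Set ℓ
  Below n p = ∀ j → n ≤ j → coeff p j ≈ 0#

  -- A round replaces `f` by `l f − k X ^ m g`, which cancels the top coefficient `k` without
  -- dividing by the leading coefficient `l` of `g`. Each round costs one factor `l`, hence the
  -- power `l ^ m`.
  pseudo-divide : ∀ g n → (∀ j → n < j → coeff g j ≈ 0#) → ∀ m f → Below (m ℕ.+ n) f →
    ∃ λ q → ∃ λ r → const (coeff g n ^ m) ⊗ f ≋ q ⊗ g ⊕ r × Below n r
  pseudo-divide g n above-g zero    f b = [] , f , mul-identityˡ f , b
  pseudo-divide g n above-g (suc m) f b =
    q ⊕ const (l ^ m * k) ⊗ shift m 𝟙 , r , eq , r-below
    where
    l = coeff g n
    k = coeff f (m ℕ.+ n)
    f′ = scale l f ⊕ ⊖ (scale k (shift m g))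
    f′-coeff : ∀ i → coeff f′ (m ℕ.+ i) ≈ l * coeff f (m ℕ.+ i) + - (k * coeff g i)
    f′-coeff i = trans (coeff-add (scale l f) (⊖ (scale k (shift m g))) (m ℕ.+ i))
        (+-cong (coeff-scale l f (m ℕ.+ i))
      (trans (coeff-neg (scale k (shift m g)) (m ℕ.+ i)) (-‿cong (trans (coeff-scale k (shift m g) (m ℕ.+ i))
        (*-congˡ (reflexive (coeff-shift m g i)))))))
    f′-zero : ∀ i → n ≤ i → coeff f′ (m ℕ.+ i) ≈ 0#
    f′-zero i n≤i with ℕₚ.m≤n⇒m<n∨m≡n n≤i
    ... | inj₂ ≡.refl = trans (f′-coeff i) (solve 2 (λ l c → l :* c :+ :- (c :* l) := :0) refl l k)
    ... | inj₁ n<i    = trans (f′-coeff i)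
      (trans (+-cong (*-congˡ (b (m ℕ.+ i) (ℕₚ.+-monoʳ-< m n<i))) (-‿cong (*-congˡ (above-g i n<i))))
             (solve 2 (λ l c → l :* :0 :+ :- (c :* :0) := :0) refl l k))
    f′-below : Below (m ℕ.+ n) f′
    f′-below j m+n≤j with ℕₚ.m≤n⇒∃[o]m+o≡n (ℕₚ.≤-trans (ℕₚ.m≤m+n m n) m+n≤j)
    ... | i , ≡.refl = f′-zero i (ℕₚ.+-cancelˡ-≤ m n i m+n≤j)
    ih = pseudo-divide g n above-g m f′ f′-below
    q = proj₁ ih
    r = proj₁ (proj₂ ih)
    r-below = proj₂ (proj₂ (proj₂ ih))
    open SetoidReasoning Pol.setoid
    eq : const (l * l ^ m) ⊗ f ≋ (q ⊕ const (l ^ m * k) ⊗ shift m 𝟙) ⊗ g ⊕ r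
    eq = begin
      const (l * l ^ m) ⊗ f                               ≈⟨ ⊗-cong (RingHom.*-homo constHom l (l ^ m)) ≋-refl ⟩
      const l ⊗ const (l ^ m) ⊗ f
        ≈⟨ solveᴾ 5 (λ l L f c s → l :* L :* f := L :* (l :* f :+ :- (c :* s)) :+ L :* c :* s) ≋-refl
             (const l) (const (l ^ m)) f (const k) (shift m g) ⟩
      const (l ^ m) ⊗ (const l ⊗ f ⊕ ⊖ (const k ⊗ shift m g)) ⊕ const (l ^ m) ⊗ const k ⊗ shift m g
        ≈⟨ ⊕-cong (⊗-cong {const (l ^ m)} ≋-refl (⊕-cong (const-⊗ l f) (neg-cong (const-⊗ k (shift m g)))))
                  (⊗-cong (≋-sym (RingHom.*-homo constHom (l ^ m) k)) (≋-sym (shift-⊗ m g))) ⟩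
      const (l ^ m) ⊗ f′ ⊕ const (l ^ m * k) ⊗ (shift m 𝟙 ⊗ g)
        ≈⟨ ⊕-cong (proj₁ (proj₂ (proj₂ ih))) ≋-refl ⟩
      (q ⊗ g ⊕ r) ⊕ const (l ^ m * k) ⊗ (shift m 𝟙 ⊗ g)
        ≈⟨ solveᴾ 5 (λ q g r k s → (q :* g :+ r) :+ k :* (s :* g) := (q :+ k :* s) :* g :+ r) ≋-refl
             q g r (const (l ^ m * k)) (shift m 𝟙) ⟩
      (q ⊕ const (l ^ m * k) ⊗ shift m 𝟙) ⊗ g ⊕ r ∎

  -- A substitute for the generator of the ideal over the fraction field: the pseudo-remainder of a
  -- member lies in the ideal and has smaller degree than `d`, hence vanishes, so `d` divides every
  -- member up to a power of its leading coefficient.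
  least-degree-member : ∀ {z} {Z : List Carrier → Set z} → IsIdeal polynomialRing Z → ∀ f → Z f → ¬ (f ≋ []) →
    ¬ ¬ (∃ λ n → ∃ λ d → Z d × HasDegree n d × (∀ g m → Z g → HasDegree m g → n ≤ m) ×
         (∀ g → Z g → ¬ ¬ (∃ λ e → ∃ λ q → const (coeff d n ^ e) ⊗ g ≋ q ⊗ d)))
  least-degree-member {Z = Z} isIdeal f zf f≉0 =
    has-degree f f≉0 >>= λ (N , f-deg) →
    least (λ n → ∃ λ d → Z d × HasDegree n d) N (f , zf , f-deg) >>= λ (n , (d , zd , d-deg) , none) →
    return (n , d , zd , d-deg , (λ g m zg g-deg → ℕₚ.≮⇒≥ (λ m<n → none m m<n (g , zg , g-deg))) ,
        divides n d zd d-deg none)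
    where
    open IsIdeal isIdeal
    divides : ∀ n d → Z d → HasDegree n d → (∀ i → i < n → ¬ (∃ λ d → Z d × HasDegree i d)) →
      ∀ g → Z g → ¬ ¬ (∃ λ e → ∃ λ q → const (coeff d n ^ e) ⊗ g ≋ q ⊗ d)
    divides n d zd d-deg none g zg with pseudo-divide d n (above (leading d-deg)) (length g) g
                                          (λ j len+n≤j → above-length g j
                                              (ℕₚ.≤-trans (ℕₚ.m≤m+n (length g) n) len+n≤j))
      where
      above-length : ∀ g j → length g ≤ j → coeff g j ≈ 0#
      above-length g j len≤j with ℕₚ.m≤n⇒m<n∨m≡n len≤j
      ... | inj₁ len<j  = above (Lead-length g) j len<j
      ... | inj₂ ≡.refl = lead (Lead-length g)
    ... | q , r , eq , r-below = degree-or-zero r >>= λ where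
        (inj₁ r≋0) → return (length g , q , ≋-trans eq (≋-trans (⊕-cong ≋-refl r≋0) (add-identityʳ _)))
        (inj₂ (m , r-deg)) → ⊥-elim (none m (ℕₚ.≰⇒> (λ n≤m → nonzero r-deg (r-below m n≤m))) (r , zr , r-deg))
      where
      zr : Z r
      zr = resp (≋-trans (⊕-cong (≋-trans eq ≋-refl) ≋-refl)
             (solveᴾ 3 (λ q d r → (q :* d :+ r) :+ :- q :* d := r) ≋-refl q d r))
             (+-closed (*-closed (const (coeff d n ^ length g)) zg) (*-closed (⊖ q) zd))

  module OverDomain (domain : IsDomain R) where
    open IsDomain domain

    HasDegree-⊗ : ∀ {m n} p q → HasDegree m p → HasDegree n q → HasDegree (m ℕ.+ n) (p ⊗ q)
    HasDegree-⊗ p q d e = HasDegree-lead (Lead-⊗ p q (leading d) (leading e))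
        (no-zero-divisors _ _ (nonzero d) (nonzero e))

    polynomialDomain : IsDomain polynomialRing
    polynomialDomain = record
      { 1≉0 = λ e → 1≉0 (e .at 0)
      ; no-zero-divisors = λ p q p≉0 q≉0 pq≋0 →
          (has-degree p p≉0 >>= λ (m , d) → has-degree q q≉0 >>= λ (n , e) →
           return (HasDegree⇒≉ (HasDegree-⊗ p q d e) pq≋0)) λ x → x }

    cancel : ∀ p {f g} → ¬ (p ≋ []) → p ⊗ f ≋ p ⊗ g → ¬ ¬ (f ≋ g)
    cancel p {f} {g} p≉0 eq = degree-or-zero (f ⊕ ⊖ g) >>= λ where
      (inj₁ z) → return (≋-trans (solveᴾ 2 (λ f g → f := (f :+ :- g) :+ g) ≋-refl f g)
                                 (⊕-cong z ≋-refl))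
      (inj₂ (n , d)) → ⊥-elim (IsDomain.no-zero-divisors polynomialDomain p (f ⊕ ⊖ g) p≉0 (HasDegree⇒≉ d)
        (≋-trans (solveᴾ 3 (λ p f g → p :* (f :+ :- g) := p :* f :+ :- (p :* g)) ≋-refl p f g)
        (≋-trans (⊕-cong eq ≋-refl) (Pol.-‿inverseʳ (p ⊗ g)))))

-- Evaluation, units and homogenisation.

module Evaluation {c ℓ c′ ℓ′} {R : CommutativeRing c ℓ} {S : CommutativeRing c′ ℓ′} (φ : RingHom R S)
    (r : CommutativeRing.Carrier S) where
  private
    module R = CommutativeRing R
    module P = Polynomials R
    solve = RingSolver.solve S
  open CommutativeRing S
  open RingHom φ
  open P using (_≋_; at; coeff; add; mul; scale; const; X)

  eval : List R.Carrier → Carrier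
  eval []      = 0#
  eval (a ∷ p) = ⟦ a ⟧ + r * eval p

  eval-null : ∀ p → p ≋ [] → eval p ≈ 0#
  eval-null []      e = refl
  eval-null (a ∷ p) e = trans
    (+-cong (trans (cong (e .at 0)) 0-homo) (*-congˡ (eval-null p (P.pointwise λ n → e .at (suc n)))))
    (solve 1 (λ r → :0 :+ r :* :0 := :0) refl r)

  eval-cong : ∀ {p q} → p ≋ q → eval p ≈ eval q
  eval-cong {[]}    {q}     e = sym (eval-null q (P.≋-sym e))
  eval-cong {a ∷ p} {[]}    e = eval-null (a ∷ p) e
  eval-cong {a ∷ p} {b ∷ q} e = +-cong (cong (e .at 0)) (*-congˡ (eval-cong (P.∷-tail e)))

  eval-add : ∀ p q → eval (add p q) ≈ eval p + eval q
  eval-add []      q       = sym (+-identityˡ _)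
  eval-add (a ∷ p) []      = sym (+-identityʳ _)
  eval-add (a ∷ p) (b ∷ q) = trans (+-cong (+-homo a b) (*-congˡ (eval-add p q)))
    (solve 5 (λ a b r p q → (a :+ b) :+ r :* (p :+ q) := (a :+ r :* p) :+ (b :+ r :* q)) refl _ _ _ _ _)

  eval-scale : ∀ a p → eval (scale a p) ≈ ⟦ a ⟧ * eval p
  eval-scale a []      = sym (zeroʳ _)
  eval-scale a (b ∷ p) = trans (+-cong (*-homo a b) (*-congˡ (eval-scale a p)))
    (solve 4 (λ a b r p → a :* b :+ r :* (a :* p) := a :* (b :+ r :* p)) refl _ _ _ _)

  eval-mul : ∀ p q → eval (mul p q) ≈ eval p * eval q
  eval-mul []      q = sym (zeroˡ _)
  eval-mul (a ∷ p) q = trans (eval-add (scale a q) (R.0# ∷ mul p q))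
    (trans (+-cong (eval-scale a q) (+-cong 0-homo (*-congˡ (eval-mul p q))))
    (solve 4 (λ a p q r → a :* q :+ (:0 :+ r :* (p :* q)) := (a :+ r :* p) :* q) refl _ _ _ _))

  eval-const : ∀ a → eval (const a) ≈ ⟦ a ⟧
  eval-const a = solve 2 (λ a r → a :+ r :* :0 := a) refl ⟦ a ⟧ r

  evalHom : RingHom P.polynomialRing S
  evalHom = record
    { ⟦_⟧ = eval ; cong = eval-cong ; 0-homo = refl
    ; 1-homo = trans (eval-const R.1#) 1-homo ; +-homo = eval-add ; *-homo = eval-mul }

  eval-X : eval X ≈ r
  eval-X = trans (+-cong 0-homo (*-congˡ (trans (eval-const R.1#) 1-homo)))
      (solve 1 (λ r → :0 :+ r :* :1 := r) refl r)

module Units {c ℓ} (R : CommutativeRing c ℓ) where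
  open CommutativeRing R
  private
    solve = RingSolver.solve R
  open Powers R using (_^_)

  Unit : Carrier → Set (c ⊔ ℓ)
  Unit x = ∃ λ y → x * y ≈ 1#

  unit-* : ∀ {x y} → Unit x → Unit y → Unit (x * y)
  unit-* {x} {y} (u , xu≈1) (v , yv≈1) = u * v , trans
    (solve 4 (λ x y u v → x :* y :* (u :* v) := x :* u :* (y :* v)) refl x y u v)
    (trans (*-cong xu≈1 yv≈1) (*-identityˡ 1#))

  unit-^ : ∀ {x} n → Unit x → Unit (x ^ n)
  unit-^ zero    u = 1# , *-identityˡ 1#
  unit-^ (suc n) u = unit-* u (unit-^ n u)

  unit-factor : ∀ {x} y → Unit (x * y) → Unit x
  unit-factor {x} y (v , e) = y * v , trans (sym (*-assoc x y v)) e

  unit-resp : ∀ {x y} → x ≈ y → Unit x → Unit y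
  unit-resp e (u , xu≈1) = u , trans (*-congʳ (sym e)) xu≈1

  unit-cancel : ∀ {x y} → Unit x → x * y ≈ 0# → y ≈ 0#
  unit-cancel {x} {y} (u , xu≈1) e = trans (sym (*-identityˡ y)) (trans (*-congʳ (sym xu≈1))
    (trans (solve 3 (λ x u y → x :* u :* y := u :* (x :* y)) refl x u y) (trans (*-congˡ e) (zeroʳ u))))

  unit-complement : ∀ {x y u} → Unit u → u + x * y ≈ 0# → Unit x
  unit-complement {x} {y} {u} (v , uv≈1) e = - (y * v) , trans
    (solve 4 (λ x y u v → x :* :- (y :* v) := u :* v :+ :- ((u :+ x :* y) :* v)) refl x y u v)
    (trans (+-cong uv≈1 (-‿cong (trans (*-congʳ e) (zeroˡ v)))) (solve 0 (:1 :+ :- :0 := :1) refl))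

-- homogenise x t (p₀ ∷ … ∷ pₙ₋₁ ∷ []) l  is  Σᵢ pᵢ xⁱ tⁿ⁻ⁱ + l xⁿ.
module Homogenisation {c ℓ} (R : CommutativeRing c ℓ) where
  open CommutativeRing R
  private
    solve = RingSolver.solve R
  open Powers R using (_^_)

  homogenise : Carrier → Carrier → List Carrier → Carrier → Carrier
  homogenise x t []       l = l
  homogenise x t (p ∷ ps) l = p * t ^ suc (length ps) + x * homogenise x t ps l

  -- Modulo `t` only the leading term survives, so a common zero of the form and of `t` is a zero of
  -- `x ^ n`. This excludes the poles of `x / t` from the roots.
  homogenise-split : ∀ x t ps → ∃ λ g → homogenise x t ps 1# ≈ x ^ length ps + t * g
  homogenise-split x t []       = 0# , solve 1 (λ t → :1 := :1 :+ t :* :0) refl t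
  homogenise-split x t (p ∷ ps) = let g , e = homogenise-split x t ps in
    p * t ^ length ps + x * g ,
    trans (+-congˡ (*-congˡ e))
      (solve 6 (λ p t T x X g → p :* (t :* T) :+ x :* (X :+ t :* g) := x :* X :+ t :* (p :* T :+ x :* g)) refl
         p t (t ^ length ps) x (x ^ length ps) g)

  module _ {c′ ℓ′} {S : CommutativeRing c′ ℓ′} (φ : RingHom R S) where
    private
      module S = CommutativeRing S
      solveˢ = RingSolver.solve S
      module φ = RingHom φ
      module PS = Powers S

    -- Dehomogenisation at `x / t`, which has a meaning only after a homomorphism under which `t`
    -- becomes invertible, with inverse `τ`.
    homogenise-unit : ∀ x t τ → φ.⟦ t ⟧ S.* τ S.≈ S.1# → ∀ ps l →
      φ.⟦ homogenise x t ps l ⟧ S.≈ φ.⟦ t ⟧ PS.^ length ps S.* Evaluation.eval φ (φ.⟦ x ⟧ S.* τ) (ps ++ l ∷ [])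
    homogenise-unit x t τ tτ≈1 []       l = solveˢ 2 (λ l z → l := :1 :* (l :+ z :* :0)) S.refl φ.⟦ l ⟧ _
    homogenise-unit x t τ tτ≈1 (p ∷ ps) l = begin
      φ.⟦ p * t ^ suc n + x * homogenise x t ps l ⟧
        ≈⟨ S.trans (φ.+-homo _ _) (S.+-cong (S.trans (φ.*-homo _ _) (S.*-congˡ (φ.^-homo t (suc n))))
            (φ.*-homo _ _)) ⟩
      φ.⟦ p ⟧ S.* (φ.⟦ t ⟧ S.* T) S.+ φ.⟦ x ⟧ S.* φ.⟦ homogenise x t ps l ⟧
        ≈⟨ S.+-congˡ (S.*-congˡ (homogenise-unit x t τ tτ≈1 ps l)) ⟩
      φ.⟦ p ⟧ S.* (φ.⟦ t ⟧ S.* T) S.+ φ.⟦ x ⟧ S.* (T S.* E)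
        ≈⟨ S.+-congˡ (S.*-congˡ (S.trans (S.sym (S.*-identityˡ _)) (S.*-congʳ (S.sym tτ≈1)))) ⟩
      φ.⟦ p ⟧ S.* (φ.⟦ t ⟧ S.* T) S.+ φ.⟦ x ⟧ S.* (φ.⟦ t ⟧ S.* τ S.* (T S.* E))
        ≈⟨ solveˢ 6 (λ p t T x τ E → p :* (t :* T) :+ x :* (t :* τ :* (T :* E)) := t :* T :* (p :+ x :* τ :* E))
            S.refl
             φ.⟦ p ⟧ φ.⟦ t ⟧ T φ.⟦ x ⟧ τ E ⟩
      φ.⟦ t ⟧ S.* T S.* (φ.⟦ p ⟧ S.+ φ.⟦ x ⟧ S.* τ S.* E) ∎
      where
      open SetoidReasoning S.setoid
      n = length ps
      T = φ.⟦ t ⟧ PS.^ n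
      E = Evaluation.eval φ (φ.⟦ x ⟧ S.* τ) (ps ++ l ∷ [])

module HomogenisationDegree {c ℓ} (R : CommutativeRing c ℓ) where
  open CommutativeRing R
  open Powers R using (_^_)
  open Polynomials R
  open Homogenisation polynomialRing

  -- The term `x ^ n` dominates: trading `i ≥ 1` factors `x` for as many factors `t` and a
  -- coefficient lowers the degree, because `b + i s ≤ i (b + s) ≤ i k` and the degrees of
  -- coefficients and of `t` are strictly below `b` and `s`.
  Lead-homogenise : ∀ {k a b s} x t → Lead k a x → Lead s 0# t → b ℕ.+ s ≤ k → ∀ ps → All (Lead b 0#) ps →
    Lead (length ps ℕ.* k) (a ^ length ps) (homogenise x t ps 𝟙)
  Lead-homogenise x t x-lead t-lead b+s≤k [] [] = Lead-const 1#
  Lead-homogenise {k} {a} {b} {s} x t x-lead t-lead b+s≤k (p ∷ ps) (p-lead ∷ ps-lead) =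
    Lead-resp (+-identityˡ _) ≋-refl (Lead-⊕
      (Lead-0-weaken bound (Lead-resp (zeroˡ _) ≋-refl (Lead-⊗ p _ p-lead (Lead-^ t (suc n) t-lead))))
      (Lead-⊗ x _ x-lead (Lead-homogenise x t x-lead t-lead b+s≤k ps ps-lead)))
    where
    n = length ps
    bound : b ℕ.+ suc n ℕ.* s ≤ suc n ℕ.* k
    bound = ℕₚ.≤-trans (ℕₚ.+-monoˡ-≤ (suc n ℕ.* s) (ℕₚ.m≤n*m b (suc n)))
      (ℕₚ.≤-trans (ℕₚ.≤-reflexive (≡.sym (ℕₚ.*-distribˡ-+ (suc n) b s))) (ℕₚ.*-monoʳ-≤ (suc n) b+s≤k))

module _ {c ℓ c′ ℓ′} {R : CommutativeRing c ℓ} {S : CommutativeRing c′ ℓ′} where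
  private
    module R = CommutativeRing R
    module S = CommutativeRing S

  eval-respects : ∀ (φ ψ : RingHom R S) {r r′} → (∀ a → RingHom.⟦_⟧ φ a S.≈ RingHom.⟦_⟧ ψ a) → r S.≈ r′ →
    ∀ p → Evaluation.eval φ r p S.≈ Evaluation.eval ψ r′ p
  eval-respects φ ψ e r≈r′ []      = S.refl
  eval-respects φ ψ e r≈r′ (a ∷ p) = S.+-cong (e a) (S.*-cong r≈r′ (eval-respects φ ψ e r≈r′ p))

  eval-compose : ∀ {c″ ℓ″} {T : CommutativeRing c″ ℓ″} (ψ : RingHom S T) (φ : RingHom R S) r p →
    CommutativeRing._≈_ T (RingHom.⟦_⟧ ψ (Evaluation.eval φ r p))
        (Evaluation.eval (compose ψ φ) (RingHom.⟦_⟧ ψ r) p)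
  eval-compose ψ φ r []      = RingHom.0-homo ψ
  eval-compose {T = T} ψ φ r (a ∷ p) = T.trans (ψ.+-homo _ _)
      (T.+-congˡ (T.trans (ψ.*-homo _ _) (T.*-congˡ (eval-compose ψ φ r p))))
    where
    module T = CommutativeRing T
    module ψ = RingHom ψ

  homogenise-map : ∀ (φ : RingHom R S) {x t l x′ t′ l′} → let open RingHom φ in
    ⟦ x ⟧ S.≈ x′ → ⟦ t ⟧ S.≈ t′ → ⟦ l ⟧ S.≈ l′ → ∀ {ps qs} → Pointwise (λ p q → ⟦ p ⟧ S.≈ q) ps qs →
    ⟦ Homogenisation.homogenise R x t ps l ⟧ S.≈ Homogenisation.homogenise S x′ t′ qs l′
  homogenise-map φ ex et el Pointwise.[] = el
  homogenise-map φ {t = t} {t′ = t′} ex et el {p ∷ ps} {q ∷ qs} (e Pointwise.∷ es) = S.trans (+-homo _ _)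
      (S.+-cong
      (S.trans (*-homo _ _) (S.*-cong e
          (S.trans (^-homo t (suc (length ps))) (S.trans (powers (suc (length ps)))
        (S.reflexive (≡.cong (λ n → t′ PS.^ suc n) (Pointwise-length es)))))))
      (S.trans (*-homo _ _) (S.*-cong ex (homogenise-map φ ex et el es))))
    where
    open RingHom φ
    module PS = Powers S
    powers : ∀ n → ⟦ t ⟧ PS.^ n S.≈ t′ PS.^ n
    powers zero    = S.refl
    powers (suc n) = S.*-cong et (powers n)

  module PolynomialMap (φ : RingHom R S) where
    private
      module P = Polynomials R
      module Q = Polynomials S
      module φ = RingHom φ
    -- Applying `φ` to the coefficients is evaluation at `X`, so the homomorphism laws come for
    -- free; `coeff-map` recovers the coefficients.
    mapHom : RingHom P.polynomialRing Q.polynomialRing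
    mapHom = Evaluation.evalHom (compose Q.constHom φ) Q.X
    open RingHom mapHom public using () renaming (⟦_⟧ to mapᴾ)

    coeff-map : ∀ p n → Q.coeff (mapᴾ p) n S.≈ φ.⟦ P.coeff p n ⟧
    coeff-map []      n = S.sym φ.0-homo
    coeff-map (a ∷ p) n = S.trans (Q.≋-sym (Q.∷-as-sum φ.⟦ a ⟧ (mapᴾ p)) .Q.at n) (cases n)
      where
      cases : ∀ n → Q.coeff (φ.⟦ a ⟧ ∷ mapᴾ p) n S.≈ φ.⟦ P.coeff (a ∷ p) n ⟧
      cases zero    = S.refl
      cases (suc n) = coeff-map p n

    Lead-map : ∀ {n a p} → P.Lead n a p → Q.Lead n φ.⟦ a ⟧ (mapᴾ p)
    Lead-map {p = p} l = Q.leads (λ j n<j → S.trans (coeff-map p j)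
        (S.trans (φ.cong (P.above l j n<j)) φ.0-homo))
                         (S.trans (coeff-map p _) (φ.cong (P.lead l)))

eval-variable : ∀ {c ℓ} (R : CommutativeRing c ℓ) p → let open Polynomials R in Evaluation.eval constHom X p ≋ p
eval-variable R []      = Polynomials.≋-refl R
eval-variable R (a ∷ p) = ≋-trans (add-congʳ (const a) (mul-congʳ X (eval-variable R p))) (≋-sym (∷-as-sum a p))
  where open Polynomials R

-- Primes of K[y] and Gauss's lemma.

module FieldTheory {c ℓ} (K : Field c ℓ) where
  open Field K hiding (zero)
  private
    module Defsᴾ = Poly K
    solve = RingSolver.solve commutativeRing
  open Defsᴾ using (natMul; evalP)
  open Powers commutativeRing using (_^_)

  fieldDomain : IsDomain commutativeRing
  fieldDomain = record
    { 1≉0 = λ e → 0≉1 (sym e)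
    ; no-zero-divisors = λ x y x≉0 y≉0 xy≈0 → let z , xz≈1 = inverse x x≉0 in
        y≉0 (trans (sym (*-identityˡ y)) (trans (*-congʳ (sym xz≈1))
          (trans (solve 3 (λ x y z → x :* z :* y := z :* (x :* y)) refl x y z)
              (trans (*-congˡ xy≈0) (zeroʳ z))))) }
  open IsDomain fieldDomain using () renaming (no-zero-divisors to *-nonzero; ^-nonzero to power-nonzero)

  open Polynomials commutativeRing
  open OverDomain fieldDomain
  open IsDomain polynomialDomain using () renaming (^-nonzero to pow-nonzero)

  module A = CommutativeRing polynomialRing
  private
    solveᴬ = RingSolver.solve polynomialRing

  const-unit : ∀ a → ¬ (a ≈ 0#) → ∃ λ b → const a ⊗ const b ≋ 𝟙
  const-unit a a≉0 = let b , ab≈1 = inverse a a≉0 in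
    b , ≋-trans (≋-sym (RingHom.*-homo constHom a b)) (const-cong ab≈1)

  const-nonzero : ∀ {a} → ¬ (a ≈ 0#) → ¬ (const a ≋ [])
  const-nonzero a≉0 e = a≉0 (e .at 0)

  divides-up-to-constant : ∀ {a d g q} → ¬ (a ≈ 0#) → const a ⊗ g ≋ q ⊗ d → Multiples polynomialRing d g
  divides-up-to-constant {a} {d} {g} {q} a≉0 eq = let b , ab≋1 = const-unit a a≉0 in
    const b ⊗ q ,
    ≋-trans (≋-sym (mul-identityˡ g)) (≋-trans (mul-congˡ g (≋-sym ab≋1))
    (≋-trans (solveᴬ 3 (λ a b g → a :* b :* g := b :* (a :* g)) ≋-refl (const a) (const b) g)
    (≋-trans (mul-congʳ (const b) eq) (≋-sym (mul-assoc (const b) q d)))))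

  -- Says that `K[y] / π` is a field up to double negation, with the zero ring allowed; `1 ≤ m` for
  -- the degree `m` of `π` accompanies it to exclude units.
  IsPrime : List Carrier → Set (c ⊔ ℓ)
  IsPrime π = ∀ a → ¬ ¬ (Multiples polynomialRing π a ⊎ Combinations polynomialRing π a 𝟙)

  nonunit : ∀ {m π} → HasDegree m π → 1 ≤ m → ¬ Multiples polynomialRing π 𝟙
  nonunit {m} {π} π-deg 1≤m (v , eq) =
    (has-degree v v≉0 >>= λ (n , v-deg) →
     return (ℕₚ.<-irrefl (HasDegree-unique (HasDegree-lead (Lead-const 1#) (λ e → 0≉1 (sym e)))
                                           (HasDegree-resp (≋-sym eq) (HasDegree-⊗ v π v-deg π-deg)))
                         (ℕₚ.≤-trans 1≤m (ℕₚ.m≤n+m m n)))) λ x → x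
    where
    v≉0 : ¬ (v ≋ [])
    v≉0 v≋0 = 0≉1 (sym (≋-trans eq (mul-null v π v≋0) .at 0))

  -- A divisor `π` of least positive degree works. The generator `d` of the ideal of `π` and `a`
  -- divides `u` too, so it is a constant, which yields a Bézout identity, or an associate of `π`,
  -- and then `π` divides `a`.
  prime-divisor : ∀ {n} u → HasDegree n u → 1 ≤ n →
    ¬ ¬ (∃ λ m → ∃ λ π → HasDegree m π × 1 ≤ m × Multiples polynomialRing π u × IsPrime π)
  prime-divisor {n} u u-deg 1≤n =
    least (λ m → ∃ λ π → HasDegree m π × 1 ≤ m × Multiples polynomialRing π u) n
      (u , u-deg , 1≤n , 𝟙 , ≋-sym (mul-identityˡ u)) >>= λ (m , (π , π-deg , 1≤m , π∣u) , none) →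
    return (m , π , π-deg , 1≤m , π∣u , prime m π π-deg 1≤m π∣u none)
    where
    prime : ∀ m π → HasDegree m π → 1 ≤ m → Multiples polynomialRing π u →
      (∀ i → i < m → ¬ (∃ λ ρ → HasDegree i ρ × 1 ≤ i × Multiples polynomialRing ρ u)) → IsPrime π
    prime m π π-deg 1≤m (v , u≋vπ) none a =
      least-degree-member (combinations polynomialRing π a) π
        (𝟙 , [] , solveᴬ 2 (λ π a → π := :1 :* π :+ :0 :* a) ≋-refl π a) (HasDegree⇒≉ π-deg)
      >>= λ (k , d , (s , t , d≋) , d-deg , _ , divides) →
      divides π (𝟙 , [] , solveᴬ 2 (λ π a → π := :1 :* π :+ :0 :* a) ≋-refl π a) >>= λ (e , q , eq) →
      divides a ([] , 𝟙 , solveᴬ 2 (λ π a → a := :0 :* π :+ :1 :* a) ≋-refl π a) >>= λ (e′ , q′ , eq′) →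
      conclude k d s t d≋ d-deg
        (divides-up-to-constant {q = q} (power-nonzero _ e (nonzero d-deg)) eq)
        (divides-up-to-constant {q = q′} (power-nonzero _ e′ (nonzero d-deg)) eq′)
      where
      conclude : ∀ k d s t → d ≋ s ⊗ π ⊕ t ⊗ a → HasDegree k d → Multiples polynomialRing d π →
          Multiples polynomialRing d a →
        ¬ ¬ (Multiples polynomialRing π a ⊎ Combinations polynomialRing π a 𝟙)
      conclude zero d s t d≋ d-deg _ _ = return (inj₂ (let b , lb≋1 = const-unit (coeff d 0) (nonzero d-deg) in
        const b ⊗ s , const b ⊗ t ,
        ≋-trans (≋-sym lb≋1) (≋-trans (mul-congˡ (const b) (≋-trans (≋-sym (Lead-0 (leading d-deg))) d≋))
        (solveᴬ 5 (λ b s t π a → (s :* π :+ t :* a) :* b := b :* s :* π :+ b :* t :* a) ≋-refl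
            (const b) s t π a))))
      conclude (suc k) d s t d≋ d-deg (w , π≋wd) (w′ , a≋w′d) =
        has-degree w w≉0 >>= λ (i , w-deg) →
            associate i w-deg (HasDegree-unique π-deg
            (HasDegree-resp (≋-sym π≋wd) (HasDegree-⊗ w d w-deg d-deg)))
        where
        w≉0 : ¬ (w ≋ [])
        w≉0 w≋0 = HasDegree⇒≉ π-deg (≋-trans π≋wd (mul-null w d w≋0))
        associate : ∀ i → HasDegree i w → m ≡ i ℕ.+ suc k →
            ¬ ¬ (Multiples polynomialRing π a ⊎ Combinations polynomialRing π a 𝟙)
        associate zero w-deg _ = return (inj₁ (let b , lb≋1 = const-unit (coeff w 0) (nonzero w-deg) in
          w′ ⊗ const b , ≋-trans a≋w′d (≋-trans
              (mul-congʳ w′ (≋-trans (≋-sym (mul-identityˡ d)) (mul-congˡ d (≋-sym lb≋1))))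
            (≋-trans (solveᴬ 4 (λ w′ l b d → w′ :* (l :* b :* d) := w′ :* b :* (l :* d)) ≋-refl w′
                (const (coeff w 0)) (const b) d)
            (mul-congʳ (w′ ⊗ const b) (≋-trans (mul-congˡ d (≋-sym (Lead-0 (leading w-deg)))) (≋-sym π≋wd)))))))
        associate (suc i) w-deg m≡ = ⊥-elim
            (none (suc k) (≡.subst (suc k <_) (≡.sym m≡)
            (ℕₚ.m≤n+m (suc (suc k)) i ⟨≤⟩ ℕₚ.≤-reflexive (ℕₚ.+-suc i (suc k))))
          (d , d-deg , s≤s z≤n , v ⊗ w , ≋-trans u≋vπ (≋-trans (mul-congʳ v π≋wd) (≋-sym (mul-assoc v w d)))))
          where _⟨≤⟩_ = ℕₚ.≤-trans

  module _ {m π} (π-deg : HasDegree m π) (1≤m : 1 ≤ m) (prime : IsPrime π) where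
    private module Q = Quotient polynomialRing (multiples polynomialRing π)

    quotientDomain : IsDomain Q.quotient
    quotientDomain = record
      { 1≉0 = λ e → nonunit π-deg 1≤m (Q.zero⇒member e)
      ; no-zero-divisors = λ a b a≁0 b≁0 ab∼0 → (prime a >>= λ where
          (inj₁ π∣a) → ⊥-elim (a≁0 (Q.member⇒zero π∣a))
          (inj₂ (s , t , eq)) → let v , ab≋vπ = Q.zero⇒member ab∼0 in
            ⊥-elim (b≁0 (Q.member⇒zero (s ⊗ b ⊕ t ⊗ v ,
              ≋-trans (≋-sym (mul-identityˡ b)) (≋-trans (mul-congˡ b eq)
              (≋-trans (solveᴬ 5 (λ s t π a b → (s :* π :+ t :* a) :* b := s :* b :* π :+ t :* (a :* b)) ≋-refl
                  s t π a b)
              (≋-trans (add-congʳ (s ⊗ b ⊗ π) (mul-congʳ t ab≋vπ))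
              (solveᴬ 5 (λ s t π v b → s :* b :* π :+ t :* (v :* π) := (s :* b :+ t :* v) :* π) ≋-refl s t π v
                  b)))))))) λ x → x }

  module B = Polynomials polynomialRing
  module DB = B.OverDomain polynomialDomain
  private
    solveᴮ = RingSolver.solve B.polynomialRing

  divide-coefficients : ∀ π d → (∀ n → Multiples polynomialRing π (B.coeff d n)) → ∃ λ d′ →
      d B.≋ B.const π B.⊗ d′
  divide-coefficients π d all = let d′ , e = go d all in d′ , B.≋-trans e (B.≋-sym (B.const-⊗ π d′))
    where
    go : ∀ d → (∀ n → Multiples polynomialRing π (B.coeff d n)) → ∃ λ d′ → d B.≋ B.scale π d′
    go []      all = [] , B.≋-refl
    go (a ∷ d) all = let v , a≋vπ = all 0 ; d′ , e = go d (λ n → all (suc n)) in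
      v ∷ d′ , B.∷-cong (≋-trans a≋vπ (mul-comm v π)) e

  const-⊗-degree : ∀ {n} a d → ¬ (a ≋ []) → B.HasDegree n d → B.HasDegree n (B.const a B.⊗ d)
  const-⊗-degree a d a≉0 d-deg = DB.HasDegree-⊗ (B.const a) d (B.HasDegree-lead (B.Lead-const a) a≉0) d-deg

  -- The primes of K[y] dividing u are moved one at a time into d or q.
  gauss : ∀ N {nu nd nq} u P d q → nu < N → HasDegree nu u → B.const u B.⊗ P B.≋ d B.⊗ q →
    B.HasDegree nd d → B.HasDegree nq q →
    ¬ ¬ (∃ λ d′ → ∃ λ q′ → P B.≋ d′ B.⊗ q′ × B.HasDegree nd d′ × B.HasDegree nq q′)
  gauss (suc N) {zero} u P d q nu<N u-deg eq d-deg q-deg = return (B.const (const b) B.⊗ d , q ,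
      B.≋-trans (B.≋-sym (B.mul-identityˡ P)) (B.≋-trans (B.mul-congˡ P (B.≋-sym one))
      (B.≋-trans (solveᴮ 3 (λ b u P → b :* u :* P := b :* (u :* P)) B.≋-refl (B.const (const b)) (B.const u) P)
      (B.≋-trans (B.mul-congʳ (B.const (const b)) eq) (B.≋-sym (B.mul-assoc (B.const (const b)) d q)))))
    , const-⊗-degree (const b) d (const-nonzero b≉0) d-deg , q-deg)
    where
    unit = const-unit (coeff u 0) (nonzero u-deg)
    b = proj₁ unit
    b≉0 : ¬ (b ≈ 0#)
    b≉0 e = 0≉1 (sym (≋-trans (≋-sym (proj₂ unit)) (mul-congʳ (const (coeff u 0)) (≋-trans (const-cong e) 0∷[]))
        .at 0))
    one : B.const (const b) B.⊗ B.const u B.≋ B.𝟙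
    one = B.≋-trans (B.≋-sym (RingHom.*-homo B.constHom (const b) u))
            (B.const-cong (≋-trans (mul-congʳ (const b) (Lead-0 (leading u-deg)))
                (≋-trans (mul-comm (const b) _) (proj₂ unit))))
  gauss (suc N) {suc nu} {nd} {nq} u P d q nu<N u-deg eq d-deg q-deg =
    prime-divisor u u-deg (s≤s z≤n) >>= λ (m , π , π-deg , 1≤m , (u′ , u≋u′π) , prime) →
    step m π π-deg 1≤m u′ u≋u′π prime
    where
    step : ∀ m π → HasDegree m π → 1 ≤ m → ∀ u′ → u ≋ u′ ⊗ π → IsPrime π →
      ¬ ¬ (∃ λ d′ → ∃ λ q′ → P B.≋ d′ B.⊗ q′ × B.HasDegree nd d′ × B.HasDegree nq q′)
    step m π π-deg 1≤m u′ u≋u′π prime =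
      -- Modulo `π` the product `d q` vanishes, and the polynomials over `K[y] / π` form a domain,
      -- so all coefficients of `d` or all those of `q` are divisible by `π`, which can be
      -- cancelled.
      lem (d Q[x].≋ []) >>= λ where
        (inj₁ d∼0) → let d₁ , d≋πd₁ = divide-coefficients π d (λ n → Q.zero⇒member (d∼0 .Q[x].at n)) in
          DB.cancel (B.const π) {B.const u′ B.⊗ P} {d₁ B.⊗ q} (const≉0)
            (B.≋-trans factor (B.≋-trans (B.mul-congˡ q d≋πd₁) (B.mul-assoc (B.const π) d₁ q))) >>= λ eq₁ →
          degree-of-quotient d d₁ d≋πd₁ d-deg >>= λ d₁-deg →
          u′-degree >>= λ (nu′ , u′-deg , nu′<N) →
          gauss N u′ P d₁ q nu′<N u′-deg eq₁ d₁-deg q-deg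
        (inj₂ d≁0) → lem (q Q[x].≋ []) >>= λ where
          (inj₁ q∼0) → let q₁ , q≋πq₁ = divide-coefficients π q (λ n → Q.zero⇒member (q∼0 .Q[x].at n)) in
            DB.cancel (B.const π) {B.const u′ B.⊗ P} {d B.⊗ q₁} const≉0
              (B.≋-trans factor (B.≋-trans (B.mul-congʳ d q≋πq₁)
                (solveᴮ 3 (λ d π q → d :* (π :* q) := π :* (d :* q)) B.≋-refl d (B.const π) q₁))) >>= λ eq₁ →
            degree-of-quotient q q₁ q≋πq₁ q-deg >>= λ q₁-deg →
            u′-degree >>= λ (nu′ , u′-deg , nu′<N) →
            gauss N u′ P d q₁ nu′<N u′-deg eq₁ d-deg q₁-deg
          (inj₂ q≁0) → ⊥-elim (IsDomain.no-zero-divisors Q[x]domain d q d≁0 q≁0 dq∼0)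
      where
      module Q = Quotient polynomialRing (multiples polynomialRing π)
      module Q[x] = Polynomials Q.quotient
      Q[x]domain = Q[x].OverDomain.polynomialDomain (quotientDomain π-deg 1≤m prime)
      const≉0 : ¬ (B.const π B.≋ [])
      const≉0 e = HasDegree⇒≉ π-deg (e .B.at 0)
      factor : B.const π B.⊗ (B.const u′ B.⊗ P) B.≋ d B.⊗ q
      factor = B.≋-trans (B.≋-sym (B.mul-assoc (B.const π) (B.const u′) P))
        (B.≋-trans (B.mul-congˡ P (B.≋-trans (B.≋-sym (RingHom.*-homo B.constHom π u′))
            (B.const-cong (≋-trans (mul-comm π u′) (≋-sym u≋u′π))))) eq)
      dq∼0 : d Q[x].⊗ q Q[x].≋ []
      dq∼0 .Q[x].at n = Q.member⇒zero (B.coeff (B.const u′ B.⊗ P) n ,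
        ≋-trans (≋-sym (factor .B.at n)) (≋-trans (B.coeff-const-⊗ π (B.const u′ B.⊗ P) n) (mul-comm π _)))
      degree-of-quotient : ∀ {n} f f₁ → f B.≋ B.const π B.⊗ f₁ → B.HasDegree n f → ¬ ¬ B.HasDegree n f₁
      degree-of-quotient {n} f f₁ e f-deg = B.has-degree f₁
        (λ f₁≋0 → B.HasDegree⇒≉ f-deg (B.≋-trans e
            (B.≋-trans (B.mul-congʳ (B.const π) f₁≋0) (B.mul-zeroʳ (B.const π))))) >>= λ (k , f₁-deg) →
        return (≡.subst (λ k → B.HasDegree k f₁)
          (B.HasDegree-unique (B.HasDegree-resp (B.≋-sym e) (const-⊗-degree π f₁ (HasDegree⇒≉ π-deg) f₁-deg))
              f-deg) f₁-deg)
      u′-degree : ¬ ¬ (∃ λ nu′ → HasDegree nu′ u′ × nu′ < N)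
      u′-degree = has-degree u′ (λ u′≋0 → HasDegree⇒≉ u-deg (≋-trans u≋u′π (mul-null u′ π u′≋0))) >>=
          λ (nu′ , u′-deg) →
        return (nu′ , u′-deg , ℕₚ.≤-trans
          (ℕₚ.≤-trans (≡.subst (suc nu′ ≤_) (ℕₚ.+-comm m nu′) (ℕₚ.+-monoˡ-≤ nu′ 1≤m))
                      (ℕₚ.≤-reflexive (HasDegree-unique
                          (HasDegree-resp (≋-sym u≋u′π) (HasDegree-⊗ u′ π u′-deg π-deg)) u-deg)))
          (ℕₚ.≤-pred nu<N))

  -- Plays the part of a nonzero resultant with respect to `x`: a polynomial in `y` alone that
  -- vanishes wherever `P` and `T` have a common zero.
  Eliminant : (P T : List (List Carrier)) → Set (c ⊔ ℓ)
  Eliminant P T = ∃ λ S → ¬ (S ≋ []) × Combinations B.polynomialRing P T (B.const S)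

  Factorisation : ℕ → List (List Carrier) → Set (c ⊔ ℓ)
  Factorisation m P = ∃ λ n₁ → ∃ λ n₂ → ∃ λ d → ∃ λ q →
    1 ≤ n₁ × 1 ≤ n₂ × n₁ ℕ.+ n₂ ≡ m × B.Lead n₁ 𝟙 d × B.Lead n₂ 𝟙 q × P B.≋ d B.⊗ q

  -- A member `d` of least degree in `x` of the ideal of `P` and `T` decides. If the degree is 0,
  -- `d` is an eliminant. Otherwise `d` has degree less than `m`, as `T` has, and it divides `P` up
  -- to a power of its leading coefficient; Gauss's lemma removes that power and leaves a proper
  -- factorisation.
  coprime-or-reducible : ∀ {m} P T → B.Lead m 𝟙 P → B.Below m T → ¬ (T B.≋ []) →
    ¬ ¬ (Eliminant P T ⊎ Factorisation m P)
  coprime-or-reducible {m} P T P-lead T-below T≉0 =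
    least-degree T∈ >>= λ (n , d , d∈ , d-deg , minimal , divides) →
    B.has-degree T T≉0 >>= λ (mT , T-deg) →
    divides P P∈ >>= λ (e , q , eq) →
    conclude n d d∈ d-deg e q eq
      (ℕₚ.≤-<-trans (minimal T mT T∈ T-deg) (ℕₚ.≰⇒> (λ m≤mT → B.nonzero T-deg (T-below mT m≤mT))))
    where
    least-degree = λ z → B.least-degree-member (combinations B.polynomialRing P T) T z T≉0
    T∈ : Combinations B.polynomialRing P T T
    T∈ = [] , B.𝟙 , solveᴮ 2 (λ P T → T := :0 :* P :+ :1 :* T) B.≋-refl P T
    P∈ : Combinations B.polynomialRing P T P
    P∈ = B.𝟙 , [] , solveᴮ 2 (λ P T → P := :1 :* P :+ :0 :* T) B.≋-refl P T
    𝟙≉0 : ¬ (𝟙 ≋ [])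
    𝟙≉0 e = 0≉1 (sym (e .at 0))
    P-deg : B.HasDegree m P
    P-deg = B.HasDegree-lead P-lead 𝟙≉0
    conclude : ∀ n d → Combinations B.polynomialRing P T d → B.HasDegree n d → ∀ e q →
      B.const (B.coeff d n ^ᴾ e) B.⊗ P B.≋ q B.⊗ d → n < m →
      ¬ ¬ (Eliminant P T ⊎ Factorisation m P)
    conclude zero d (U , V , d≋) d-deg e q eq n<m =
      return (inj₁ (B.coeff d 0 , B.nonzero d-deg , U , V , B.≋-trans (B.≋-sym (B.Lead-0 (B.leading d-deg)))
          d≋))
    conclude (suc n) d _ d-deg e q eq n<m =
      has-degree u u≉0 >>= λ (nu , u-deg) →
      B.has-degree q q≉0 >>= λ (nq , q-deg) →
      gauss (suc nu) u P q d ℕₚ.≤-refl u-deg eq q-deg d-deg >>= λ (q′ , d′ , P≋ , q′-deg , d′-deg) →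
      return (inj₂ (normalise nq q′ d′ P≋ q′-deg d′-deg))
      where
      u = B.coeff d (suc n) ^ᴾ e
      u≉0 : ¬ (u ≋ [])
      u≉0 = pow-nonzero (B.coeff d (suc n)) e (B.nonzero d-deg)
      q≉0 : ¬ (q B.≋ [])
      q≉0 q≋0 = B.HasDegree⇒≉ (const-⊗-degree u P u≉0 P-deg) (B.≋-trans eq (B.mul-null q d q≋0))
      -- `P` being monic, the leading coefficients of the two factors are inverse to each other;
      -- multiplying each factor by the leading coefficient of the other makes both monic.
      normalise : ∀ nq q′ d′ → P B.≋ q′ B.⊗ d′ → B.HasDegree nq q′ → B.HasDegree (suc n) d′ → Factorisation m P
      normalise nq q′ d′ P≋ q′-deg d′-deg =
        nq , suc n , B.const b B.⊗ q′ , B.const a B.⊗ d′ , 1≤nq , s≤s z≤n , degrees ,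
        B.Lead-resp (≋-trans (mul-comm b a) ab≋1) B.≋-refl
            (B.Lead-⊗ (B.const b) q′ (B.Lead-const b) (B.leading q′-deg)) ,
        B.Lead-resp ab≋1 B.≋-refl (B.Lead-⊗ (B.const a) d′ (B.Lead-const a) (B.leading d′-deg)) ,
        B.≋-trans (B.≋-sym (B.mul-identityˡ P)) (B.≋-trans (B.mul-cong₂ one P≋)
          (solveᴮ 4 (λ a b q d → (a :* b) :* (q :* d) := (b :* q) :* (a :* d)) B.≋-refl (B.const a)
              (B.const b) q′ d′))
        where
        a = B.coeff q′ nq
        b = B.coeff d′ (suc n)
        degrees : nq ℕ.+ suc n ≡ m
        degrees = B.HasDegree-unique (B.HasDegree-resp (B.≋-sym P≋) (DB.HasDegree-⊗ q′ d′ q′-deg d′-deg)) P-deg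
        1≤nq : 1 ≤ nq
        1≤nq = ℕₚ.+-cancelʳ-≤ (suc n) 1 nq (≡.subst (suc (suc n) ≤_) (≡.sym degrees) n<m)
        ab≋1 : a ⊗ b ≋ 𝟙
        ab≋1 = ≋-trans (≋-sym (B.lead (B.Lead-⊗ q′ d′ (B.leading q′-deg) (B.leading d′-deg))))
          (≋-trans (≋-sym (P≋ .B.at (nq ℕ.+ suc n)))
              (≡.subst (λ i → B.coeff P i ≋ 𝟙) (≡.sym degrees) (B.lead P-lead)))
        one : B.𝟙 B.≋ B.const a B.⊗ B.const b
        one = B.≋-trans (B.const-cong (≋-sym ab≋1)) (RingHom.*-homo B.constHom a b)

  -- The derivation and the criterion for separability.

  open Homogenisation polynomialRing

  -- The Euler operator `y d/dy`. Monomials are its eigenvectors, which lets the substitution of a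
  -- monomial for `x` commute with a derivation of `K[x, y]`.
  θ : List Carrier → List Carrier
  θ p = X ⊗ derivative p

  θ-cong : ∀ {p q} → p ≋ q → θ p ≋ θ q
  θ-cong e = mul-congʳ X (derivative-cong e)

  θ-⊕ : ∀ p q → θ (p ⊕ q) ≋ θ p ⊕ θ q
  θ-⊕ p q = ≋-trans (mul-congʳ X (derivative-⊕ p q)) (A.distribˡ X (derivative p) (derivative q))

  θ-⊗ : ∀ p q → θ (p ⊗ q) ≋ θ p ⊗ q ⊕ p ⊗ θ q
  θ-⊗ p q = ≋-trans (mul-congʳ X (derivative-⊗ p q))
    (solveᴬ 5 (λ x p q p′ q′ → x :* (p′ :* q :+ p :* q′) := x :* p′ :* q :+ p :* (x :* q′)) ≋-refl
      X p q (derivative p) (derivative q))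

  θ-const : ∀ a → θ (const a) ≋ []
  θ-const a = ≋-trans (mul-congʳ X 0∷[]) (mul-zeroʳ X)

  coeff-θ-1 : ∀ p → coeff (θ p) 1 ≈ coeff p 1
  coeff-θ-1 p = trans (X-⊗ (derivative p) .at 1) (coeff-derivative-0 p)

  θ-X : θ X ≋ X
  θ-X = ≋-trans (mul-congʳ X (≋-trans (∷-cong (+-identityʳ 1#) 0∷[]) ≋-refl))
      (≋-trans (mul-comm X 𝟙) (mul-identityˡ X))

  θ-^ : ∀ p a n → θ p ≋ const a ⊗ p → θ (p ^ᴾ n) ≋ const (natMul n a) ⊗ p ^ᴾ n
  θ-^ p a zero    e = ≋-trans (θ-const 1#) (≋-sym (≋-trans (mul-congˡ 𝟙 0∷[]) ≋-refl))
  θ-^ p a (suc n) e = ≋-trans (θ-⊗ p (p ^ᴾ n))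
    (≋-trans (add-cong (mul-congˡ (p ^ᴾ n) e) (mul-congʳ p (θ-^ p a n e)))
      (solveᴬ 4 (λ a b p q → a :* p :* q :+ p :* (b :* q) := (a :+ b) :* (p :* q)) ≋-refl
        (const a) (const (natMul n a)) p (p ^ᴾ n)))

  θ-const-⊗ : ∀ a p → θ (const a ⊗ p) ≋ const a ⊗ θ p
  θ-const-⊗ a p = ≋-trans (θ-⊗ (const a) p)
      (≋-trans (add-congˡ (const a ⊗ θ p) (≋-trans (mul-congˡ p (θ-const a)) ≋-refl)) ≋-refl)

  monomial : Carrier → ℕ → List Carrier
  monomial a k = const a ⊗ X ^ᴾ k

  θ-monomial : ∀ a k → θ (monomial a k) ≋ const (natMul k 1#) ⊗ monomial a k
  θ-monomial a k = ≋-trans (θ-const-⊗ a (X ^ᴾ k)) (≋-trans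
    (mul-congʳ (const a) (θ-^ X 1# k (≋-trans θ-X (≋-sym (mul-identityˡ X)))))
    (solveᴬ 3 (λ a n x → a :* (n :* x) := n :* (a :* x)) ≋-refl (const a) (const (natMul k 1#)) (X ^ᴾ k)))

  coeff-^-0 : ∀ p n → coeff (p ^ᴾ n) 0 ≈ coeff p 0 ^ n
  coeff-^-0 p zero    = refl
  coeff-^-0 p (suc n) = trans (coeff-⊗-0 p (p ^ᴾ n)) (*-congˡ (coeff-^-0 p n))

  monic : List (List Carrier) → List (List Carrier)
  monic ps = ps ++ 𝟙 ∷ []

  -- The curve passes through the origin and `∂P/∂y` does not vanish there, read off the part of `P`
  -- free of `x`.
  Smooth : List (List Carrier) → Set ℓ
  Smooth P = coeff (B.coeff P 0) 0 ≈ 0# × ¬ (coeff (B.coeff P 0) 1 ≈ 0#)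

  module Derivation (κ : Carrier) where
    -- The value is `b + n κ`, accumulated in the order in which `D` runs through the coefficients;
    -- this makes `D-++` hold without any arithmetic.
    advance : ℕ → Carrier → Carrier
    advance zero    b = b
    advance (suc n) b = advance n (b + κ)

    advance-natMul : ∀ n b → advance n b ≈ b + natMul n κ
    advance-natMul zero    b = sym (+-identityʳ b)
    advance-natMul (suc n) b = trans (advance-natMul n (b + κ)) (+-assoc b κ _)

    -- With b = 0 this is the derivation θ + κ x ∂/∂x of K[x, y].
    D : Carrier → List (List Carrier) → List (List Carrier)
    D b []      = []
    D b (p ∷ P) = (θ p ⊕ const b ⊗ p) ∷ D (b + κ) P

    coeff-D : ∀ b P i → B.coeff (D b P) i ≋ θ (B.coeff P i) ⊕ const (advance i b) ⊗ B.coeff P i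
    coeff-D b []      i       = ≋-sym (add-cong {q′ = []} (mul-zeroʳ X) (mul-zeroʳ (const (advance i b))))
    coeff-D b (p ∷ P) zero    = ≋-refl
    coeff-D b (p ∷ P) (suc i) = coeff-D (b + κ) P i

    D-++ : ∀ b ps l → D b (ps ++ l ∷ []) ≡ D b ps ++ (θ l ⊕ const (advance (length ps) b) ⊗ l) ∷ []
    D-++ b []       l = ≡.refl
    D-++ b (p ∷ ps) l = ≡.cong ((θ p ⊕ const b ⊗ p) ∷_) (D-++ (b + κ) ps l)

    length-D : ∀ b ps → length (D b ps) ≡ length ps
    length-D b []       = ≡.refl
    length-D b (p ∷ ps) = ≡.cong suc (length-D (b + κ) ps)

    -- The chain rule: as `θ x = κ x` and `θ t = 0`, applying `θ` to `t ^ n P (x / t, y)` amounts to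
    -- applying `D` to `P`. The offset `b` grows by `κ` with each factor `x` split off in the
    -- recursion.
    θ-homogenise : ∀ x t → θ x ≋ const κ ⊗ x → θ t ≋ [] → ∀ b ps l →
      θ (homogenise x t ps l) ⊕ const b ⊗ homogenise x t ps l ≋
      homogenise x t (D b ps) (θ l ⊕ const (advance (length ps) b) ⊗ l)
    θ-homogenise x t θx θt b []       l = ≋-refl
    θ-homogenise x t θx θt b (p ∷ ps) l rewrite length-D (b + κ) ps = begin
      θ (p ⊗ T ⊕ x ⊗ H) ⊕ const b ⊗ (p ⊗ T ⊕ x ⊗ H)
        ≈⟨ add-congˡ (const b ⊗ (p ⊗ T ⊕ x ⊗ H)) (≋-trans (θ-⊕ (p ⊗ T) (x ⊗ H)) (add-cong (θ-⊗ p T) (θ-⊗ x H)))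
            ⟩
      ((θ p ⊗ T ⊕ p ⊗ θ T) ⊕ (θ x ⊗ H ⊕ x ⊗ θ H)) ⊕ const b ⊗ (p ⊗ T ⊕ x ⊗ H)
        ≈⟨ add-congˡ (const b ⊗ (p ⊗ T ⊕ x ⊗ H))
            (add-cong (add-congʳ (θ p ⊗ T) (mul-congʳ p θT)) (add-congˡ (x ⊗ θ H) (mul-congˡ H θx))) ⟩
      ((θ p ⊗ T ⊕ p ⊗ []) ⊕ (const κ ⊗ x ⊗ H ⊕ x ⊗ θ H)) ⊕ const b ⊗ (p ⊗ T ⊕ x ⊗ H)
        ≈⟨ solveᴬ 8 (λ p p′ T κ x H H′ b → ((p′ :* T :+ p :* :0) :+ (κ :* x :* H :+ x :* H′)) :+ b :*
            (p :* T :+ x :* H)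
             := (p′ :+ b :* p) :* T :+ x :* (H′ :+ (b :+ κ) :* H)) ≋-refl p (θ p) T (const κ) x H (θ H)
                 (const b) ⟩
      (θ p ⊕ const b ⊗ p) ⊗ T ⊕ x ⊗ (θ H ⊕ const (b + κ) ⊗ H)
        ≈⟨ add-congʳ ((θ p ⊕ const b ⊗ p) ⊗ T) (mul-congʳ x (θ-homogenise x t θx θt (b + κ) ps l)) ⟩
      (θ p ⊕ const b ⊗ p) ⊗ T ⊕ x ⊗ homogenise x t (D (b + κ) ps)
          (θ l ⊕ const (advance (length ps) (b + κ)) ⊗ l) ∎
      where
      open SetoidReasoning A.setoid
      T = t ^ᴾ suc (length ps)
      H = homogenise x t ps l
      θT : θ T ≋ []
      θT = ≋-trans (θ-^ t 0# (suc (length ps)) (≋-trans θt (≋-sym (mul-congˡ t 0∷[]))))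
                   (≋-trans (mul-congˡ T (const-cong (natMul-0 (suc (length ps))))) (mul-congˡ T 0∷[]))
        where
        natMul-0 : ∀ n → natMul n 0# ≈ 0#
        natMul-0 zero    = refl
        natMul-0 (suc n) = trans (+-identityˡ _) (natMul-0 n)

    -- For `P` monic of degree `m` in `x`, `D P` has the leading coefficient `m κ`. Subtracting
    -- `m κ P` lowers the degree and does not change the ideal generated together with `P`.
    T : ℕ → List (List Carrier) → List (List Carrier)
    T m P = D 0# P B.⊕ B.⊖ (B.const (const (advance m 0#)) B.⊗ P)

    coeff-T : ∀ m P i → B.coeff (T m P) i ≋ (θ (B.coeff P i) ⊕ const (advance i 0#) ⊗ B.coeff P i) ⊕ ⊖
        (const (advance m 0#) ⊗ B.coeff P i)
    coeff-T m P i = ≋-trans (B.coeff-add (D 0# P) _ i) (add-cong (coeff-D 0# P i)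
      (≋-trans (B.coeff-neg (B.const (const (advance m 0#)) B.⊗ P) i)
          (neg-cong (B.coeff-const-⊗ (const (advance m 0#)) P i))))

    T-below : ∀ {m} P → B.Lead m 𝟙 P → B.Below m (T m P)
    T-below {m} P P-lead j m≤j with ℕₚ.m≤n⇒m<n∨m≡n m≤j
    ... | inj₁ m<j = ≋-trans (coeff-T m P j)
        (vanish (B.coeff P j) (const (advance j 0#)) (const (advance m 0#)) (B.above P-lead j m<j))
      where
      vanish : ∀ p a b → p ≋ [] → (θ p ⊕ a ⊗ p) ⊕ ⊖ (b ⊗ p) ≋ []
      vanish p a b p≋0 = ≋-trans (add-cong (add-cong (≋-trans (θ-cong p≋0) (mul-zeroʳ X)) (mul-congʳ a p≋0))
          (neg-cong (mul-congʳ b p≋0)))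
        (solveᴬ 2 (λ a b → (:0 :+ a :* :0) :+ :- (b :* :0) := :0) ≋-refl a b)
    ... | inj₂ ≡.refl = ≋-trans (coeff-T m P m) (vanish (B.coeff P m) (const (advance m 0#)) (B.lead P-lead))
      where
      vanish : ∀ p a → p ≋ 𝟙 → (θ p ⊕ a ⊗ p) ⊕ ⊖ (a ⊗ p) ≋ []
      vanish p a p≋1 = ≋-trans (solveᴬ 3 (λ q a p → (q :+ a :* p) :+ :- (a :* p) := q) ≋-refl (θ p) a p)
        (≋-trans (θ-cong p≋1) (θ-const 1#))

    -- Here the smooth point enters: the coefficient of `y` in the part of `T` free of `x` is
    -- `(1 − m κ) p₁`, where `p₁` is `∂P/∂y` at the origin.
    T-nonzero : ∀ m P → Smooth P → ¬ (natMul m κ ≈ 1#) → ¬ (T m P B.≋ [])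
    T-nonzero m P (_ , p₁≉0) mκ≉1 T≋0 = *-nonzero (1# + - natMul m κ) p₁
      (λ e → mκ≉1 (trans (solve 1 (λ x → x := :1 :+ :- (:1 :+ :- x)) refl (natMul m κ))
                  (trans (+-congˡ (-‿cong e)) (solve 0 (:1 :+ :- :0 := :1) refl))))
      p₁≉0
      (trans (solve 2 (λ x p → (:1 :+ :- x) :* p := (p :+ :0 :* p) :+ :- ((:0 :+ x) :* p)) refl (natMul m κ) p₁)
      (trans (sym value) (T≋0 .B.at 0 .at 1)))
      where
      p = B.coeff P 0
      p₁ = coeff p 1
      value : coeff (B.coeff (T m P) 0) 1 ≈ (p₁ + 0# * p₁) + - ((0# + natMul m κ) * p₁)
      value = trans (coeff-T m P 0 .at 1) (trans (coeff-add (θ p ⊕ const 0# ⊗ p) _ 1)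
        (+-cong (trans (coeff-add (θ p) (const 0# ⊗ p) 1) (+-cong (coeff-θ-1 p) (coeff-const-⊗ 0# p 1)))
                (trans (coeff-neg (const (advance m 0#) ⊗ p) 1)
                    (-‿cong (trans (coeff-const-⊗ (advance m 0#) p 1) (*-congʳ (advance-natMul m 0#)))))))

  split : ∀ p → ∃ λ g → p ≋ const (coeff p 0) ⊕ X ⊗ g
  split []      = [] , ≋-trans (≋-sym 0∷[])
      (≋-sym (≋-trans (add-congʳ (const 0#) (mul-zeroʳ X)) (add-identityʳ (const 0#))))
  split (a ∷ p) = p , ∷-as-sum a p

  module _ (p : List Carrier) (ps : List (List Carrier)) (smooth : Smooth (p ∷ ps)) (α : Carrier) (k : ℕ)
      (t : List Carrier) where
    private
      x = monomial α (2 ℕ.+ k)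
      H = homogenise x t ps 𝟙
      n = suc (length ps)
      F = homogenise x t (p ∷ ps) 𝟙

      x≋ : x ≋ X ⊗ (X ⊗ monomial α k)
      x≋ = solveᴬ 3 (λ a x y → a :* (x :* (x :* y)) := x :* (x :* (a :* y))) ≋-refl (const α) X (X ^ᴾ k)
      xH≋ : x ⊗ H ≋ (0# ∷ 0# ∷ monomial α k ⊗ H)
      xH≋ = ≋-trans (mul-congˡ H x≋) (≋-trans
        (solveᴬ 3 (λ x m h → (x :* (x :* m)) :* h := x :* (x :* (m :* h))) ≋-refl X (monomial α k) H)
        (≋-trans (X-⊗ (X ⊗ (monomial α k ⊗ H))) (∷-cong refl (X-⊗ (monomial α k ⊗ H)))))

    coeff-homogenise-0 : coeff F 0 ≈ 0#
    coeff-homogenise-0 = trans (coeff-add (p ⊗ t ^ᴾ n) (x ⊗ H) 0) (trans (+-cong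
      (trans (coeff-⊗-0 p (t ^ᴾ n)) (trans (*-congʳ (proj₁ smooth)) (zeroˡ _))) (xH≋ .at 0)) (+-identityʳ 0#))

    -- The exponent of `y` in `x` is at least 2, so only the part `p` of `P` free of `x` contributes
    -- to the linear term.
    coeff-homogenise-1 : coeff F 1 ≈ coeff p 1 * coeff t 0 ^ n
    coeff-homogenise-1 = trans (coeff-add (p ⊗ t ^ᴾ n) (x ⊗ H) 1) (trans (+-cong
      (trans (coeff-⊗-1 p (t ^ᴾ n)) (+-cong (trans (*-congʳ (proj₁ smooth)) (zeroˡ _))
          (*-congˡ (coeff-^-0 t n)))) (xH≋ .at 1))
      (solve 1 (λ a → (:0 :+ a) :+ :0 := a) refl _))

  -- A ring `Q` under `K[y]` takes the place of an extension field with a common root of `F` and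
  -- `F′`; being a unit of `Q` takes the place of being nonzero at that root.
  module Vanishing {c′ ℓ′} {Q : CommutativeRing c′ ℓ′} (φ : RingHom polynomialRing Q) where
    private module Q = CommutativeRing Q
    open Units Q
    open RingHom φ

    map-unit : ∀ {p q} → p ⊗ q ≋ 𝟙 → Unit ⟦ p ⟧
    map-unit {p} {q} e = ⟦ q ⟧ , Q.trans (Q.sym (*-homo p q)) (Q.trans (cong e) 1-homo)

    map-complement : ∀ {f u v w} → f ≋ u ⊕ v ⊗ w → ⟦ f ⟧ Q.≈ Q.0# → Unit ⟦ u ⟧ → Unit ⟦ v ⟧
    map-complement {f} {u} {v} {w} e f∼0 u-unit = unit-complement u-unit
      (Q.trans (Q.+-congˡ (Q.sym (*-homo v w)))
          (Q.trans (Q.sym (+-homo u (v ⊗ w))) (Q.trans (cong (≋-sym e)) f∼0)))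

    variable-unit : ∀ {f} → ⟦ f ⟧ Q.≈ Q.0# → ¬ (coeff f 0 ≈ 0#) → Unit ⟦ X ⟧
    variable-unit {f} f∼0 f₀≉0 = let g , e = split f in
      map-complement {f} {const (coeff f 0)} {X} {g} e f∼0
          (map-unit {const (coeff f 0)} {const (proj₁ (const-unit (coeff f 0) f₀≉0))}
          (proj₂ (const-unit (coeff f 0) f₀≉0)))

    power-unit : ∀ {p} n → Unit ⟦ p ⟧ → Unit ⟦ p ^ᴾ n ⟧
    power-unit {p} n u = unit-resp (Q.sym (^-homo p n)) (unit-^ n u)

    product-unit : ∀ {p q} → Unit ⟦ p ⟧ → Unit ⟦ q ⟧ → Unit ⟦ p ⊗ q ⟧
    product-unit {p} {q} u v = unit-resp (Q.sym (*-homo p q)) (unit-* u v)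

    module _ (κ : Carrier) (x t : List Carrier) (θx : θ x ≋ const κ ⊗ x) (θt : θ t ≋ [])
        (ps : List (List Carrier))
             (F∼0 : ⟦ homogenise x t ps 𝟙 ⟧ Q.≈ Q.0#)
                 (F′∼0 : ⟦ derivative (homogenise x t ps 𝟙) ⟧ Q.≈ Q.0#) where
      open Derivation κ
      private F = homogenise x t ps 𝟙

      denominator-unit : Unit ⟦ x ⟧ → Unit ⟦ t ⟧
      denominator-unit x-unit = let g , e = homogenise-split x t ps in map-complement e F∼0
          (power-unit (length ps) x-unit)

      -- Both generators of the ideal vanish at `x / t`: `P` because `F` does and `t` is a unit,
      -- `D P` because `F` and `F′` do, by `θ-homogenise`.
      eliminant-vanishes : Unit ⟦ t ⟧ → ∀ {S} → Combinations B.polynomialRing (monic ps) (D 0# (monic ps))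
          (B.const S) → ⟦ S ⟧ Q.≈ Q.0#
      eliminant-vanishes (τ , tτ≈1) {S} (U , V , S≋) = Q.trans (Q.sym (Evaluation.eval-const φ x₀ S))
          (Q.trans (Evaluation.eval-cong φ x₀ S≋)
        (Q.trans (Evaluation.eval-add φ x₀ (U B.⊗ P) (V B.⊗ D 0# P)) (Q.trans (Q.+-cong
          (Q.trans (Evaluation.eval-mul φ x₀ U P) (Q.trans (Q.*-congˡ P∼0) (Q.zeroʳ (eval U))))
          (Q.trans (Evaluation.eval-mul φ x₀ V (D 0# P)) (Q.trans (Q.*-congˡ DP∼0) (Q.zeroʳ (eval V)))))
              (Q.+-identityʳ Q.0#))))
        where
        P = monic ps
        x₀ = ⟦ x ⟧ Q.* τ
        eval = Evaluation.eval φ x₀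
        l = θ 𝟙 ⊕ const (advance (length ps) 0#) ⊗ 𝟙
        P∼0 : eval P Q.≈ Q.0#
        P∼0 = unit-cancel (unit-^ (length ps) (τ , tτ≈1))
            (Q.trans (Q.sym (homogenise-unit φ x t τ tτ≈1 ps 𝟙)) F∼0)
        DF∼0 : ⟦ θ F ⊕ const 0# ⊗ F ⟧ Q.≈ Q.0#
        DF∼0 = Q.trans (+-homo (θ F) (const 0# ⊗ F)) (Q.trans (Q.+-cong
          (Q.trans (*-homo X (derivative F)) (Q.trans (Q.*-congˡ F′∼0) (Q.zeroʳ _)))
          (Q.trans (*-homo (const 0#) F) (Q.trans (Q.*-congˡ F∼0) (Q.zeroʳ _)))) (Q.+-identityʳ Q.0#))
        DP∼0 : eval (D 0# P) Q.≈ Q.0#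
        DP∼0 = Q.trans (Q.reflexive (≡.cong eval (D-++ 0# ps 𝟙)))
            (unit-cancel (unit-^ (length (D 0# ps)) (τ , tτ≈1))
          (Q.trans (Q.sym (homogenise-unit φ x t τ tτ≈1 (D 0# ps) l))
          (Q.trans (cong (≋-sym (θ-homogenise x t θx θt 0# ps 𝟙))) DF∼0)))

      contradiction : ∀ {S} j S′ → Combinations B.polynomialRing (monic ps) (D 0# (monic ps)) (B.const S) →
          S ≋ X ^ᴾ j ⊗ S′ →
        Unit ⟦ t ⟧ → Unit ⟦ X ⟧ → Unit ⟦ S′ ⟧ → ⟦ 𝟙 ⟧ Q.≈ Q.0#
      contradiction {S} j S′ comb S≋ t-unit X-unit S′-unit =
        Q.trans 1-homo (unit-cancel (product-unit (power-unit j X-unit) S′-unit) (Q.trans (Q.*-identityʳ _)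
          (Q.trans (cong (≋-sym S≋)) (eliminant-vanishes t-unit comb))))

  UnitUnder : ∀ {c′ ℓ′} {Q : CommutativeRing c′ ℓ′} → RingHom polynomialRing Q → List Carrier → Set (c′ ⊔ ℓ′)
  UnitUnder {Q = Q} φ p = Units.Unit Q (RingHom.⟦_⟧ φ p)

  ZeroUnder : ∀ {c′ ℓ′} {Q : CommutativeRing c′ ℓ′} → RingHom polynomialRing Q → List Carrier → Set ℓ′
  ZeroUnder {Q = Q} φ p = CommutativeRing._≈_ Q (RingHom.⟦_⟧ φ p) (CommutativeRing.0# Q)

  -- In `K[y] / (F, F′)`, the universal ring with a common root, one unit leads to the next: `y`
  -- because `F′(0) ≠ 0`, then `x`, then `t`, then `S′`. So `S = y ^ j S′` is a unit, although it
  -- vanishes, and `1 = 0` in this quotient is the Bézout identity wanted.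
  separable : ∀ ps S j S′ κ x t → let F = homogenise x t ps 𝟙 in
    Combinations B.polynomialRing (monic ps) (Derivation.D κ 0# (monic ps)) (B.const S) →
    S ≋ X ^ᴾ j ⊗ S′ → θ x ≋ const κ ⊗ x → θ t ≋ [] → ¬ (coeff F 1 ≈ 0#) →
    (∀ {Q : CommutativeRing c (c ⊔ ℓ)} (φ : RingHom polynomialRing Q) → UnitUnder φ X → UnitUnder φ x) →
    (∀ {Q : CommutativeRing c (c ⊔ ℓ)} (φ : RingHom polynomialRing Q) → ZeroUnder φ F → UnitUnder φ t →
        UnitUnder φ S′) →
    Combinations polynomialRing F (derivative F) 𝟙
  separable ps S j S′ κ x t comb S≋ θx θt F₁≉0 x-unit S′-unit =
    Quotient.zero⇒member polynomialRing ideal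
      (Vanishing.contradiction φ κ x t θx θt ps F∼0 F′∼0 j S′ comb S≋ t-unit X-unit (S′-unit φ F∼0 t-unit))
    where
    F = homogenise x t ps 𝟙
    ideal = combinations polynomialRing F (derivative F)
    φ = Quotient.projection polynomialRing ideal
    F∼0 : ZeroUnder φ F
    F∼0 = Quotient.member⇒zero polynomialRing ideal
      (𝟙 , [] , solveᴬ 2 (λ f g → f := :1 :* f :+ :0 :* g) ≋-refl F (derivative F))
    F′∼0 : ZeroUnder φ (derivative F)
    F′∼0 = Quotient.member⇒zero polynomialRing ideal
      ([] , 𝟙 , solveᴬ 2 (λ f g → g := :0 :* f :+ :1 :* g) ≋-refl F (derivative F))
    X-unit : UnitUnder φ X
    X-unit = Vanishing.variable-unit φ {derivative F} F′∼0 (λ e → F₁≉0 (trans (sym (coeff-derivative-0 F)) e))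
    t-unit : UnitUnder φ t
    t-unit = Vanishing.denominator-unit φ κ x t θx θt ps F∼0 F′∼0 (x-unit φ X-unit)

  -- Descent to a factor with an eliminant.

  Lead-monic : ∀ ps → B.Lead (length ps) 𝟙 (monic ps)
  Lead-monic []       = B.Lead-const 𝟙
  Lead-monic (p ∷ ps) = B.leads (λ { (suc j) (s≤s n<j) → B.above (Lead-monic ps) j n<j })
      (B.lead (Lead-monic ps))

  monic-form : ∀ n d → B.Lead n 𝟙 d → ∃ λ ps → length ps ≡ n × d B.≋ monic ps
  monic-form zero    d       l = [] , ≡.refl , B.Lead-0 l
  monic-form (suc n) []      l = ⊥-elim (0≉1 (B.lead l .at 0))
  monic-form (suc n) (a ∷ d) l =
    let ps , len , e = monic-form n d (B.leads (λ j n<j → B.above l (suc j) (s≤s n<j)) (B.lead l)) in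
    a ∷ ps , ≡.cong suc len , B.∷-cong ≋-refl e

  Smooth-resp : ∀ {P P′} → P B.≋ P′ → Smooth P → Smooth P′
  Smooth-resp e (z , nz) = trans (sym (e .B.at 0 .at 0)) z , λ w → nz (trans (e .B.at 0 .at 1) w)

  -- The constant terms of `d` and `q` have product zero, so one factor passes through the origin.
  -- If its linear coefficient vanished as well, so would `P₁`, by the product rule.
  Smooth-factor : ∀ {P} d q → P B.≋ d B.⊗ q → Smooth P → ¬ ¬ (Smooth d ⊎ Smooth q)
  Smooth-factor {P} d q e (P₀≈0 , P₁≉0) = lem (d₀ ≈ 0#) >>= λ where
      (inj₁ d₀≈0) → return (inj₁ (d₀≈0 , λ d₁≈0 →
          P₁≉0 (trans P₁ (trans (+-cong (*-congʳ d₀≈0) (*-congʳ d₁≈0)) zero-sum))))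
      (inj₂ d₀≉0) → lem (q₀ ≈ 0#) >>= λ where
        (inj₁ q₀≈0) → return (inj₂ (q₀≈0 , λ q₁≈0 →
            P₁≉0 (trans P₁ (trans (+-cong (*-congˡ q₁≈0) (*-congˡ q₀≈0)) zero-sum′))))
        (inj₂ q₀≉0) → ⊥-elim (*-nonzero d₀ q₀ d₀≉0 q₀≉0
          (trans (sym (coeff-⊗-0 (B.coeff d 0) (B.coeff q 0)))
              (trans (sym (B.coeff-⊗-0 d q .at 0)) (trans (sym (e .B.at 0 .at 0)) P₀≈0))))
    where
    d₀ = coeff (B.coeff d 0) 0
    d₁ = coeff (B.coeff d 0) 1
    q₀ = coeff (B.coeff q 0) 0
    q₁ = coeff (B.coeff q 0) 1
    P₁ : coeff (B.coeff P 0) 1 ≈ d₀ * q₁ + d₁ * q₀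
    P₁ = trans (e .B.at 0 .at 1) (trans (B.coeff-⊗-0 d q .at 1) (coeff-⊗-1 (B.coeff d 0) (B.coeff q 0)))
    zero-sum : ∀ {a b} → 0# * a + 0# * b ≈ 0#
    zero-sum = solve 2 (λ a b → :0 :* a :+ :0 :* b := :0) refl _ _
    zero-sum′ : ∀ {a b} → a * 0# + b * 0# ≈ 0#
    zero-sum′ = solve 2 (λ a b → a :* :0 :+ b :* :0 := :0) refl _ _

  -- The root `y = 0` is excluded by `F′(0) ≠ 0`, so powers of `y` in the eliminant are harmless.
  -- The rest needs `S′(0) ≠ 0`: in positive characteristic for `t(0) ≠ 0`, in characteristic zero
  -- so that no prime of `S′` divides a power of `y`.
  factor-variable : ∀ S → ¬ (S ≋ []) → ¬ ¬ (∃ λ j → ∃ λ S′ → S ≋ X ^ᴾ j ⊗ S′ × ¬ (coeff S′ 0 ≈ 0#))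
  factor-variable []      S≉0 = ⊥-elim (S≉0 ≋-refl)
  factor-variable (a ∷ S) S≉0 = lem (a ≈ 0#) >>= λ where
    (inj₂ a≉0) → return (0 , a ∷ S , ≋-sym (mul-identityˡ (a ∷ S)) , a≉0)
    (inj₁ a≈0) → factor-variable S (λ S≋0 → S≉0 (≋-trans (∷-cong a≈0 S≋0) 0∷[])) >>= λ (j , S′ , e , nz) →
      return (suc j , S′ , ≋-trans (∷-cong a≈0 e)
          (≋-trans (≋-sym (X-⊗ (X ^ᴾ j ⊗ S′))) (≋-sym (mul-assoc X (X ^ᴾ j) S′))) , nz)

  -- `G` will say that all zeros lie in a given finite list, which passes to factors. `κ` may depend
  -- on the factor reached, since in characteristic zero it is the exponent of `y` in `w`, which has
  -- to exceed the degrees of the coefficients.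
  module Descent {g} (G : List (List Carrier) → Set g)
                 (G-factor : ∀ {P} d q → P B.≋ d B.⊗ q → G P → G d × G q)
                 (κ : List (List Carrier) → Carrier) (iκ≉1 : ∀ ps i → ¬ (natMul i (κ ps) ≈ 1#)) where

    G-resp : ∀ {P P′} → P B.≋ P′ → G P → G P′
    G-resp {P} {P′} e gP = proj₁ (G-factor P′ B.𝟙
        (B.≋-trans e (B.≋-trans (B.≋-sym (B.mul-identityˡ P′)) (B.mul-comm B.𝟙 P′))) gP)

    Eliminated : Set (c ⊔ ℓ ⊔ g)
    Eliminated = ∃ λ ps → ∃ λ S → ¬ (S ≋ []) × Smooth (monic ps) × G (monic ps) ×
      Combinations B.polynomialRing (monic ps) (Derivation.D (κ ps) 0# (monic ps)) (B.const S)

    -- While `P` and `T` have no eliminant, `P` splits, and one of the factors is again smooth at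
    -- the origin and has smaller degree in `x`. No factorisation into irreducibles is involved.
    descend : ∀ N ps → length ps < N → Smooth (monic ps) → G (monic ps) → ¬ ¬ Eliminated
    descend (suc N) ps len<N smooth gP =
      coprime-or-reducible P (T n P) (Lead-monic ps) (T-below P (Lead-monic ps))
          (T-nonzero n P smooth (iκ≉1 ps n)) >>= λ where
        (inj₁ (S , S≉0 , U , V , e)) → return (ps , S , S≉0 , smooth , gP , U B.⊕ B.⊖ (V B.⊗ k) , V ,
          B.≋-trans e (solveᴮ 5 (λ U V P D k → U :* P :+ V :* (D :+ :- (k :* P)) :=
              (U :+ :- (V :* k)) :* P :+ V :* D)
            B.≋-refl U V P (D 0# P) k))
        (inj₂ (n₁ , n₂ , d , q , 1≤n₁ , 1≤n₂ , n₁+n₂≡n , d-lead , q-lead , e)) →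
          Smooth-factor d q e smooth >>= λ where
            (inj₁ d-smooth) → next d n₁ d-lead d-smooth (proj₁ (G-factor d q e gP))
              (≡.subst (n₁ <_) n₁+n₂≡n (ℕₚ.m<m+n n₁ 1≤n₂))
            (inj₂ q-smooth) → next q n₂ q-lead q-smooth (proj₂ (G-factor d q e gP))
              (≡.subst (n₂ <_) n₁+n₂≡n (ℕₚ.m<n+m n₂ 1≤n₁))
      where
      P = monic ps
      n = length ps
      open Derivation (κ ps)
      k = B.const (const (advance n 0#))
      next : ∀ d m → B.Lead m 𝟙 d → Smooth d → G d → m < n → ¬ ¬ Eliminated
      next d m d-lead d-smooth gd m<n = let qs , len , e = monic-form m d d-lead in
        descend N qs (≡.subst (_< N) (≡.sym len) (ℕₚ.<-≤-trans m<n (ℕₚ.≤-pred len<N)))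
          (Smooth-resp e d-smooth) (G-resp e gd)

  -- Separable fibres in positive characteristic and in characteristic zero.

  bound : List (List Carrier) → ℕ
  bound []       = 0
  bound (p ∷ ps) = length p ℕ.+ bound ps

  bounded : ∀ ps {b} → bound ps ≤ b → All (Lead b 0#) ps
  bounded []       _    = []
  bounded (p ∷ ps) b≤ = Lead-0-weaken (ℕₚ.≤-trans (ℕₚ.m≤m+n (length p) _) b≤) (Lead-length p)
    ∷ bounded ps (ℕₚ.≤-trans (ℕₚ.m≤n+m (bound ps) (length p)) b≤)

  -- All that the perturbation uses: a curve, the function `w = α y ^ (2 + k) / t` and the
  -- separability of `F`. The degree bounds are recorded because they determine the degree and the
  -- leading coefficient of the perturbed polynomials as well.
  record Fibre {g} (G : List (List Carrier) → Set g) : Set (c ⊔ ℓ ⊔ g) where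
    field
      ps       : List (List Carrier)
      α        : Carrier
      k b s    : ℕ
      t        : List Carrier
      smooth   : Smooth (monic ps)
      property : G (monic ps)
      α≉0      : ¬ (α ≈ 0#)
      t₀≉0     : ¬ (coeff t 0 ≈ 0#)
      ps-bound : All (Lead b 0#) ps
      t-bound  : Lead s 0# t
      b+s≤k    : b ℕ.+ s ≤ 2 ℕ.+ k
    F = homogenise (monomial α (2 ℕ.+ k)) t ps 𝟙
    field
      coprime  : Combinations polynomialRing F (derivative F) 𝟙

  natMul-+ : ∀ m n a → natMul (m ℕ.+ n) a ≈ natMul m a + natMul n a
  natMul-+ zero    n a = sym (+-identityˡ _)
  natMul-+ (suc m) n a = trans (+-congˡ (natMul-+ m n a)) (sym (+-assoc a _ _))

  natMul-* : ∀ m n → natMul (m ℕ.* n) 1# ≈ natMul m (natMul n 1#)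
  natMul-* zero    n = refl
  natMul-* (suc m) n = trans (natMul-+ n (m ℕ.* n) 1#) (+-congˡ (natMul-* m n))

  natMul-0 : ∀ m {a} → a ≈ 0# → natMul m a ≈ 0#
  natMul-0 zero    a≈0 = refl
  natMul-0 (suc m) a≈0 = trans (+-cong a≈0 (natMul-0 m a≈0)) (+-identityˡ 0#)

  natMul-assoc : ∀ m a → natMul m a ≈ natMul m 1# * a
  natMul-assoc zero    a = sym (zeroˡ a)
  natMul-assoc (suc m) a = trans (+-cong (sym (*-identityˡ a)) (natMul-assoc m a)) (sym (distribʳ a 1# _))

  θ-power : ∀ p n → θ (p ^ᴾ suc n) ≋ const (natMul (suc n) 1#) ⊗ (p ^ᴾ n ⊗ θ p)
  θ-power p zero    = ≋-trans (θ-cong (≋-trans (mul-comm p 𝟙) (mul-identityˡ p)))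
    (≋-sym (≋-trans (mul-congˡ (𝟙 ⊗ θ p) (const-cong (+-identityʳ 1#)))
        (≋-trans (mul-identityˡ (𝟙 ⊗ θ p)) (mul-identityˡ (θ p)))))
  θ-power p (suc n) = ≋-trans (θ-⊗ p (p ^ᴾ suc n))
      (≋-trans (add-congʳ (θ p ⊗ p ^ᴾ suc n) (mul-congʳ p (θ-power p n)))
    (solveᴬ 4 (λ p q t m → t :* (p :* q) :+ p :* (m :* (q :* t)) := (:1 :+ m) :* ((p :* q) :* t)) ≋-refl
      p (p ^ᴾ n) (θ p) (const (natMul (suc n) 1#))))

  monomial-unit : ∀ {α} k → ¬ (α ≈ 0#) → ∀ {c′ ℓ′} {Q : CommutativeRing c′ ℓ′} (φ : RingHom polynomialRing Q) →
    UnitUnder φ X → UnitUnder φ (monomial α k)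
  monomial-unit {α} k α≉0 φ X-unit = Vanishing.product-unit φ {const α} {X ^ᴾ k}
    (Vanishing.map-unit φ {const α} {const (proj₁ (const-unit α α≉0))} (proj₂ (const-unit α α≉0)))
    (Vanishing.power-unit φ {X} k X-unit)

  first-coefficient : ∀ ps α k t → Smooth (monic ps) → ¬ (coeff t 0 ≈ 0#) →
      ¬ (coeff (homogenise (monomial α (2 ℕ.+ k)) t ps 𝟙) 1 ≈ 0#)
  first-coefficient []       α k t smooth t₀≉0 e = 0≉1 (sym (proj₁ smooth))
  first-coefficient (p ∷ ps) α k t smooth t₀≉0 e =
    *-nonzero _ _ (proj₂ smooth) (power-nonzero _ (suc (length ps)) t₀≉0)
      (trans (sym (coeff-homogenise-1 p ps smooth α k t)) e)

  -- `suc p` is a positive multiple of the characteristic: a `suc p`-th power has derivative zero,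
  -- and an exponent divisible by `suc p` gives `κ = 0`.
  module PositiveCharacteristic {g} (G : List (List Carrier) → Set g)
      (G-factor : ∀ {P} d q → P B.≋ d B.⊗ q → G P → G d × G q)
      (p : ℕ) (p≈0 : natMul (suc p) 1# ≈ 0#) where

    open Descent G G-factor (λ _ → 0#) (λ _ i e → 0≉1 (trans (sym (natMul-0 i refl)) e))

    fibre : ∀ ps → Smooth (monic ps) → G (monic ps) → ¬ ¬ Fibre G
    fibre ps smooth gP = descend (suc (length ps)) ps ℕₚ.≤-refl smooth gP >>=
        λ (ps , S , S≉0 , smooth , gP , comb) →
      factor-variable S S≉0 >>= λ (j , S′ , S≋ , S′₀≉0) → return (build ps S smooth gP comb j S′ S≋ S′₀≉0)
      where
      build : ∀ ps S → Smooth (monic ps) → G (monic ps) →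
        Combinations B.polynomialRing (monic ps) (Derivation.D 0# 0# (monic ps)) (B.const S) →
        ∀ j S′ → S ≋ X ^ᴾ j ⊗ S′ → ¬ (coeff S′ 0 ≈ 0#) → Fibre G
      build ps S smooth gP comb j S′ S≋ S′₀≉0 = record
        { ps = ps ; α = 1# ; k = k ; b = b ; s = s ; t = t ; smooth = smooth ; property = gP
        ; α≉0 = 1≉0 ; t₀≉0 = t₀≉0 ; ps-bound = bounded ps ℕₚ.≤-refl ; t-bound = Lead-length t
        ; b+s≤k = ℕₚ.≤-trans (ℕₚ.m≤m+n (b ℕ.+ s) (p ℕ.* (2 ℕ.+ (b ℕ.+ s)))) (ℕₚ.m≤n+m k 2)
        ; coprime = separable ps S j S′ 0# (monomial 1# (2 ℕ.+ k)) t comb S≋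
            (≋-trans (θ-monomial 1# (2 ℕ.+ k)) (mul-congˡ (monomial 1# (2 ℕ.+ k)) (const-cong k≈0)))
            θt (first-coefficient ps 1# k t smooth t₀≉0) (monomial-unit (2 ℕ.+ k) 1≉0) S′-unit }
        where
        -- `S′` divides `t`, so its roots are poles of `w`, and it is a unit wherever `t` is one.
        t = S′ ^ᴾ suc p
        b = bound ps
        s = length t
        -- Chosen so that `2 + k` equals `(1 + p) (2 + b + s)`: a multiple of `suc p` that is at
        -- least `b + s`.
        k = b ℕ.+ s ℕ.+ p ℕ.* (2 ℕ.+ (b ℕ.+ s))
        1≉0 : ¬ (1# ≈ 0#)
        1≉0 e = 0≉1 (sym e)
        t₀≉0 : ¬ (coeff t 0 ≈ 0#)
        t₀≉0 e = power-nonzero _ (suc p) S′₀≉0 (trans (sym (coeff-^-0 S′ (suc p))) e)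
        k≈0 : natMul (2 ℕ.+ k) 1# ≈ 0#
        k≈0 = trans (natMul-* (suc p) (2 ℕ.+ (b ℕ.+ s)))
            (trans (natMul-assoc (suc p) _) (trans (*-congʳ p≈0) (zeroˡ _)))
        θt : θ t ≋ []
        θt = ≋-trans (θ-power S′ p) (mul-null (const (natMul (suc p) 1#)) _ (≋-trans (const-cong p≈0) 0∷[]))
        S′-unit : ∀ {Q : CommutativeRing c (c ⊔ ℓ)} (φ : RingHom polynomialRing Q) →
          ZeroUnder φ (homogenise (monomial 1# (2 ℕ.+ k)) t ps 𝟙) → UnitUnder φ t → UnitUnder φ S′
        S′-unit {Q} φ _ t-unit = Units.unit-factor Q (RingHom.⟦_⟧ φ (S′ ^ᴾ p))
            (Units.unit-resp Q (RingHom.*-homo φ S′ (S′ ^ᴾ p)) t-unit)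

  -- Families φ(α) over the constants α which are polynomial in α of degree n with leading coefficient l.
  Family : List Carrier → ℕ → (Carrier → List Carrier) → Set (c ⊔ ℓ)
  Family l zero    φ = Lift c (∀ α → φ α ≋ l)
  Family l (suc n) φ = ∀ r → ∃ λ ψ → Family l n ψ × (∀ α → φ α ≋ φ r ⊕ const (α + - r) ⊗ ψ α)

  Family-scale : ∀ {l} n w φ → Family l n φ → Family (w ⊗ l) n (λ α → w ⊗ φ α)
  Family-scale zero    w φ (lift f) = lift (λ α → mul-congʳ w (f α))
  Family-scale (suc n) w φ f r = let ψ , h , e = f r in
    (λ α → w ⊗ ψ α) , Family-scale n w ψ h , λ α → ≋-trans (mul-congʳ w (e α))
      (solveᴬ 4 (λ w p a q → w :* (p :+ a :* q) := w :* p :+ a :* (w :* q)) ≋-refl w (φ r) (const (α + - r))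
          (ψ α))

  Family-add : ∀ {l l′} n w φ χ → Family l (suc n) φ → Family l′ n χ → Family l (suc n) (λ α → φ α ⊕ w ⊗ χ α)
  Family-add {l} {l′} zero w φ χ f (lift h) r = let ψ , i , e = f r in
    ψ , i , λ α → ≋-trans (add-cong (e α) (mul-congʳ w (≋-trans (h α) (≋-sym (h r)))))
      (solveᴬ 3 (λ p q r → (p :+ q) :+ r := (p :+ r) :+ q) ≋-refl (φ r) (const (α + - r) ⊗ ψ α) (w ⊗ χ r))
  Family-add (suc n) w φ χ f h r = let ψ , i , e = f r ; ψ′ , i′ , e′ = h r in
    (λ α → ψ α ⊕ w ⊗ ψ′ α) , Family-add n w ψ ψ′ i i′ , λ α → ≋-trans (add-cong (e α) (mul-congʳ w (e′ α)))
      (solveᴬ 6 (λ p a q w p′ q′ → (p :+ a :* q) :+ w :* (p′ :+ a :* q′) :=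
          (p :+ w :* p′) :+ a :* (q :+ w :* q′)) ≋-refl
        (φ r) (const (α + - r)) (ψ α) w (χ r) (ψ′ α))

  const-difference : ∀ α r → const α ≋ const r ⊕ const (α + - r)
  const-difference α r = const-cong (solve 2 (λ α r → α := r :+ (α :+ :- r)) refl α r)

  -- The product rule for divided differences: if `φ(α) = φ(r) + (α − r) ψ(α)`, then the quotient
  -- belonging to `α w φ(α)` is `w φ(α) + r w ψ(α)`.
  Family-step : ∀ {l} n a w φ → Family l n φ → Family (w ⊗ l) (suc n) (λ α → a ⊕ (const α ⊗ w) ⊗ φ α)
  Family-step zero a w φ (lift f) r = (λ α → w ⊗ φ α) , Family-scale 0 w φ (lift f) , λ α →
    ≋-trans (add-congʳ a (mul-congˡ (φ α) (mul-congˡ w (const-difference α r))))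
    (≋-trans (solveᴬ 5 (λ a r d w p → a :+ ((r :+ d) :* w) :* p := (a :+ (r :* w) :* p) :+ d :* (w :* p)) ≋-refl
        a (const r) (const (α + - r)) w (φ α))
      (add-congˡ (const (α + - r) ⊗ (w ⊗ φ α))
          (add-congʳ a (mul-congʳ (const r ⊗ w) (≋-trans (f α) (≋-sym (f r)))))))
  Family-step {l} (suc n) a w φ f r = let ψ , i , e = f r in
    (λ α → w ⊗ φ α ⊕ (const r ⊗ w) ⊗ ψ α) , Family-add n (const r ⊗ w) (λ α → w ⊗ φ α) ψ
        (Family-scale (suc n) w φ f) i , λ α →
    ≋-trans (add-congʳ a (mul-congˡ (φ α) (mul-congˡ w (const-difference α r))))
    (≋-trans (solveᴬ 5 (λ a r d w p → a :+ ((r :+ d) :* w) :* p := (a :+ (r :* w) :* p) :+ d :* (w :* p)) ≋-refl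
        a (const r) (const (α + - r)) w (φ α))
    (≋-trans (add-congˡ (const (α + - r) ⊗ (w ⊗ φ α)) (add-congʳ a (mul-congʳ (const r ⊗ w) (e α))))
      (solveᴬ 7 (λ a r d w p q s → (a :+ (r :* w) :* (q :+ d :* s)) :+ d :* (w :* p)
          := (a :+ (r :* w) :* q) :+ d :* (w :* p :+ (r :* w) :* s)) ≋-refl
        a (const r) (const (α + - r)) w (φ α) (φ r) (ψ α))))

  Family-homogenise : ∀ w t ps → Family (w ^ᴾ length ps) (length ps) (λ α → homogenise (const α ⊗ w) t ps 𝟙)
  Family-homogenise w t []       = lift (λ α → ≋-refl)
  Family-homogenise w t (p ∷ ps) = Family-step (length ps) (p ⊗ t ^ᴾ suc (length ps)) w _
      (Family-homogenise w t ps)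

  -- A polynomial of degree `n` in `α` has at most `n` roots modulo `π`. Given a root `r`, any other
  -- root is one of the quotient `ψ`, because the nonzero constant `α − r` is invertible; at degree
  -- 0 only `l` remains, which `π` does not divide.
  finite-roots : ∀ π {l} n φ → Family l n φ → ¬ Multiples polynomialRing π l →
    ¬ ¬ (∃ λ L → ∀ α → ¬ Any (α ≈_) L → ¬ Multiples polynomialRing π (φ α))
  finite-roots π zero    φ (lift f) ∤l = return ([] , λ α _ ∣φα → ∤l (resp (f α) ∣φα))
    where open IsIdeal (multiples polynomialRing π)
  finite-roots π (suc n) φ f ∤l = lem (∃ λ r → Multiples polynomialRing π (φ r)) >>= λ where
      (inj₂ none)      → return ([] , λ α _ ∣φα → none (α , ∣φα))
      (inj₁ (r , ∣φr)) → let ψ , i , e = f r in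
        finite-roots π n ψ i ∤l >>= λ (L , h) → return (r ∷ L , λ α α∉ ∣φα →
          let b , ub = const-unit (α + - r) (λ z → α∉ (here (trans (solve 2 (λ α r → α := (α :+ :- r) :+ r) refl α r) (trans (+-congʳ z) (+-identityˡ r))))) in
          h α (λ α∈ → α∉ (there α∈)) (resp (≋-trans (mul-congʳ (const b) (≋-trans (add-congˡ (⊖ 𝟙 ⊗ φ r) (e α))
              (solveᴬ 2 (λ p q → (p :+ q) :+ :- :1 :* p := q) ≋-refl (φ r) (const (α + - r) ⊗ ψ α))))
              (≋-trans (solveᴬ 3 (λ b a q → b :* (a :* q) := (a :* b) :* q) ≋-refl (const b) (const (α + - r))
                  (ψ α))
              (≋-trans (mul-congˡ (ψ α) ub) (mul-identityˡ (ψ α)))))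
            (*-closed (const b) (+-closed ∣φα (*-closed (⊖ 𝟙) ∣φr)))))
    where open IsIdeal (multiples polynomialRing π)

  ∤X : ∀ {m} π → HasDegree m π → 1 ≤ m → ¬ (coeff π 0 ≈ 0#) → ¬ Multiples polynomialRing π X
  ∤X {m} π π-deg 1≤m π₀≉0 (v , e) = (has-degree v v≉0 >>= λ (n , v-deg) →
      return (constant n v-deg (HasDegree-unique (HasDegree-lead Lead-X (λ z → 0≉1 (sym z)))
          (HasDegree-resp (≋-sym e) (HasDegree-⊗ v π v-deg π-deg))))) λ x → x
    where
    v≉0 : ¬ (v ≋ [])
    v≉0 v≋0 = 0≉1 (sym (≋-trans e (mul-null v π v≋0) .at 1))
    constant : ∀ n → HasDegree n v → 1 ≡ n ℕ.+ m → ⊥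
    constant zero    v-deg _  = *-nonzero _ _ (nonzero v-deg) π₀≉0 (trans (sym (coeff-⊗-0 v π)) (sym (e .at 0)))
    constant (suc n) v-deg eq = ℕₚ.<-irrefl (ℕₚ.suc-injective eq) (ℕₚ.≤-trans 1≤m (ℕₚ.m≤n+m m n))

  module _ (k n : ℕ) (φ : Carrier → List Carrier) (family : Family ((X ^ᴾ k) ^ᴾ n) n φ) where

    -- One prime `π` of `S` is treated at a time. It does not divide the leading coefficient of the
    -- family, a power of `y`, because `π(0) ≠ 0`; so it excludes only finitely many `α`. For the
    -- others, the Bézout identity for `π`, inserted in that for the cofactor `v`, gives one for
    -- `S`.
    cofinitely-coprime : ∀ N {m} S → m < N → HasDegree m S → ¬ (coeff S 0 ≈ 0#) →
      ¬ ¬ (∃ λ L → ∀ α → ¬ Any (α ≈_) L → ¬ ¬ Combinations polynomialRing S (φ α) 𝟙)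
    cofinitely-coprime (suc N) {zero} S _ S-deg _ = let b , e = const-unit (coeff S 0) (nonzero S-deg) in
      return ([] , λ α _ → return (const b , [] ,
          ≋-trans (≋-sym e) (≋-trans (mul-congˡ (const b) (≋-sym (Lead-0 (leading S-deg))))
        (solveᴬ 3 (λ s b p → s :* b := b :* s :+ :0 :* p) ≋-refl S (const b) (φ α)))))
    cofinitely-coprime (suc N) {suc m} S m<N S-deg S₀≉0 =
      prime-divisor S S-deg (s≤s z≤n) >>= λ (i , π , π-deg , 1≤i , (v , S≋vπ) , prime) →
      has-degree v (λ v≋0 → HasDegree⇒≉ S-deg (≋-trans S≋vπ (mul-null v π v≋0))) >>= λ (h , v-deg) →
      cofinitely-coprime N v
        (ℕₚ.≤-trans (ℕₚ.≤-trans (≡.subst (suc h ≤_) (ℕₚ.+-comm i h) (ℕₚ.+-monoˡ-≤ h 1≤i))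
          (ℕₚ.≤-reflexive (HasDegree-unique (HasDegree-resp (≋-sym S≋vπ) (HasDegree-⊗ v π v-deg π-deg)) S-deg)))
              (ℕₚ.≤-pred m<N))
        v-deg (λ z → S₀≉0 (trans (S₀ v π S≋vπ) (trans (*-congʳ z) (zeroˡ _)))) >>= λ (L , hL) →
      finite-roots π n φ family (∤power π π-deg 1≤i prime
          (λ z → S₀≉0 (trans (S₀ v π S≋vπ) (trans (*-congˡ z) (zeroʳ _))))) >>= λ (L′ , hL′) →
      return (L ++ L′ , λ α α∉ → hL α (λ α∈ → α∉ (Anyₚ.++⁺ˡ α∈)) >>= λ (a , b , e) →
        prime (φ α) >>= λ where
          (inj₁ ∣φα) → ⊥-elim (hL′ α (λ α∈ → α∉ (Anyₚ.++⁺ʳ L α∈)) ∣φα)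
          (inj₂ (a′ , b′ , e′)) → return (a ⊗ a′ , a ⊗ v ⊗ b′ ⊕ b ,
            ≋-trans e (≋-trans (add-congˡ (b ⊗ φ α)
                (≋-trans (≋-sym (≋-trans (mul-comm (a ⊗ v) 𝟙) (mul-identityˡ (a ⊗ v)))) (mul-congʳ (a ⊗ v) e′)))
            (≋-trans (solveᴬ 7 (λ a v b a′ π b′ f → (a :* v) :* (a′ :* π :+ b′ :* f) :+ b :* f :=
                a :* a′ :* (v :* π) :+ (a :* v :* b′ :+ b) :* f) ≋-refl a v b a′ π b′ (φ α))
            (add-congˡ ((a ⊗ v ⊗ b′ ⊕ b) ⊗ φ α) (mul-congʳ (a ⊗ a′) (≋-sym S≋vπ)))))))
      where
      S₀ : ∀ v π → S ≋ v ⊗ π → coeff S 0 ≈ coeff v 0 * coeff π 0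
      S₀ v π e = trans (e .at 0) (coeff-⊗-0 v π)
      ∤power : ∀ {i} π → HasDegree i π → 1 ≤ i → IsPrime π → ¬ (coeff π 0 ≈ 0#) → ¬ Multiples polynomialRing π
          ((X ^ᴾ k) ^ᴾ n)
      ∤power π π-deg 1≤i prime π₀≉0 ∣ = ^-nonzero (X ^ᴾ k) n
          (^-nonzero X k (λ z → ∤X π π-deg 1≤i π₀≉0 (Q.zero⇒member z))) (Q.member⇒zero ∣)
        where
        module Q = Quotient polynomialRing (multiples polynomialRing π)
        open IsDomain (quotientDomain π-deg 1≤i prime)

  module CharacteristicZero {g} (G : List (List Carrier) → Set g)
      (G-factor : ∀ {P} d q → P B.≋ d B.⊗ q → G P → G d × G q)
      (char0 : ∀ p → ¬ (natMul (suc p) 1# ≈ 0#)) where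

    -- In characteristic zero the multiples of 1 are distinct, so each entry of `L` excludes at most
    -- one `n`. This supplies the generic constant `α`.
    eventually-avoids : ∀ L → ¬ ¬ (∃ λ N → ∀ n → N ≤ n → ¬ Any (natMul n 1# ≈_) L)
    eventually-avoids []      = return (0 , λ n _ ())
    eventually-avoids (a ∷ L) = eventually-avoids L >>= λ (N , h) → lem (∃ λ m → natMul m 1# ≈ a) >>= λ where
        (inj₂ none)     → return (N , λ { n N≤n (here e) → none (n , e) ; n N≤n (there z) → h n N≤n z })
        (inj₁ (m , e)) → return (N ℕ.+ suc m , λ
          { n N+m<n (here e′) → distinct m n (ℕₚ.≤-trans (ℕₚ.m≤n+m (suc m) N) N+m<n) (trans e (sym e′))
          ; n N+m<n (there z) → h n (ℕₚ.≤-trans (ℕₚ.m≤m+n N (suc m)) N+m<n) z })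
      where
      distinct : ∀ m n → m < n → ¬ (natMul m 1# ≈ natMul n 1#)
      distinct m n m<n e with ℕₚ.m≤n⇒∃[o]m+o≡n m<n
      ... | o , ≡.refl = char0 o (trans
          (solve 2 (λ x y → x := (y :+ x) :+ :- y) refl (natMul (suc o) 1#) (natMul m 1#))
        (trans (+-congʳ (trans (sym (natMul-+ m (suc o) 1#))
            (trans (reflexive (≡.cong (λ i → natMul i 1#) (ℕₚ.+-suc m o))) (sym e)))) (-‿inverseʳ _)))

    -- The exponent of `y` in `w`, viewed in `K`. It exceeds all degrees of the coefficients and is
    -- settled before the eliminant, which depends on it.
    κ : List (List Carrier) → Carrier
    κ ps = natMul (2 ℕ.+ bound ps) 1#

    -- For `i ≥ 1` the integer `i (2 + bound ps) − 1` is positive, hence nonzero in `K`.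
    iκ≉1 : ∀ ps i → ¬ (natMul i (κ ps) ≈ 1#)
    iκ≉1 ps zero    e = 0≉1 e
    iκ≉1 ps (suc i) e = char0 (bound ps ℕ.+ i ℕ.* (2 ℕ.+ bound ps))
        (trans (solve 1 (λ x → x := (:1 :+ x) :+ :- :1) refl _)
      (trans (+-congʳ (trans (natMul-* (suc i) (2 ℕ.+ bound ps)) e)) (-‿inverseʳ 1#)))

    open Descent G G-factor κ iκ≉1

    fibre : ∀ ps → Smooth (monic ps) → G (monic ps) → ¬ ¬ Fibre G
    fibre ps smooth gP = descend (suc (length ps)) ps ℕₚ.≤-refl smooth gP >>=
        λ (ps , S , S≉0 , smooth , gP , comb) →
      factor-variable S S≉0 >>= λ (j , S′ , S≋ , S′₀≉0) →
      has-degree S′ (λ e → S′₀≉0 (e .at 0)) >>= λ (m , S′-deg) →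
      cofinitely-coprime (2 ℕ.+ bound ps) (length ps) _ (Family-homogenise (X ^ᴾ (2 ℕ.+ bound ps)) 𝟙 ps)
          (suc m) S′ ℕₚ.≤-refl S′-deg S′₀≉0 >>= λ (L , h) →
      -- The entry `0#` secures `α ≠ 0`.
      eventually-avoids (0# ∷ L) >>= λ (N , avoid) →
      h (natMul N 1#) (λ z → avoid N ℕₚ.≤-refl (there z)) >>= λ coprime →
      return (build ps S smooth gP comb j S′ S≋ (natMul N 1#) (λ e → avoid N ℕₚ.≤-refl (here e)) coprime)
      where
      build : ∀ ps S → Smooth (monic ps) → G (monic ps) →
        Combinations B.polynomialRing (monic ps) (Derivation.D (κ ps) 0# (monic ps)) (B.const S) →
        ∀ j S′ → S ≋ X ^ᴾ j ⊗ S′ → ∀ α → ¬ (α ≈ 0#) →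
        Combinations polynomialRing S′ (homogenise (const α ⊗ X ^ᴾ (2 ℕ.+ bound ps)) 𝟙 ps 𝟙) 𝟙 → Fibre G
      build ps S smooth gP comb j S′ S≋ α α≉0 (u , v , e) = record
        -- The constant `t = 1` has degree less than `s = 1`, so the exponent `2 + b` exceeds the
        -- required `b + s` by one.
        { ps = ps ; α = α ; k = b ; b = b ; s = 1 ; t = 𝟙 ; smooth = smooth ; property = gP
        ; α≉0 = α≉0 ; t₀≉0 = 1≉0 ; ps-bound = bounded ps ℕₚ.≤-refl ; t-bound = Lead-length 𝟙
        ; b+s≤k = ℕₚ.≤-trans (ℕₚ.≤-reflexive (ℕₚ.+-comm b 1)) (ℕₚ.n≤1+n (suc b))
        ; coprime = separable ps S j S′ (κ ps) (monomial α (2 ℕ.+ b)) 𝟙 comb S≋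
            (θ-monomial α (2 ℕ.+ b)) (θ-const 1#) (first-coefficient ps α b 𝟙 smooth 1≉0)
                (monomial-unit (2 ℕ.+ b) α≉0) S′-unit }
        where
        b = bound ps
        1≉0 : ¬ (1# ≈ 0#)
        1≉0 e = 0≉1 (sym e)
        S′-unit : ∀ {Q : CommutativeRing c (c ⊔ ℓ)} (φ : RingHom polynomialRing Q) →
          ZeroUnder φ (homogenise (monomial α (2 ℕ.+ b)) 𝟙 ps 𝟙) → UnitUnder φ 𝟙 → UnitUnder φ S′
        S′-unit {Q} φ F∼0 _ = ⟦ u ⟧ , Q.trans (Q.*-comm _ _) (Q.trans (Q.sym (Q.+-identityʳ _)) (Q.trans
            (Q.+-cong (Q.sym (*-homo u S′))
                (Q.sym (Q.trans (*-homo v F) (Q.trans (Q.*-congˡ F∼0) (Q.zeroʳ _)))))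
            (Q.trans (Q.sym (+-homo (u ⊗ S′) (v ⊗ F))) (Q.trans (cong (≋-sym e)) 1-homo))))
          where
          module Q = CommutativeRing Q
          open RingHom φ
          F = homogenise (monomial α (2 ℕ.+ b)) 𝟙 ps 𝟙

  fibre : ∀ {g} (G : List (List Carrier) → Set g) (G-factor : ∀ {P} d q → P B.≋ d B.⊗ q → G P → G d × G q) →
    ∀ ps → Smooth (monic ps) → G (monic ps) → ¬ ¬ Fibre G
  fibre G G-factor ps smooth gP = lem (∃ λ p → natMul (suc p) 1# ≈ 0#) >>= λ where
    (inj₁ (p , p≈0)) → PositiveCharacteristic.fibre G G-factor p p≈0 ps smooth gP
    (inj₂ none)      → CharacteristicZero.fibre G G-factor (λ p e → none (p , e)) ps smooth gP

  -- Comparison with the polynomial arithmetic of the statement.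

  evaluate : Carrier → RingHom polynomialRing commutativeRing
  evaluate y = Evaluation.evalHom (identity commutativeRing) y

  evaluate₂ : Carrier → Carrier → RingHom B.polynomialRing commutativeRing
  evaluate₂ x y = Evaluation.evalHom (evaluate y) x

  evalP-≡ : ∀ p x → evalP p x ≡ RingHom.⟦_⟧ (evaluate x) p
  evalP-≡ []      x = ≡.refl
  evalP-≡ (a ∷ p) x = ≡.cong (λ z → a + x * z) (evalP-≡ p x)

  addP-≡ : ∀ p q → Defsᴾ.addP p q ≡ p ⊕ q
  addP-≡ []      q       = ≡.refl
  addP-≡ (a ∷ p) []      = ≡.refl
  addP-≡ (a ∷ p) (b ∷ q) = ≡.cong (a + b ∷_) (addP-≡ p q)

  scaleP-≡ : ∀ a p → Defsᴾ.scaleP a p ≡ scale a p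
  scaleP-≡ a []      = ≡.refl
  scaleP-≡ a (b ∷ p) = ≡.cong (a * b ∷_) (scaleP-≡ a p)

  negP-≡ : ∀ p → Defsᴾ.negP p ≡ ⊖ p
  negP-≡ []      = ≡.refl
  negP-≡ (a ∷ p) = ≡.cong (- a ∷_) (negP-≡ p)

  mulP-≡ : ∀ p q → Defsᴾ.mulP p q ≡ p ⊗ q
  mulP-≡ []      q = ≡.refl
  mulP-≡ (a ∷ p) q = ≡.trans (addP-≡ (Defsᴾ.scaleP a q) (0# ∷ Defsᴾ.mulP p q))
      (≡.cong₂ (λ u v → add u (0# ∷ v)) (scaleP-≡ a q) (mulP-≡ p q))

  derivAux-suc : ∀ n p → Defsᴾ.derivAux (suc n) p ≋ p ⊕ Defsᴾ.derivAux n p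
  derivAux-suc n []      = ≋-refl
  derivAux-suc n (a ∷ p) = ∷-cong refl (derivAux-suc (suc n) p)

  derivAux-0 : ∀ p → Defsᴾ.derivAux 0 p ≋ (0# ∷ Defsᴾ.derivP p)
  derivAux-0 []      = ≋-sym 0∷[]
  derivAux-0 (a ∷ p) = ≋-refl

  derivP-≋ : ∀ p → Defsᴾ.derivP p ≋ derivative p
  derivP-≋ []      = ≋-refl
  derivP-≋ (a ∷ p) = ≋-trans (derivAux-suc 0 p)
      (add-congʳ p (≋-trans (derivAux-0 p) (∷-cong refl (derivP-≋ p))))

  ≋⇒≈ᴾ : ∀ p q → p ≋ q → Defsᴾ._≈ᴾ_ p q
  ≋⇒≈ᴾ p q e = ≡.subst Defsᴾ.IsZeroP (≡.sym (≡.trans (addP-≡ p (Defsᴾ.negP q)) (≡.cong (add p) (negP-≡ q))))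
      (all (p ⊕ ⊖ q) (≋-trans (add-congˡ (⊖ q) e) (A.-‿inverseʳ q)))
    where
    all : ∀ r → r ≋ [] → All (_≈ 0#) r
    all []      e = []
    all (a ∷ r) e = e .at 0 ∷ all r (pointwise λ n → e .at (suc n))

  separable-from : ∀ {p} f → p ≋ f → Combinations polynomialRing f (derivative f) 𝟙 → Defsᴾ.Separable p
  separable-from {p} f e (U , V , eq) = U , V ,
    ≋⇒≈ᴾ (Defsᴾ.addP (Defsᴾ.mulP U p) (Defsᴾ.mulP V (Defsᴾ.derivP p))) 𝟙
      (≡.subst (_≋ 𝟙) (≡.sym (≡.trans (addP-≡ (Defsᴾ.mulP U p) _)
          (≡.cong₂ add (mulP-≡ U p) (mulP-≡ V (Defsᴾ.derivP p)))))
        (≋-trans (add-cong (mul-congʳ U e) (mul-congʳ V (≋-trans (derivP-≋ p) (derivative-cong e))))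
            (≋-sym eq)))

  coefficients : ∀ d → List Carrier → Vec Carrier d
  coefficients d f = Vec.tabulate (λ i → coeff f (toℕ i))

  monic-coefficients : ∀ d f → Lead d 1# f → Defsᴾ.monic (coefficients d f) ≋ f
  monic-coefficients zero    f       l = ≋-sym (Lead-0 l)
  monic-coefficients (suc d) []      l = ⊥-elim (0≉1 (lead l))
  monic-coefficients (suc d) (a ∷ f) l =
      ∷-cong refl (monic-coefficients d f (leads (λ j d<j → above l (suc j) (s≤s d<j)) (lead l)))

  -- The outer variable is `y` in the statement, but `x` in the curves of the proof, whence the
  -- exchanged arguments.
  eval₂-≈ : ∀ P x y → Defsᴾ.eval2 P x y ≈ RingHom.⟦_⟧ (evaluate₂ y x) P
  eval₂-≈ []      x y = refl
  eval₂-≈ (p ∷ P) x y = +-cong (reflexive (evalP-≡ p x)) (*-congˡ (eval₂-≈ P x y))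

  eval-derivAux-suc : ∀ n p x → evalP (Defsᴾ.derivAux (suc n) p) x ≈ evalP p x + evalP (Defsᴾ.derivAux n p) x
  eval-derivAux-suc n []      x = sym (+-identityˡ 0#)
  eval-derivAux-suc n (a ∷ p) x = trans (+-congˡ (*-congˡ (eval-derivAux-suc (suc n) p x)))
    (solve 5 (λ a b x u v → (a :+ b) :+ x :* (u :+ v) := (a :+ x :* u) :+ (b :+ x :* v)) refl a
        (natMul n a) x _ _)

  eval-derivAux-0 : ∀ p x → evalP (Defsᴾ.derivAux 0 p) x ≈ x * evalP (Defsᴾ.derivP p) x
  eval-derivAux-0 []      x = sym (zeroʳ x)
  eval-derivAux-0 (a ∷ p) x = +-identityˡ _

  eval-natMul : ∀ n p x → evalP (List.map (natMul n) p) x ≈ natMul n (evalP p x)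
  eval-natMul n []      x = sym (zeros n)
    where
    zeros : ∀ n → natMul n 0# ≈ 0#
    zeros zero    = refl
    zeros (suc n) = trans (+-identityˡ _) (zeros n)
  eval-natMul n (a ∷ p) x = trans (+-congˡ (*-congˡ (eval-natMul n p x))) (sym (distribute n a (evalP p x)))
    where
    distribute : ∀ n a b → natMul n (a + x * b) ≈ natMul n a + x * natMul n b
    distribute zero    a b = solve 1 (λ x → :0 := :0 :+ x :* :0) refl x
    distribute (suc n) a b = trans (+-congˡ (distribute n a b))
      (solve 5 (λ a b x u v → (a :+ x :* b) :+ (u :+ x :* v) := (a :+ u) :+ x :* (b :+ v)) refl a b x _ _)

  eval-dyAux : ∀ n P a b → evalP (List.map (λ p → evalP p a) (Defsᴾ.dyAux n P)) b ≈ evalP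
      (Defsᴾ.derivAux n (List.map (λ p → evalP p a) P)) b
  eval-dyAux n []      a b = refl
  eval-dyAux n (p ∷ P) a b = +-cong (eval-natMul n p a) (*-congˡ (eval-dyAux (suc n) P a b))

  eval-∂y : ∀ P a b → Defsᴾ.eval2 (Defsᴾ.∂y P) a b ≈ evalP (Defsᴾ.derivP (List.map (λ p → evalP p a) P)) b
  eval-∂y []      a b = refl
  eval-∂y (p ∷ P) a b = eval-dyAux 1 P a b

  -- Translation and shear to a curve monic in x.

  module _ (b : Carrier) where
    translate : List Carrier → List Carrier
    translate = Evaluation.eval constHom (b ∷ 1# ∷ [])

    coeff-translate-0 : ∀ p → coeff (translate p) 0 ≈ evalP p b
    coeff-translate-0 []      = refl
    coeff-translate-0 (a ∷ p) = trans (coeff-add (const a) ((b ∷ 1# ∷ []) ⊗ translate p) 0)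
      (+-congˡ (trans (coeff-⊗-0 (b ∷ 1# ∷ []) (translate p)) (*-congˡ (coeff-translate-0 p))))

    coeff-translate-1 : ∀ p → coeff (translate p) 1 ≈ evalP (Defsᴾ.derivP p) b
    coeff-translate-1 []      = refl
    coeff-translate-1 (a ∷ p) = trans (coeff-add (const a) ((b ∷ 1# ∷ []) ⊗ translate p) 1)
      (trans (+-congˡ (trans (coeff-⊗-1 (b ∷ 1# ∷ []) (translate p))
          (+-cong (*-congˡ (coeff-translate-1 p)) (*-congˡ (coeff-translate-0 p)))))
      (trans (solve 3 (λ b u v → :0 :+ (b :* u :+ :1 :* v) := v :+ b :* u) refl b _ _)
      (sym (trans (eval-derivAux-suc 0 p b) (+-congˡ (eval-derivAux-0 p b))))))

  module Preparation (a b : Carrier) where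

    -- P(a + x, b + y + x^M) has a constant leading coefficient in x for large M.
    module _ (M : ℕ) where
      ξ ζ : List (List Carrier)
      ξ = const a ∷ 𝟙 ∷ []
      ζ = B.const (b ∷ 1# ∷ []) B.⊕ B.X B.^ᴾ suc M

      inner : RingHom polynomialRing B.polynomialRing
      inner = Evaluation.evalHom (compose B.constHom constHom) ξ

      outer : RingHom B.polynomialRing B.polynomialRing
      outer = Evaluation.evalHom inner ζ

      open RingHom outer using () renaming (⟦_⟧ to sheared) public
      open RingHom inner using () renaming (⟦_⟧ to shifted) public

      one-power : ∀ n → 𝟙 ^ᴾ n ≋ 𝟙
      one-power zero    = ≋-refl
      one-power (suc n) = ≋-trans (mul-identityˡ (𝟙 ^ᴾ n)) (one-power n)

      ξ-lead : B.Lead 1 𝟙 ξ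
      ξ-lead = B.leads (λ { (suc (suc j)) _ → ≋-refl ; (suc zero) (s≤s ()) }) ≋-refl

      X-power-lead : ∀ n → B.Lead n 𝟙 (B.X B.^ᴾ n)
      X-power-lead n = ≡.subst (λ m → B.Lead m 𝟙 (B.X B.^ᴾ n)) (ℕₚ.*-identityʳ n)
          (B.Lead-resp (one-power n) B.≋-refl (B.Lead-^ B.X n B.Lead-X))

      ζ-lead : B.Lead (suc M) 𝟙 ζ
      ζ-lead = B.Lead-⊕ {p = B.const (b ∷ 1# ∷ [])} (B.Lead-weaken (s≤s z≤n) (B.Lead-const (b ∷ 1# ∷ [])))
          (X-power-lead (suc M))

      shifted-bound : ∀ p → B.Lead (length p) [] (shifted p)
      shifted-bound []      = B.Lead-length []
      shifted-bound (a₀ ∷ p) = B.Lead-⊕ {p = B.const (const a₀)}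
          (B.Lead-weaken (s≤s z≤n) (B.Lead-const (const a₀)))
        (B.Lead-resp (mul-zeroʳ 𝟙) B.≋-refl (B.Lead-⊗ ξ (shifted p) ξ-lead (shifted-bound p)))

      ConstantLead : List (List Carrier) → Set (c ⊔ ℓ)
      ConstantLead Q = Q B.≋ [] ⊎ ∃ λ n → ∃ λ u → ¬ (u ≈ 0#) × B.Lead n (const u) Q

      shifted-lead : ∀ p → ¬ ¬ ConstantLead (shifted p)
      shifted-lead []       = return (inj₁ B.≋-refl)
      shifted-lead (a₀ ∷ p) = shifted-lead p >>= λ where
        (inj₂ (n , u , u≉0 , l)) → return
            (inj₂ (suc n , u , u≉0 , B.Lead-⊕ {p = B.const (const a₀)}
            (B.Lead-weaken (s≤s z≤n) (B.Lead-const (const a₀)))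
          (B.Lead-resp (mul-identityˡ (const u)) B.≋-refl (B.Lead-⊗ ξ (shifted p) ξ-lead l))))
        (inj₁ e) → let e′ = B.≋-trans (B.add-congʳ (B.const (const a₀)) (B.≋-trans (B.mul-congʳ ξ e) (B.mul-zeroʳ ξ))) (B.add-identityʳ (B.const (const a₀))) in
          lem (a₀ ≈ 0#) >>= λ where
            (inj₁ a₀≈0) → return (inj₁ (B.≋-trans e′
                (B.≋-trans (B.const-cong (≋-trans (const-cong a₀≈0) 0∷[])) B.0∷[])))
            (inj₂ a₀≉0) → return (inj₂ (0 , a₀ , a₀≉0 , B.Lead-resp ≋-refl (B.≋-sym e′)
                (B.Lead-const (const a₀))))

      -- By Horner's scheme: `shifted p` has degree less than `length p ≤ M`, so once `sheared P` is
      -- nonzero, `ζ ⊗ sheared P` dominates with degree at least `M + 1`. The leading coefficient is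
      -- thus that of the last nonzero coefficient of `P`, an element of `K`.
      sheared-lead : ∀ P → bound P ≤ M → ¬ ¬ ConstantLead (sheared P)
      sheared-lead []      _   = return (inj₁ B.≋-refl)
      sheared-lead (p ∷ P) b≤M = sheared-lead P (ℕₚ.≤-trans (ℕₚ.m≤n+m (bound P) (length p)) b≤M) >>= λ where
        (inj₂ (n , u , u≉0 , l)) → return (inj₂ (suc M ℕ.+ n , u , u≉0 ,
          B.Lead-⊕ {p = shifted p} (B.Lead-weaken
              (s≤s (ℕₚ.≤-trans (ℕₚ.≤-trans (ℕₚ.m≤m+n (length p) (bound P)) b≤M) (ℕₚ.m≤m+n M n)))
              (shifted-bound p))
            (B.Lead-resp (mul-identityˡ (const u)) B.≋-refl (B.Lead-⊗ ζ (sheared P) ζ-lead l))))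
        (inj₁ e) → let e′ = B.≋-trans (B.add-congʳ (shifted p) (B.≋-trans (B.mul-congʳ ζ e) (B.mul-zeroʳ ζ))) (B.add-identityʳ (shifted p)) in
          shifted-lead p >>= λ where
            (inj₁ e″)               → return (inj₁ (B.≋-trans e′ e″))
            (inj₂ (n , u , u≉0 , l)) → return (inj₂ (n , u , u≉0 , B.Lead-resp ≋-refl (B.≋-sym e′) l))

      sheared-value : ∀ P x y → RingHom.⟦_⟧ (evaluate₂ x y) (sheared P) ≈ Defsᴾ.eval2 P (a + x)
          (b + y + x ^ suc M)
      sheared-value P x y = trans (eval-compose ev inner ζ P) (trans
          (eval-respects (compose ev inner) (evaluate (a + x)) inner-value ζ-value P)
          (sym (eval₂-≈ P (a + x) (b + y + x ^ suc M))))
        where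
        ev = evaluate₂ x y
        module ev = RingHom ev
        constant : ∀ p → ev.⟦ B.const p ⟧ ≈ RingHom.⟦_⟧ (evaluate y) p
        constant = Evaluation.eval-const (evaluate y) x
        inner-value : ∀ p → ev.⟦ shifted p ⟧ ≈ RingHom.⟦_⟧ (evaluate (a + x)) p
        inner-value p = trans (eval-compose ev (compose B.constHom constHom) ξ p)
          (eval-respects (compose ev (compose B.constHom constHom)) (identity commutativeRing)
            (λ u → trans (constant (const u)) (Evaluation.eval-const (identity commutativeRing) y u))
            (solve 3 (λ a x y → (a :+ y :* :0) :+ x :* ((:1 :+ y :* :0) :+ x :* :0) := a :+ x) refl a x y) p)
        ζ-value : ev.⟦ ζ ⟧ ≈ b + y + x ^ suc M
        ζ-value = trans (ev.+-homo (B.const (b ∷ 1# ∷ [])) (B.X B.^ᴾ suc M)) (+-cong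
          (trans (constant (b ∷ 1# ∷ [])) (solve 2 (λ b y → b :+ y :* (:1 :+ y :* :0) := b :+ y) refl b y))
          (trans (ev.^-homo B.X (suc M)) (powers (suc M))))
          where
          powers : ∀ n → ev.⟦ B.X ⟧ ^ n ≈ x ^ n
          powers zero    = refl
          powers (suc n) = *-cong (Evaluation.eval-X (evaluate y) x) (powers n)

      -- At `x = 0` the shear disappears, its exponent `suc M` being positive, and `P(a, b + y)` is
      -- left; its first two coefficients are the value and the `y`-derivative of `P` at the given
      -- point.
      sheared-at-0 : ∀ P → B.coeff (sheared P) 0 ≋ translate b (List.map (λ p → evalP p a) P)
      sheared-at-0 []      = ≋-refl
      sheared-at-0 (p ∷ P) = ≋-trans (B.coeff-add (shifted p) (ζ B.⊗ sheared P) 0) (add-cong (shifted-at-0 p)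
        (≋-trans (B.coeff-⊗-0 ζ (sheared P)) (mul-cong₂ ζ-at-0 (sheared-at-0 P))))
        where
        shifted-at-0 : ∀ p → B.coeff (shifted p) 0 ≋ const (evalP p a)
        shifted-at-0 []       = ≋-sym 0∷[]
        shifted-at-0 (a₀ ∷ p) = ≋-trans (B.coeff-add (B.const (const a₀)) (ξ B.⊗ shifted p) 0)
          (≋-trans (add-congʳ (const a₀) (≋-trans (B.coeff-⊗-0 ξ (shifted p))
              (mul-congʳ (const a) (shifted-at-0 p))))
          (≋-sym (≋-trans (RingHom.+-homo constHom a₀ (a * evalP p a))
              (add-congʳ (const a₀) (RingHom.*-homo constHom a (evalP p a))))))
        ζ-at-0 : B.coeff ζ 0 ≋ b ∷ 1# ∷ []
        ζ-at-0 = ≋-trans (B.coeff-add (B.const (b ∷ 1# ∷ [])) (B.X B.^ᴾ suc M) 0)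
          (≋-trans (add-congʳ (b ∷ 1# ∷ []) (B.X-⊗ (B.X B.^ᴾ M) .B.at 0)) (add-identityʳ (b ∷ 1# ∷ [])))

    module _ (P : List (List Carrier)) (vanishes : Defsᴾ.eval2 P a b ≈ 0#)
        (simple : ¬ (Defsᴾ.eval2 (Defsᴾ.∂y P) a b ≈ 0#)) where
      private M = bound P

      sheared-smooth : Smooth (sheared M P)
      sheared-smooth = trans (sheared-at-0 M P .at 0)
          (trans (coeff-translate-0 b (List.map (λ p → evalP p a) P)) vanishes) ,
        λ e → simple (trans (eval-∂y P a b)
            (trans (sym (coeff-translate-1 b (List.map (λ p → evalP p a) P)))
            (trans (sym (sheared-at-0 M P .at 1)) e)))

      Prepared : Set (c ⊔ ℓ)
      Prepared = ∃ λ ps → Smooth (monic ps) ×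
        (∀ x y → RingHom.⟦_⟧ (evaluate₂ x y) (monic ps) ≈ 0# → Defsᴾ.eval2 P (a + x) (b + y + x ^ suc M) ≈ 0#)

      prepared : ¬ ¬ Prepared
      prepared = sheared-lead M P ℕₚ.≤-refl >>= λ where
          (inj₁ e) → ⊥-elim (proj₂ sheared-smooth (e .B.at 0 .at 1))
          (inj₂ (n , u , u≉0 , l)) → return (normalise n u u≉0 l)
        where
        normalise : ∀ n u → ¬ (u ≈ 0#) → B.Lead n (const u) (sheared M P) → Prepared
        normalise n u u≉0 l = ps , smooth , zeros
          where
          v = proj₁ (const-unit u u≉0)
          uv≋1 = proj₂ (const-unit u u≉0)
          Q = B.const (const v) B.⊗ sheared M P
          form = monic-form n Q (B.Lead-resp (≋-trans (mul-comm (const v) (const u)) uv≋1) B.≋-refl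
                   (B.Lead-⊗ (B.const (const v)) (sheared M P) (B.Lead-const (const v)) l))
          ps = proj₁ form
          Q≋ = proj₂ (proj₂ form)
          original : sheared M P B.≋ B.const (const u) B.⊗ monic ps
          original = B.≋-trans (B.≋-sym (B.mul-identityˡ (sheared M P)))
            (B.≋-trans (B.mul-congˡ (sheared M P)
                (B.≋-trans (B.const-cong (≋-sym uv≋1)) (RingHom.*-homo B.constHom (const u) (const v))))
            (B.≋-trans (B.mul-assoc (B.const (const u)) (B.const (const v)) (sheared M P))
                (B.mul-congʳ (B.const (const u)) Q≋)))
          coefficient : ∀ j → coeff (B.coeff (sheared M P) 0) j ≈ u * coeff (B.coeff (monic ps) 0) j
          coefficient j = trans (original .B.at 0 .at j)
              (trans (B.coeff-const-⊗ (const u) (monic ps) 0 .at j) (coeff-const-⊗ u (B.coeff (monic ps) 0) j))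
          smooth : Smooth (monic ps)
          smooth = Units.unit-cancel commutativeRing (inverse u u≉0)
              (trans (sym (coefficient 0)) (proj₁ sheared-smooth)) ,
            λ e → proj₂ sheared-smooth (trans (coefficient 1) (trans (*-congˡ e) (zeroʳ u)))
          zeros : ∀ x y → RingHom.⟦_⟧ (evaluate₂ x y) (monic ps) ≈ 0# → Defsᴾ.eval2 P (a + x)
              (b + y + x ^ suc M) ≈ 0#
          zeros x y e = trans (sym (sheared-value M P x y))
              (trans (ev.cong original) (trans (ev.*-homo (B.const (const u)) (monic ps))
            (trans (*-congˡ e) (zeroʳ _))))
            where module ev = RingHom (evaluate₂ x y)

      -- Translation and shear are invertible on points, so the finite list of zeros can be carried
      -- over by the inverse map.
      prepared-zeros : ∀ (L : List (Carrier × Carrier)) →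
          (∀ x y → Defsᴾ.eval2 P x y ≈ 0# → Any (λ z → x ≈ proj₁ z × y ≈ proj₂ z) L) →
        ∀ ps → (∀ x y → RingHom.⟦_⟧ (evaluate₂ x y) (monic ps) ≈ 0# → Defsᴾ.eval2 P (a + x)
            (b + y + x ^ suc M) ≈ 0#) →
        ∀ x y → RingHom.⟦_⟧ (evaluate₂ x y) (monic ps) ≈ 0# →
        Any (λ z → x ≈ proj₁ z × y ≈ proj₂ z)
            (List.map (λ (u , v) → (u + - a) , (v + - b + - ((u + - a) ^ suc M))) L)
      prepared-zeros L finite ps zeros x y e =
          Anyₚ.map⁺ (Any.map (λ {(u , v)} → move u v) (finite _ _ (zeros x y e)))
        where
        powers : ∀ {x z} n → x ≈ z → x ^ n ≈ z ^ n
        powers zero    e = refl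
        powers (suc n) e = *-cong e (powers n e)
        move : ∀ u v → a + x ≈ u × b + y + x ^ suc M ≈ v → x ≈ u + - a × y ≈ v + - b + - ((u + - a) ^ suc M)
        move u v (e , f) = x≈ , trans (solve 3 (λ b y w → y := (b :+ y :+ w) :+ :- b :+ :- w) refl b y
            (x ^ suc M))
            (+-cong (+-congʳ f) (-‿cong (powers (suc M) x≈)))
          where
          x≈ : x ≈ u + - a
          x≈ = trans (solve 2 (λ a x → x := (a :+ x) :+ :- a) refl a x) (+-congʳ e)

  -- Continuous families and the perturbation argument.

  module Topology {o} (τ : FieldTopology K o) where
    open FieldTopology τ

    ContinuousAt0 : (Carrier → Carrier) → Set (c ⊔ lsuc o)
    ContinuousAt0 f = ∀ U → IsOpen U → U (f 0#) → ∃ λ V → IsOpen V × V 0# × (∀ s → V s → U (f s))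

    const-continuous : ∀ a → ContinuousAt0 (λ _ → a)
    const-continuous a U U-open Ua = (λ _ → Lift o ⊤) , univ-open , lift tt , λ s _ → Ua

    combine : ∀ {f g : Carrier → Carrier} {h : Carrier → Carrier → Carrier} →
      (∀ x y U → IsOpen U → U (h x y) → ∃ λ V → ∃ λ W → IsOpen V × IsOpen W × V x × W y ×
          (∀ x′ y′ → V x′ → W y′ → U (h x′ y′))) →
      ContinuousAt0 f → ContinuousAt0 g → ContinuousAt0 (λ s → h (f s) (g s))
    combine {f} {g} h-cont f-cont g-cont U U-open Uh =
      let V , W , V-open , W-open , Vf , Wg , VW = h-cont (f 0#) (g 0#) U U-open Uh
          V′ , V′-open , V′0 , fV = f-cont V V-open Vf
          W′ , W′-open , W′0 , gW = g-cont W W-open Wg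
      in (λ s → V′ s × W′ s) , ∩-open V′-open W′-open , (V′0 , W′0) , λ s (v , w) → VW (f s) (g s) (fV s v)
          (gW s w)

    neg-continuous : ∀ {f} → ContinuousAt0 f → ContinuousAt0 (λ s → - f s)
    neg-continuous {f} f-cont U U-open U-f =
      let V , V-open , Vf , VU = neg-cont (f 0#) U U-open U-f
          W , W-open , W0 , fW = f-cont V V-open Vf
      in W , W-open , W0 , λ s w → VU (f s) (fW s w)

    infix 4 _≐_
    record _≐_ (f g : Σ (Carrier → Carrier) ContinuousAt0) : Set (c ⊔ ℓ) where
      constructor everywhere
      field value : ∀ s → proj₁ f s ≈ proj₁ g s
    open _≐_ public

    -- A polynomial over this ring is a family of polynomials in a parameter `s` whose coefficients
    -- are continuous at 0. Over it the perturbed `F` is continuous by construction, and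
    -- homogenisation and the degree lemmas apply as they stand.
    continuousFunctions : CommutativeRing (c ⊔ lsuc o) (c ⊔ ℓ)
    continuousFunctions = record
      { Carrier = Σ (Carrier → Carrier) ContinuousAt0
      ; _≈_ = _≐_
      ; _+_ = λ (f , f-cont) (g , g-cont) → (λ s → f s + g s) , combine +-cont f-cont g-cont
      ; _*_ = λ (f , f-cont) (g , g-cont) → (λ s → f s * g s) , combine *-cont f-cont g-cont
      ; -_ = λ (f , f-cont) → (λ s → - f s) , neg-continuous f-cont
      ; 0# = (λ _ → 0#) , const-continuous 0#
      ; 1# = (λ _ → 1#) , const-continuous 1#
      ; isCommutativeRing = record
        { isRing = record
          { +-isAbelianGroup = record
            { isGroup = record
              { isMonoid = record
                { isSemigroup = record
                  { isMagma = record
                    { isEquivalence = record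
                      { refl = everywhere λ s → refl
                      ; sym = λ e → everywhere λ s → sym (e .value s)
                      ; trans = λ e f → everywhere λ s → trans (e .value s) (f .value s) }
                    ; ∙-cong = λ e f → everywhere λ s → +-cong (e .value s) (f .value s) }
                  ; assoc = λ f g h → everywhere λ s → +-assoc _ _ _ }
                ; identity = (λ f → everywhere λ s → +-identityˡ _) , λ f → everywhere λ s → +-identityʳ _ }
              ; inverse = (λ f → everywhere λ s → -‿inverseˡ _) , λ f → everywhere λ s → -‿inverseʳ _
              ; ⁻¹-cong = λ e → everywhere λ s → -‿cong (e .value s) }
            ; comm = λ f g → everywhere λ s → +-comm _ _ }
          ; *-cong = λ e f → everywhere λ s → *-cong (e .value s) (f .value s)
          ; *-assoc = λ f g h → everywhere λ s → *-assoc _ _ _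
          ; *-identity = (λ f → everywhere λ s → *-identityˡ _) , λ f → everywhere λ s → *-identityʳ _
          ; distrib = (λ f g h → everywhere λ s → distribˡ _ _ _) , λ f g h → everywhere λ s → distribʳ _ _ _ }
        ; *-comm = λ f g → everywhere λ s → *-comm _ _ }
      }

    valueAt : Carrier → RingHom continuousFunctions commutativeRing
    valueAt s = record
      { ⟦_⟧ = λ f → proj₁ f s ; cong = λ e → e .value s ; 0-homo = refl ; 1-homo = refl
      ; +-homo = λ _ _ → refl ; *-homo = λ _ _ → refl }

    constants : RingHom commutativeRing continuousFunctions
    constants = record
      { ⟦_⟧ = λ a → (λ _ → a) , const-continuous a ; cong = λ e → everywhere λ _ → e
      ; 0-homo = everywhere λ _ → refl ; 1-homo = everywhere λ _ → refl
      ; +-homo = λ _ _ → everywhere λ _ → refl ; *-homo = λ _ _ → everywhere λ _ → refl }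

    parameter : Σ (Carrier → Carrier) ContinuousAt0
    parameter = (λ s → s) , λ U U-open U0 → U , U-open , U0 , λ s u → u

    intersection : ∀ d (W : Fin d → Pred Carrier o) → (∀ i → IsOpen (W i)) → (∀ i → W i 0#) →
      ∃ λ V → IsOpen V × V 0# × (∀ s → V s → ∀ i → W i s)
    intersection zero    W W-open W0 = (λ _ → Lift o ⊤) , univ-open , lift tt , λ s _ ()
    intersection (suc d) W W-open W0 =
      let V , V-open , V0 , VW = intersection d (λ i → W (Fin.suc i)) (λ i → W-open (Fin.suc i)) (λ i → W0 (Fin.suc i)) in
      (λ s → W Fin.zero s × V s) , ∩-open (W-open Fin.zero) V-open , (W0 Fin.zero , V0) ,
      λ { s (w , v) Fin.zero → w ; s (w , v) (Fin.suc i) → VW s v i }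

    -- The Hausdorff property separates 0 from the listed points one after the other; points equal
    -- to 0 are dropped from the list.
    isolate : ∀ S V → IsOpen V → V 0# → (∀ s → V s → s ≈ 0# ⊎ Any (s ≈_) S) →
      ¬ ¬ (∃ λ W → IsOpen W × W 0# × (∀ s → W s → s ≈ 0#))
    isolate []      V V-open V0 V⊆ = return (V , V-open , V0 , λ s v → Sum.[ (λ e → e) , (λ ()) ] (V⊆ s v))
    isolate (a ∷ S) V V-open V0 V⊆ = lem (0# ≈ a) >>= λ where
      (inj₁ 0≈a) → isolate S V V-open V0
          (λ s v → Sum.[ inj₁ , (λ { (here e) → inj₁ (trans e (sym 0≈a)) ; (there z) → inj₂ z }) ] (V⊆ s v))
      (inj₂ 0≉a) → let U , U′ , U-open , U′-open , U0 , U′a , disjoint = hausdorff 0# a 0≉a in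
        isolate S (λ s → V s × U s) (∩-open V-open U-open) (V0 , U0)
          (λ s (v , u) → Sum.[ inj₁ , (λ { (here e) → ⊥-elim (disjoint s u (open-resp U′-open (sym e) U′a)) ;
              (there z) → inj₂ z }) ] (V⊆ s v))

    -- If 0 is isolated, so is every `x`: continuity of addition at `(x , - x)` makes `y - x` lie in
    -- the small neighbourhood of 0 for `y` near `x`. That contradicts `nonDiscrete`.
    neighbourhood-infinite : ∀ S V → IsOpen V → V 0# → (∀ s → V s → Any (s ≈_) S) → ⊥
    neighbourhood-infinite S V V-open V0 V⊆ = isolate S V V-open V0 (λ s v → inj₂ (V⊆ s v))
        λ (W , W-open , W0 , W-zero) →
      nonDiscrete λ x → let U , U′ , U-open , U′-open , Ux , U′-x , UU′ = +-cont x (- x) W W-open (open-resp W-open (sym (-‿inverseʳ x)) W0) in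
        U , U-open , Ux , λ y Uy → trans (solve 2 (λ x y → y := (y :+ :- x) :+ x) refl x y)
          (trans (+-congʳ (W-zero _ (UU′ y (- x) Uy U′-x))) (+-identityˡ x))

    private
      module C = CommutativeRing continuousFunctions
      module PC = Polynomials continuousFunctions

    ι : List Carrier → List C.Carrier
    ι = PolynomialMap.mapᴾ constants

    specialise : Carrier → List C.Carrier → List Carrier
    specialise s = PolynomialMap.mapᴾ (valueAt s)

    Zeros⊆ : List (Carrier × Carrier) → List (List Carrier) → Set (c ⊔ ℓ)
    Zeros⊆ L P = ∀ x y → RingHom.⟦_⟧ (evaluate₂ x y) P ≈ 0# → Any (λ z → x ≈ proj₁ z × y ≈ proj₂ z) L

    Zeros⊆-factor : ∀ L {P} d q → P B.≋ d B.⊗ q → Zeros⊆ L P → Zeros⊆ L d × Zeros⊆ L q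
    Zeros⊆-factor L {P} d q e z =
        (λ x y d≈0 → z x y (trans (product x y) (trans (*-congʳ d≈0) (zeroˡ _)))) ,
        (λ x y q≈0 → z x y (trans (product x y) (trans (*-congˡ q≈0) (zeroʳ _))))
      where
      product : ∀ x y → RingHom.⟦_⟧ (evaluate₂ x y) P ≈ RingHom.⟦_⟧ (evaluate₂ x y) d * RingHom.⟦_⟧
          (evaluate₂ x y) q
      product x y = trans (RingHom.cong (evaluate₂ x y) e) (RingHom.*-homo (evaluate₂ x y) d q)

    pair : Carrier → Carrier → RingHom PC.polynomialRing commutativeRing
    pair s y = Evaluation.evalHom (valueAt s) y

    evaluate-map : ∀ s y f → RingHom.⟦_⟧ (evaluate y) (specialise s f) ≈ RingHom.⟦_⟧ (pair s y) f
    evaluate-map s y f = trans (eval-compose (evaluate y) (compose constHom (valueAt s)) X f)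
      (eval-respects (compose (evaluate y) (compose constHom (valueAt s))) (valueAt s)
        (λ a → Evaluation.eval-const (identity commutativeRing) y (proj₁ a s))
            (Evaluation.eval-X (identity commutativeRing) y) f)

    pair-ι : ∀ s y p → RingHom.⟦_⟧ (pair s y) (ι p) ≈ RingHom.⟦_⟧ (evaluate y) p
    pair-ι s y p = trans (eval-compose (pair s y) (compose PC.constHom constants) PC.X p)
      (eval-respects (compose (pair s y) (compose PC.constHom constants)) (identity commutativeRing)
        (λ a → Evaluation.eval-const (valueAt s) y (RingHom.⟦_⟧ constants a)) (Evaluation.eval-X (valueAt s) y)
            p)

    map-ι : ∀ s p → specialise s (ι p) ≋ p
    map-ι s p = ≋-trans (eval-compose (PolynomialMap.mapHom (valueAt s)) (compose PC.constHom constants) PC.X p)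
      (≋-trans (eval-respects (compose (PolynomialMap.mapHom (valueAt s)) (compose PC.constHom constants))
          constHom
        (λ a → Evaluation.eval-const (compose constHom (valueAt s)) X (RingHom.⟦_⟧ constants a))
            (Evaluation.eval-X (compose constHom (valueAt s)) X) p)
      (eval-variable commutativeRing p))

    evaluate-at-0 : ∀ y p → y ≈ 0# → RingHom.⟦_⟧ (evaluate y) p ≈ coeff p 0
    evaluate-at-0 y []      e = refl
    evaluate-at-0 y (a ∷ p) e = trans (+-congˡ (trans (*-congʳ e) (zeroˡ _))) (+-identityʳ a)

    evaluate-respects : ∀ {y z} p → y ≈ z → RingHom.⟦_⟧ (evaluate y) p ≈ RingHom.⟦_⟧ (evaluate z) p
    evaluate-respects p e = eval-respects (identity commutativeRing) (identity commutativeRing) (λ a → refl) e p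

    module _ (henselian : BtHenselian K τ) (L : List (Carrier × Carrier)) (fib : Fibre (Zeros⊆ L)) where
      open Fibre fib using (ps; α; k; b; s; t; smooth; property; α≉0; t₀≉0; ps-bound; t-bound; b+s≤k; coprime;
          F)
      private
        n = length ps
        m = monomial α (2 ℕ.+ k)
        d = n ℕ.* (2 ℕ.+ k)

      monomial-lead : Lead (2 ℕ.+ k) α m
      monomial-lead = ≡.subst (λ i → Lead i α m) (ℕₚ.*-identityʳ (2 ℕ.+ k))
        (Lead-resp (trans (*-congˡ (ones (2 ℕ.+ k))) (*-identityʳ α)) ≋-refl
            (Lead-⊗ (const α) (X ^ᴾ (2 ℕ.+ k)) (Lead-const α) (Lead-^ X (2 ℕ.+ k) Lead-X)))
        where
        ones : ∀ n → 1# ^ n ≈ 1#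
        ones zero    = refl
        ones (suc n) = trans (*-identityˡ _) (ones n)

      -- Here `x̂ / t̂` is `w + s` with the denominator cleared. The summand `s t` has smaller
      -- degree than `α y ^ (2 + k)`, so the leading coefficient `α ^ n` does not depend on `s`, and
      -- dividing by it makes `F̃` monic for all `s` at once.
      t̂ x̂ F̂ F̃ : List C.Carrier
      t̂ = ι t
      x̂ = ι m PC.⊕ PC.const parameter PC.⊗ t̂
      p̂s : List (List C.Carrier)
      p̂s = List.map ι ps
      F̂ = Homogenisation.homogenise PC.polynomialRing x̂ t̂ p̂s PC.𝟙

      inverse-lead : ∃ λ β → α ^ n * β ≈ 1#
      inverse-lead = inverse (α ^ n) (power-nonzero α n α≉0)
      β = proj₁ inverse-lead
      β̂ : C.Carrier
      β̂ = RingHom.⟦_⟧ constants β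
      F̃ = PC.const β̂ PC.⊗ F̂

      t̂-lead : PC.Lead s C.0# t̂
      t̂-lead = PC.Lead-resp (RingHom.0-homo constants) PC.≋-refl (PolynomialMap.Lead-map constants t-bound)

      x̂-lead : PC.Lead (2 ℕ.+ k) (RingHom.⟦_⟧ constants α) x̂
      x̂-lead = PC.Lead-resp (C.+-identityʳ (RingHom.⟦_⟧ constants α)) PC.≋-refl
          (PC.Lead-⊕ {p = ι m} {q = PC.const parameter PC.⊗ t̂} (PolynomialMap.Lead-map constants monomial-lead)
        (PC.Lead-0-weaken (ℕₚ.≤-trans (ℕₚ.m≤n+m s b) b+s≤k)
          (PC.Lead-resp (C.zeroʳ parameter) PC.≋-refl
              (PC.Lead-⊗ (PC.const parameter) t̂ (PC.Lead-const parameter) t̂-lead))))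

      p̂s-lead : ∀ {ps} → All (Lead b 0#) ps → All (PC.Lead b C.0#) (List.map ι ps)
      p̂s-lead []       = []
      p̂s-lead (l ∷ ls) = PC.Lead-resp (RingHom.0-homo constants) PC.≋-refl (PolynomialMap.Lead-map constants l)
          ∷ p̂s-lead ls

      map-length : ∀ (ps : List (List Carrier)) → length (List.map ι ps) ≡ length ps
      map-length []       = ≡.refl
      map-length (p ∷ ps) = ≡.cong suc (map-length ps)

      F̃-lead : PC.Lead d C.1# F̃
      F̃-lead = ≡.subst (λ i → PC.Lead (i ℕ.* (2 ℕ.+ k)) C.1# F̃) (map-length ps)
        (PC.Lead-resp (everywhere λ s → trans (*-congˡ (sym (RingHom.^-homo constants α (length p̂s) .value s)))
                        (trans (*-congˡ (reflexive (≡.cong (α ^_) (map-length ps))))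
                            (trans (*-comm β _) (proj₂ inverse-lead))))
          PC.≋-refl (PC.Lead-⊗ (PC.const β̂) F̂ (PC.Lead-const β̂)
            (HomogenisationDegree.Lead-homogenise continuousFunctions x̂ t̂ x̂-lead t̂-lead b+s≤k p̂s
                (p̂s-lead ps-bound))))

      f : Carrier → List Carrier
      f s = specialise s F̃

      f-lead : ∀ s → Lead d 1# (f s)
      f-lead s = PolynomialMap.Lead-map (valueAt s) F̃-lead

      f-special : f 0# ≋ const β ⊗ F
      f-special = ≋-trans (M.*-homo (PC.const β̂) F̂) (mul-cong₂ constant
          (homogenise-map (PolynomialMap.mapHom (valueAt 0#)) {x̂} {t̂} {PC.𝟙} x-special (map-ι 0# t) M.1-homo
              (specials ps)))
        where
        module M = RingHom (PolynomialMap.mapHom (valueAt 0#))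
        constant : M.⟦ PC.const β̂ ⟧ ≋ const β
        constant = Evaluation.eval-const (compose constHom (valueAt 0#)) X β̂
        x-special : M.⟦ x̂ ⟧ ≋ m
        x-special = ≋-trans (M.+-homo (ι m) (PC.const parameter PC.⊗ t̂)) (≋-trans
          (add-cong (map-ι 0# m) (≋-trans (M.*-homo (PC.const parameter) t̂)
            (mul-null _ (M.⟦ t̂ ⟧) (≋-trans (Evaluation.eval-const (compose constHom (valueAt 0#)) X parameter)
                0∷[])))) (add-identityʳ m))
        specials : ∀ ps → Pointwise (λ p q → M.⟦ p ⟧ ≋ q) (List.map ι ps) ps
        specials []       = Pointwise.[]
        specials (p ∷ ps) = map-ι 0# p Pointwise.∷ specials ps

      special-separable : Combinations polynomialRing (f 0#) (derivative (f 0#)) 𝟙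
      special-separable = let U , V , e = coprime in
        const γ ⊗ U , const γ ⊗ V ,
        ≋-trans e (≋-trans (add-cong (mul-congʳ U F≋) (mul-congʳ V (≋-trans (derivative-cong F≋)
            (≋-trans (derivative-cong (const-⊗ γ (f 0#)))
                (≋-trans (derivative-scale γ (f 0#)) (≋-sym (const-⊗ γ (derivative (f 0#)))))))))
          (solveᴬ 5 (λ U V g F F′ → U :* (g :* F) :+ V :* (g :* F′) := g :* U :* F :+ g :* V :* F′) ≋-refl
            U V (const γ) (f 0#) (derivative (f 0#))))
        where
        γ = α ^ n
        F≋ : F ≋ const γ ⊗ f 0#
        F≋ = ≋-sym (≋-trans (mul-congʳ (const γ) f-special) (≋-trans (≋-sym (mul-assoc (const γ) (const β) F))
          (≋-trans (mul-congˡ F (≋-trans (≋-sym (RingHom.*-homo constHom γ β))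
              (const-cong (proj₂ inverse-lead)))) (mul-identityˡ F))))

      special-root : coeff (f 0#) 0 ≈ 0#
      special-root = trans (f-special .at 0)
          (trans (coeff-const-⊗ β F 0) (trans (*-congˡ (vanishes ps smooth)) (zeroʳ β)))
        where
        vanishes : ∀ ps → Smooth (monic ps) → coeff (homogenise m t ps 𝟙) 0 ≈ 0#
        vanishes []       sm = ⊥-elim (0≉1 (sym (proj₁ sm)))
        vanishes (p ∷ ps) sm = coeff-homogenise-0 p ps sm α k t

      root : ∀ s → Defsᴾ.HasRoot (Defsᴾ.monic (coefficients d (f s))) → ∃ λ y → RingHom.⟦_⟧ (pair s y) F̂ ≈ 0#
      root s (y , e) = y , Units.unit-cancel commutativeRing (α ^ n , trans (*-comm β _) (proj₂ inverse-lead))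
        (trans (*-congʳ (sym (Evaluation.eval-const (valueAt s) y β̂)))
        (trans (sym (RingHom.*-homo (pair s y) (PC.const β̂) F̂)) (trans (sym (evaluate-map s y F̃))
        (trans (RingHom.cong (evaluate y) (≋-sym (monic-coefficients d (f s) (f-lead s))))
          (trans (sym (reflexive (evalP-≡ (Defsᴾ.monic (coefficients d (f s))) y))) e)))))

      mᵛ tᵛ : Carrier → Carrier
      mᵛ y = RingHom.⟦_⟧ (evaluate y) m
      tᵛ y = RingHom.⟦_⟧ (evaluate y) t

      x̂-value : ∀ s y → RingHom.⟦_⟧ (pair s y) x̂ ≈ mᵛ y + s * tᵛ y
      x̂-value s y = trans (P.+-homo (ι m) (PC.const parameter PC.⊗ t̂)) (+-cong (pair-ι s y m)
        (trans (P.*-homo (PC.const parameter) t̂)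
            (*-cong (Evaluation.eval-const (valueAt s) y parameter) (pair-ι s y t))))
        where module P = RingHom (pair s y)

      -- At a zero of `t` the form reduces to a power of `α y ^ (2 + k)`, which vanishes only for
      -- `y = 0`, and `t(0) ≠ 0`.
      denominator-nonzero : ∀ s y → RingHom.⟦_⟧ (pair s y) F̂ ≈ 0# → ¬ (tᵛ y ≈ 0#)
      denominator-nonzero s y e t≈0 = (lem (y ≈ 0#) >>= λ where
          (inj₁ y≈0) → ⊥-elim (t₀≉0 (trans (sym (evaluate-at-0 y t y≈0)) t≈0))
          (inj₂ y≉0) → ⊥-elim (power-nonzero _ (length p̂s) (m≉0 y≉0) power≈0)) λ x → x
        where
        module P = RingHom (pair s y)
        g = proj₁ (Homogenisation.homogenise-split PC.polynomialRing x̂ t̂ p̂s)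
        m≉0 : ¬ (y ≈ 0#) → ¬ (P.⟦ x̂ ⟧ ≈ 0#)
        m≉0 y≉0 z = *-nonzero α (y ^ (2 ℕ.+ k)) α≉0 (power-nonzero y (2 ℕ.+ k) y≉0)
          (trans (sym (trans (RingHom.*-homo (evaluate y) (const α) (X ^ᴾ (2 ℕ.+ k)))
                   (*-cong (Evaluation.eval-const (identity commutativeRing) y α)
                       (trans (RingHom.^-homo (evaluate y) X (2 ℕ.+ k)) (powers (2 ℕ.+ k))))))
          (trans (solve 2 (λ m w → m := (m :+ w) :+ :- w) refl (mᵛ y) (s * tᵛ y))
          (trans (+-cong (trans (sym (x̂-value s y)) z) (-‿cong (trans (*-congˡ t≈0) (zeroʳ s))))
              (-‿inverseʳ 0#))))
          where
          powers : ∀ n → RingHom.⟦_⟧ (evaluate y) X ^ n ≈ y ^ n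
          powers zero    = refl
          powers (suc n) = *-cong (Evaluation.eval-X (identity commutativeRing) y) (powers n)
        power≈0 : P.⟦ x̂ ⟧ ^ length p̂s ≈ 0#
        power≈0 = trans (sym (P.^-homo x̂ (length p̂s))) (trans (sym (+-identityʳ _))
          (trans (+-congˡ (sym (trans (P.*-homo t̂ g) (trans (*-congʳ (trans (pair-ι s y t) t≈0)) (zeroˡ _)))))
          (trans (sym (P.+-homo (x̂ PC.^ᴾ length p̂s) (t̂ PC.⊗ g)))
              (trans (P.cong (PC.≋-sym (proj₂ (Homogenisation.homogenise-split PC.polynomialRing x̂ t̂ p̂s))))
              e))))

      point : ∀ s y σ → RingHom.⟦_⟧ (pair s y) F̂ ≈ 0# → tᵛ y * σ ≈ 1# →
          RingHom.⟦_⟧ (evaluate₂ ((mᵛ y + s * tᵛ y) * σ) y) (monic ps) ≈ 0#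
      point s y σ e tσ≈1 = trans (sym (same ps)) (Units.unit-cancel commutativeRing
          (Units.unit-^ commutativeRing (length p̂s) (σ , t̂σ≈1))
          (trans (sym (Homogenisation.homogenise-unit PC.polynomialRing (pair s y) x̂ t̂ σ t̂σ≈1 p̂s PC.𝟙)) e))
        where
        t̂σ≈1 : RingHom.⟦_⟧ (pair s y) t̂ * σ ≈ 1#
        t̂σ≈1 = trans (*-congʳ (pair-ι s y t)) tσ≈1
        same : ∀ ps → Evaluation.eval (pair s y) (RingHom.⟦_⟧ (pair s y) x̂ * σ) (List.map ι ps ++ PC.𝟙 ∷ []) ≈
                      RingHom.⟦_⟧ (evaluate₂ ((mᵛ y + s * tᵛ y) * σ) y) (monic ps)
        same []       = +-cong (trans (RingHom.1-homo (pair s y)) (sym (RingHom.1-homo (evaluate y))))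
            (*-congʳ (*-congʳ (x̂-value s y)))
        same (p ∷ ps) = +-cong (pair-ι s y p) (*-cong (*-congʳ (x̂-value s y)) (same ps))

      -- A point `(u , v)` arises only from `s = u − m(v) / t(v)`, and from no `s` at all if
      -- `t(v) = 0`, since `t` is invertible at the roots considered.
      parameters : ∀ L → ¬ ¬ (∃ λ S → ∀ s y σ → tᵛ y * σ ≈ 1# →
        Any (λ z → (mᵛ y + s * tᵛ y) * σ ≈ proj₁ z × y ≈ proj₂ z) L → Any (s ≈_) S)
      parameters []            = return ([] , λ _ _ _ _ ())
      parameters ((u , v) ∷ L) = parameters L >>= λ (S , h) → lem (tᵛ v ≈ 0#) >>= λ where
          (inj₁ tv≈0) → return (S , λ
            { s y σ tσ≈1 (here (_ , y≈v)) →
                ⊥-elim (0≉1 (trans (sym (zeroˡ σ))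
                (trans (*-congʳ (sym (trans (evaluate-respects t y≈v) tv≈0))) tσ≈1)))
            ; s y σ tσ≈1 (there z) → h s y σ tσ≈1 z })
          (inj₂ tv≉0) → let ρ , tρ≈1 = inverse (tᵛ v) tv≉0 in return (u + - (mᵛ v * ρ) ∷ S , λ
            { s y σ tσ≈1 (here (x≈u , y≈v)) → here (determined s y σ ρ tσ≈1 x≈u y≈v tρ≈1)
            ; s y σ tσ≈1 (there z) → there (h s y σ tσ≈1 z) })
        where
        determined : ∀ s y σ ρ → tᵛ y * σ ≈ 1# → (mᵛ y + s * tᵛ y) * σ ≈ u → y ≈ v → tᵛ v * ρ ≈ 1# →
            s ≈ u + - (mᵛ v * ρ)
        determined s y σ ρ tσ≈1 x≈u y≈v tρ≈1 = trans (sym (*-identityʳ s)) (trans (*-congˡ (sym tσ≈1))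
          (trans (solve 4 (λ s t σ m → s :* (t :* σ) := (m :+ s :* t) :* σ :+ :- (m :* σ)) refl s (tᵛ y) σ
              (mᵛ y))
          (+-cong x≈u (-‿cong (*-cong (evaluate-respects m y≈v) σ≈ρ)))))
          where
          σ≈ρ : σ ≈ ρ
          σ≈ρ = trans (sym (*-identityˡ σ))
              (trans (*-congʳ (sym tρ≈1)) (trans
              (solve 3 (λ t ρ σ → t :* ρ :* σ := ρ :* (t :* σ)) refl (tᵛ v) ρ σ)
            (trans (*-congˡ (trans (*-congʳ (evaluate-respects t (sym y≈v))) tσ≈1)) (*-identityʳ ρ))))

      zeros-not-finite : ⊥
      zeros-not-finite = parameters L λ (S , h) →
        let q = coefficients d (f 0#)
            special≋ = monic-coefficients d (f 0#) (f-lead 0#)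
            U , U-open , U-contains , box = henselian d q
              (separable-from (f 0#) special≋ special-separable)
              (0# , trans (reflexive (evalP-≡ (Defsᴾ.monic q) 0#))
                  (trans (RingHom.cong (evaluate 0#) special≋)
                  (trans (evaluate-at-0 0# (f 0#) refl) special-root)))
            member : ∀ s i → U i (proj₁ (PC.coeff F̃ (toℕ i)) s) → U i (Vec.lookup (coefficients d (f s)) i)
            member = λ s i u → open-resp (U-open i)
                (trans (sym (PolynomialMap.coeff-map (valueAt s) F̃ (toℕ i)))
                (reflexive (≡.sym (Vecₚ.lookup∘tabulate _ i)))) u
            -- Each coefficient of `F̃` carries its own proof of continuity, which pulls the `i`-th
            -- side of the box back to a neighbourhood of `s = 0`.
            nearby = λ i → proj₂ (PC.coeff F̃ (toℕ i)) (U i) (U-open i)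
              (open-resp (U-open i) (trans (reflexive (Vecₚ.lookup∘tabulate _ i))
                  (PolynomialMap.coeff-map (valueAt 0#) F̃ (toℕ i))) (U-contains i))
            V , V-open , V0 , V⊆ = intersection d (λ i → proj₁ (nearby i)) (λ i → proj₁ (proj₂ (nearby i)))
                (λ i → proj₁ (proj₂ (proj₂ (nearby i))))
        in neighbourhood-infinite S V V-open V0 λ s Vs →
          let y , e = root s (box (coefficients d (f s)) (λ i → member s i (proj₂ (proj₂ (proj₂ (nearby i))) s (V⊆ s Vs i))))
              σ , tσ≈1 = inverse (tᵛ y) (denominator-nonzero s y e)
          in h s y σ tσ≈1 (property _ y (point s y σ e tσ≈1))

theorem2p9 : ∀ {c ℓ t : Level} (K : Field c ℓ) (τ : FieldTopology K t) →
    BtHenselian K τ → Large K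
theorem2p9 K τ henselian P a b vanishes simple (L , finite) =
  FieldTheory.Preparation.prepared K a b P vanishes simple λ (ps , smooth , zeros) →
  FieldTheory.fibre K (FieldTheory.Topology.Zeros⊆ K τ _) (FieldTheory.Topology.Zeros⊆-factor K τ _) ps smooth
    (FieldTheory.Preparation.prepared-zeros K a b P vanishes simple L
      -- The identity only restates the predicate of `FiniteSubset` with projections in place of
      -- pattern matching.
      (λ x y e → Any.map (λ z → z) (finite x y e)) ps zeros) λ fib →
  FieldTheory.Topology.zeros-not-finite K τ henselian _ fib
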